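{- Let $f\in\mathbb{Q}[t]\setminus\mathbb{Q}$ with $\deg f\leq 4$, and assume that $f$ has at least two different complex roots. Let $\mathcal{E}_{f}: y^2=x^3+f(t)x$. (1) If $\deg f\leq 3$, then there exists a rational base change $t=\phi(s)$ such that there is a non-torsion section on the surface $\mathcal{E}_{f\circ\phi}: y^2=x^3+f(\phi(s))x$. (2) If $\deg f=4$ and there is $t_{0}\in\mathbb{Q}$ such that the curve $E_{t_{0}}: y^2=x^3+f(t_{0})x$ has infinitely many rational points, then there exists a rational base change $t=\psi(r)$ such that there is a non-torsion section on the surface $\mathcal{E}_{f\circ\psi}: y^2=x^3+f(\psi(r))x$.
   Context: A rational base change $t=\phi(s)$ is a non-constant rational function $\phi\in\mathbb{Q}(s)$. A section on a surface $y^2=x^3+A(s)x+B(s)$ with $A,B\in\mathbb{Q}(s)$ (defined over $\mathbb{Q}$) is a point of this elliptic curve with coordinates in $\mathbb{Q}(s)$ (or the point at infinity); it is non-torsion if it has infinite order in the group of $\mathbb{Q}(s)$-rational points of this elliptic curve over $\mathbb{Q}(s)$. -}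

module Defs where

open import Level using (0ℓ)
open import Algebra.Bundles.Raw using (RawRing)
open import Data.List.Base using (List; []; _∷_; map)
open import Data.Nat.Base as ℕ using (ℕ; zero; suc)
import Data.Nat.Properties as ℕₚ
open import Data.Product.Base using (Σ; ∃; ∃₂; _×_; _,_; proj₁; proj₂)
open import Data.Rational.Base as ℚ using (ℚ; 0ℚ; 1ℚ; ½; _+_; _*_; _-_; -_; ∣_∣; _<_; _≤_; 1/_; Positive; positive)
import Data.Rational.Properties as ℚₚ
open import Data.Rational.Solver using (module +-*-Solver)
open import Data.Unit.Base using (⊤)
open import Function.Definitions using (Injective)
open import Relation.Binary.PropositionalEquality
open import Relation.Nullary using (¬_; Dec; yes; no)

-- Coefficient lists, constant term first; trailing zeros are allowed, so
-- equality of polynomials is _≈ₚ_ and not _≡_.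
Poly : Set
Poly = List ℚ

coeff : Poly → ℕ → ℚ
coeff []      _       = 0ℚ
coeff (a ∷ p) zero    = a
coeff (a ∷ p) (suc i) = coeff p i

infix 4 _≈ₚ_
_≈ₚ_ : Poly → Poly → Set
p ≈ₚ q = ∀ i → coeff p i ≡ coeff q i

0ₚ 1ₚ : Poly
0ₚ = []
1ₚ = 1ℚ ∷ []

const : ℚ → Poly
const c = c ∷ []

infixl 6 _+ₚ_
_+ₚ_ : Poly → Poly → Poly
[]      +ₚ q       = q
(a ∷ p) +ₚ []      = a ∷ p
(a ∷ p) +ₚ (b ∷ q) = (a + b) ∷ (p +ₚ q)

infix 8 -ₚ_
-ₚ_ : Poly → Poly
-ₚ p = map -_ p

scale : ℚ → Poly → Poly
scale c p = map (c *_) p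

infixl 7 _*ₚ_
_*ₚ_ : Poly → Poly → Poly
[]      *ₚ q = []
(a ∷ p) *ₚ q = scale a q +ₚ (0ℚ ∷ (p *ₚ q))

-- The zero polynomial satisfies deg≤ n for every n.
deg≤ : ℕ → Poly → Set
deg≤ n p = ∀ i → n ℕ.< i → coeff p i ≡ 0ℚ

deg≡ : ℕ → Poly → Set
deg≡ n p = coeff p n ≢ 0ℚ × deg≤ n p

NonConstantPoly : Poly → Set
NonConstantPoly p = ¬ ∃ λ c → p ≈ₚ const c

-- Value p(x) in a ring R receiving ℚ through ι.
eval : (R : RawRing 0ℓ 0ℓ) → (ℚ → RawRing.Carrier R) → Poly → RawRing.Carrier R → RawRing.Carrier R
eval R ι []      x = RawRing.0# R
eval R ι (a ∷ p) x = ι a R.+ x R.* eval R ι p x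
  where module R = RawRing R

evalℚ : Poly → ℚ → ℚ
evalℚ = eval ℚ.+-*-rawRing (λ c → c)

zero? : ∀ p → Dec (p ≈ₚ 0ₚ)
zero? [] = yes λ _ → refl
zero? (a ∷ p) with a ℚₚ.≟ 0ℚ | zero? p
... | yes a≡0 | yes p≈0 = yes λ { zero → a≡0 ; (suc i) → p≈0 i }
... | no  a≢0 | _       = no λ h → a≢0 (h 0)
... | yes _   | no p≉0  = no λ h → p≉0 (λ i → h (suc i))

coeff-+ : ∀ p q i → coeff (p +ₚ q) i ≡ coeff p i + coeff q i
coeff-+ []      q       i       = sym (ℚₚ.+-identityˡ (coeff q i))
coeff-+ (a ∷ p) []      i       = sym (ℚₚ.+-identityʳ (coeff (a ∷ p) i))
coeff-+ (a ∷ p) (b ∷ q) zero    = refl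
coeff-+ (a ∷ p) (b ∷ q) (suc i) = coeff-+ p q i

coeff-scale : ∀ c p i → coeff (scale c p) i ≡ c * coeff p i
coeff-scale c []      i       = sym (ℚₚ.*-zeroʳ c)
coeff-scale c (a ∷ p) zero    = refl
coeff-scale c (a ∷ p) (suc i) = coeff-scale c p i

coeff-∷* : ∀ a p q i → coeff ((a ∷ p) *ₚ q) i ≡ a * coeff q i + coeff (0ℚ ∷ (p *ₚ q)) i
coeff-∷* a p q i = trans (coeff-+ (scale a q) _ i) (cong (_+ coeff (0ℚ ∷ (p *ₚ q)) i) (coeff-scale a q i))

0∷*-suc : ∀ p q i → coeff ((0ℚ ∷ p) *ₚ q) (suc i) ≡ coeff (p *ₚ q) i
0∷*-suc p q i = trans (coeff-∷* 0ℚ p q (suc i))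
  (trans (cong (_+ coeff (p *ₚ q) i) (ℚₚ.*-zeroˡ (coeff q (suc i)))) (ℚₚ.+-identityˡ _))

*0∷-zero : ∀ p q → coeff (p *ₚ (0ℚ ∷ q)) 0 ≡ 0ℚ
*0∷-zero []      q = refl
*0∷-zero (a ∷ p) q = trans (coeff-∷* a p (0ℚ ∷ q) 0) (trans (ℚₚ.+-identityʳ _) (ℚₚ.*-zeroʳ a))

*0∷-suc : ∀ p q i → coeff (p *ₚ (0ℚ ∷ q)) (suc i) ≡ coeff (p *ₚ q) i
*0∷-suc []      q i = refl
*0∷-suc (a ∷ p) q i = trans (coeff-∷* a p (0ℚ ∷ q) (suc i))
  (trans (cong (a * coeff q i +_) (shift i)) (sym (coeff-∷* a p q i)))
  where
  shift : ∀ i → coeff (p *ₚ (0ℚ ∷ q)) i ≡ coeff (0ℚ ∷ (p *ₚ q)) i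
  shift zero    = *0∷-zero p q
  shift (suc i) = *0∷-suc p q i

*-nonZeroℚ : ∀ a b → a ≢ 0ℚ → a * b ≡ 0ℚ → b ≡ 0ℚ
*-nonZeroℚ a b a≢0 ab≡0 = begin
  b               ≡⟨ ℚₚ.*-identityˡ b ⟨
  1ℚ * b          ≡⟨ cong (_* b) (ℚₚ.*-inverseˡ a) ⟨
  (1/ a * a) * b  ≡⟨ ℚₚ.*-assoc (1/ a) a b ⟩
  1/ a * (a * b)  ≡⟨ cong (1/ a *_) ab≡0 ⟩
  1/ a * 0ℚ       ≡⟨ ℚₚ.*-zeroʳ (1/ a) ⟩
  0ℚ              ∎
  where
  open ≡-Reasoning
  instance _ = ℚ.≢-nonZero a≢0

*ₚ-nonZero : ∀ p q → ¬ p ≈ₚ 0ₚ → ¬ q ≈ₚ 0ₚ → ¬ p *ₚ q ≈ₚ 0ₚ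
*ₚ-nonZero []      q p≉0 q≉0 pq≈0 = p≉0 λ _ → refl
*ₚ-nonZero (a ∷ p) q p≉0 q≉0 pq≈0 with a ℚₚ.≟ 0ℚ
... | yes refl = *ₚ-nonZero p q
  (λ p≈0 → p≉0 λ { zero → refl ; (suc i) → p≈0 i }) q≉0
  (λ i → trans (sym (0∷*-suc p q i)) (pq≈0 (suc i)))
... | no a≢0 = q≉0 (go q pq≈0)
  where
  go : ∀ q → (a ∷ p) *ₚ q ≈ₚ 0ₚ → q ≈ₚ 0ₚ
  go []      h = λ _ → refl
  go (b ∷ q) h with b≡0 ← *-nonZeroℚ a b a≢0
                     (trans (sym (ℚₚ.+-identityʳ (a * b))) (trans (sym (coeff-∷* a p (b ∷ q) 0)) (h 0)))
               with refl ← b≡0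
               = λ { zero → refl ; (suc i) → go q (λ j → trans (sym (*0∷-suc (a ∷ p) q j)) (h (suc j))) i }

record RatFun : Set where
  constructor _/_[_]
  field
    num   : Poly
    den   : Poly
    den≉0 : ¬ den ≈ₚ 0ₚ
open RatFun public

1ₚ≉0ₚ : ¬ 1ₚ ≈ₚ 0ₚ
1ₚ≉0ₚ h with () ← h 0

constᶠ : ℚ → RatFun
constᶠ c = const c / 1ₚ [ 1ₚ≉0ₚ ]

infix 4 _≈ᶠ_
_≈ᶠ_ : RatFun → RatFun → Set
x ≈ᶠ y = num x *ₚ den y ≈ₚ num y *ₚ den x

IsZeroᶠ : RatFun → Set
IsZeroᶠ x = num x ≈ₚ 0ₚ

infixl 6 _+ᶠ_ _-ᶠ_
infixl 7 _*ᶠ_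
infix  8 -ᶠ_

_+ᶠ_ _*ᶠ_ : RatFun → RatFun → RatFun
x +ᶠ y = (num x *ₚ den y +ₚ num y *ₚ den x) / (den x *ₚ den y) [ *ₚ-nonZero (den x) (den y) (den≉0 x) (den≉0 y) ]
x *ᶠ y = (num x *ₚ num y) / (den x *ₚ den y) [ *ₚ-nonZero (den x) (den y) (den≉0 x) (den≉0 y) ]

-ᶠ_ : RatFun → RatFun
-ᶠ x = (-ₚ num x) / den x [ den≉0 x ]

_-ᶠ_ : RatFun → RatFun → RatFun
x -ᶠ y = x +ᶠ (-ᶠ y)

inv : (x : RatFun) → ¬ IsZeroᶠ x → RatFun
inv x x≉0 = den x / num x [ x≉0 ]

RatFun-rawRing : RawRing 0ℓ 0ℓ
RatFun-rawRing = record
  { Carrier = RatFun ; _≈_ = _≈ᶠ_ ; _+_ = _+ᶠ_ ; _*_ = _*ᶠ_ ; -_ = -ᶠ_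
  ; 0# = constᶠ 0ℚ ; 1# = constᶠ 1ℚ }

NonConstant : RatFun → Set
NonConstant φ = ¬ ∃ λ c → φ ≈ᶠ constᶠ c

infixr 9 _∘ᶠ_
_∘ᶠ_ : Poly → RatFun → RatFun
f ∘ᶠ φ = eval RatFun-rawRing constᶠ f φ

OnWeierstrass : (R : RawRing 0ℓ 0ℓ) (A B x y : RawRing.Carrier R) → Set
OnWeierstrass R A B x y = y R.* y R.≈ x R.* x R.* x R.+ A R.* x R.+ B
  where module R = RawRing R

record Curve : Set where
  constructor y²=x³+_x+_
  field
    A B : RatFun

data Point : Set where
  O   : Point
  aff : (x y : RatFun) → Point

_∈ᴱ_ : Point → Curve → Set
O       ∈ᴱ E = ⊤
aff x y ∈ᴱ E = OnWeierstrass RatFun-rawRing (Curve.A E) (Curve.B E) x y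

Section : Curve → Set
Section E = Σ Point (_∈ᴱ E)

-- Reflection in the x-axis of the third intersection point of the curve with
-- the line of slope m through (x₁ , y₁) that also meets it at abscissa x₂.
thirdPoint : (m x₁ y₁ x₂ : RatFun) → Point
thirdPoint m x₁ y₁ x₂ = aff x₃ (m *ᶠ (x₁ -ᶠ x₃) -ᶠ y₁)
  where x₃ = m *ᶠ m -ᶠ x₁ -ᶠ x₂

-- The chord-tangent group law (only the coefficient A enters the formulas).
-- If x₁ = x₂ then y₁ = ± y₂ for points of the curve; so if moreover
-- y₁ + y₂ ≠ 0, the points coincide and y₁ + y₂ = 2y₁ is the denominator of
-- the slope of the tangent.
addAff : (A x₁ y₁ x₂ y₂ : RatFun) → Dec (IsZeroᶠ (x₂ -ᶠ x₁)) → Dec (IsZeroᶠ (y₁ +ᶠ y₂)) → Point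
addAff A x₁ y₁ x₂ y₂ (no x₁≉x₂) _ =
  thirdPoint ((y₂ -ᶠ y₁) *ᶠ inv (x₂ -ᶠ x₁) x₁≉x₂) x₁ y₁ x₂
addAff A x₁ y₁ x₂ y₂ (yes _) (yes _) = O
addAff A x₁ y₁ x₂ y₂ (yes _) (no y₁≉-y₂) =
  thirdPoint ((x₁ *ᶠ x₁ +ᶠ x₁ *ᶠ x₁ +ᶠ x₁ *ᶠ x₁ +ᶠ A) *ᶠ inv (y₁ +ᶠ y₂) y₁≉-y₂) x₁ y₁ x₂

add : Curve → Point → Point → Point
add E O           Q           = Q
add E (aff x₁ y₁) O           = aff x₁ y₁
add E (aff x₁ y₁) (aff x₂ y₂) =
  addAff (Curve.A E) x₁ y₁ x₂ y₂ (zero? (num (x₂ -ᶠ x₁))) (zero? (num (y₁ +ᶠ y₂)))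

multiple : Curve → ℕ → Point → Point
multiple E zero    P = O
multiple E (suc n) P = add E P (multiple E n P)

NonTorsion : (E : Curve) → Section E → Set
NonTorsion E (P , _) = ∀ n → n ≢ 0 → multiple E n P ≢ O

HasNonTorsionSection : Curve → Set
HasNonTorsionSection E = Σ (Section E) (NonTorsion E)

ℰ : RatFun → Curve
ℰ g = y²=x³+ g x+ constᶠ 0ℚ

-- Affine points of y² = x³ + c x: the point at infinity is irrelevant for
-- infinitude. The singular case c = 0 is allowed.
InfinitelyManyRationalPoints : ℚ → Set
InfinitelyManyRationalPoints c =
  Σ (ℕ → ℚ × ℚ) λ P → Injective _≡_ _≡_ P ×
    (∀ n → OnWeierstrass ℚ.+-*-rawRing c 0ℚ (proj₁ (P n)) (proj₂ (P n)))

-- ℝ is the setoid of Cauchy sequences of rationals modulo null sequences.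
IsCauchy : (ℕ → ℚ) → Set
IsCauchy x = ∀ ε → 0ℚ < ε → ∃ λ N → ∀ m n → N ℕ.≤ m → N ℕ.≤ n → ∣ x m - x n ∣ < ε

record ℝ : Set where
  constructor mkℝ
  field
    seq    : ℕ → ℚ
    cauchy : IsCauchy seq
open ℝ public

infix 4 _≈ᴿ_
_≈ᴿ_ : ℝ → ℝ → Set
x ≈ᴿ y = ∀ ε → 0ℚ < ε → ∃ λ N → ∀ n → N ℕ.≤ n → ∣ seq x n - seq y n ∣ < ε

½+½ : ∀ ε → ½ * ε + ½ * ε ≡ ε
½+½ ε = trans (sym (ℚₚ.*-distribʳ-+ ε ½ ½)) (ℚₚ.*-identityˡ ε)

*-pos : ∀ {p q} → 0ℚ < p → 0ℚ < q → 0ℚ < p * q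
*-pos {p} {q} 0<p 0<q = ℚₚ.positive⁻¹ (p * q) {{ℚₚ.pos*pos⇒pos p {{positive 0<p}} q {{positive 0<q}}}}

half-pos : ∀ {ε} → 0ℚ < ε → 0ℚ < ½ * ε
half-pos = *-pos (ℚₚ.positive⁻¹ ½)

constᴿ : ℚ → ℝ
constᴿ c = mkℝ (λ _ → c) λ ε 0<ε → 0 , λ _ _ _ _ →
  subst (_< ε) (sym (cong ∣_∣ (ℚₚ.+-inverseʳ c))) 0<ε

infixl 6 _+ᴿ_
infixl 7 _*ᴿ_
infix  8 -ᴿ_

_+ᴿ_ : ℝ → ℝ → ℝ
x +ᴿ y = mkℝ (λ n → seq x n + seq y n) pf
  where
  open +-*-Solver
  rearrange : ∀ a b c d → (a + b) - (c + d) ≡ (a - c) + (b - d)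
  rearrange = solve 4 (λ a b c d → (a :+ b) :+ (:- (c :+ d)) := (a :+ (:- c)) :+ (b :+ (:- d))) refl

  pf : IsCauchy (λ n → seq x n + seq y n)
  pf ε 0<ε with cauchy x (½ * ε) (half-pos 0<ε) | cauchy y (½ * ε) (half-pos 0<ε)
  ... | M , hx | N , hy = M ℕ.⊔ N , λ m n l l′ → begin-strict
    ∣ (seq x m + seq y m) - (seq x n + seq y n) ∣
      ≡⟨ cong ∣_∣ (rearrange (seq x m) (seq y m) (seq x n) (seq y n)) ⟩
    ∣ (seq x m - seq x n) + (seq y m - seq y n) ∣
      ≤⟨ ℚₚ.∣p+q∣≤∣p∣+∣q∣ (seq x m - seq x n) (seq y m - seq y n) ⟩
    ∣ seq x m - seq x n ∣ + ∣ seq y m - seq y n ∣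
      <⟨ ℚₚ.+-mono-< (hx m n (ℕₚ.m⊔n≤o⇒m≤o M N l) (ℕₚ.m⊔n≤o⇒m≤o M N l′))
                     (hy m n (ℕₚ.m⊔n≤o⇒n≤o M N l) (ℕₚ.m⊔n≤o⇒n≤o M N l′)) ⟩
    ½ * ε + ½ * ε
      ≡⟨ ½+½ ε ⟩
    ε ∎
    where open ℚₚ.≤-Reasoning

-ᴿ_ : ℝ → ℝ
-ᴿ x = mkℝ (λ n → - seq x n) pf
  where
  open +-*-Solver
  rearrange : ∀ a b → (- a) - (- b) ≡ - (a - b)
  rearrange = solve 2 (λ a b → (:- a) :+ (:- (:- b)) := :- (a :+ (:- b))) refl

  pf : IsCauchy (λ n → - seq x n)
  pf ε 0<ε with cauchy x ε 0<ε
  ... | N , h = N , λ m n l l′ → subst (_< ε)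
    (sym (trans (cong ∣_∣ (rearrange (seq x m) (seq x n))) (ℚₚ.∣-p∣≡∣p∣ (seq x m - seq x n))))
    (h m n l l′)

eventuallyBounded : (x : ℝ) → ∃₂ λ B N → 0ℚ < B × (∀ n → N ℕ.≤ n → ∣ seq x n ∣ < B)
eventuallyBounded x with cauchy x 1ℚ (ℚₚ.positive⁻¹ 1ℚ)
... | N , h = 1ℚ + ∣ seq x N ∣ , N ,
  ℚₚ.+-mono-<-≤ (ℚₚ.positive⁻¹ 1ℚ) (ℚₚ.0≤∣p∣ (seq x N)) , λ n l → begin-strict
    ∣ seq x n ∣                        ≡⟨ cong ∣_∣ (split (seq x n) (seq x N)) ⟩
    ∣ (seq x n - seq x N) + seq x N ∣  ≤⟨ ℚₚ.∣p+q∣≤∣p∣+∣q∣ (seq x n - seq x N) (seq x N) ⟩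
    ∣ seq x n - seq x N ∣ + ∣ seq x N ∣ <⟨ ℚₚ.+-monoˡ-< ∣ seq x N ∣ (h n N l ℕₚ.≤-refl) ⟩
    1ℚ + ∣ seq x N ∣                   ∎
  where
  open ℚₚ.≤-Reasoning
  open +-*-Solver
  split : ∀ a b → a ≡ (a - b) + b
  split = solve 2 (λ a b → a := (a :+ (:- b)) :+ b) refl

∣*∣≤ : ∀ {B δ} p q → 0ℚ < B → ∣ p ∣ < B → ∣ q ∣ < δ → ∣ p * q ∣ ≤ B * δ
∣*∣≤ {B} {δ} p q 0<B p<B q<δ = begin
  ∣ p * q ∣      ≡⟨ ℚₚ.∣p*q∣≡∣p∣*∣q∣ p q ⟩
  ∣ p ∣ * ∣ q ∣  ≤⟨ ℚₚ.*-monoʳ-≤-nonNeg ∣ q ∣ {{ℚ.nonNegative (ℚₚ.0≤∣p∣ q)}} (ℚₚ.<⇒≤ p<B) ⟩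
  B * ∣ q ∣      ≤⟨ ℚₚ.*-monoˡ-≤-nonNeg B {{ℚ.nonNegative (ℚₚ.<⇒≤ 0<B)}} (ℚₚ.<⇒≤ q<δ) ⟩
  B * δ          ∎
  where open ℚₚ.≤-Reasoning

*-close : ∀ {B C δ} a b c d → 0ℚ < B → 0ℚ < C → ∣ a ∣ < B → ∣ d ∣ < C →
          ∣ b - d ∣ < δ → ∣ a - c ∣ < δ → ∣ a * b - c * d ∣ ≤ B * δ + C * δ
*-close {B} {C} {δ} a b c d 0<B 0<C a<B d<C bd ac = begin
  ∣ a * b - c * d ∣                  ≡⟨ cong ∣_∣ (rearrange a b c d) ⟩
  ∣ a * (b - d) + d * (a - c) ∣      ≤⟨ ℚₚ.∣p+q∣≤∣p∣+∣q∣ (a * (b - d)) (d * (a - c)) ⟩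
  ∣ a * (b - d) ∣ + ∣ d * (a - c) ∣  ≤⟨ ℚₚ.+-mono-≤ (∣*∣≤ a (b - d) 0<B a<B bd) (∣*∣≤ d (a - c) 0<C d<C ac) ⟩
  B * δ + C * δ                      ∎
  where
  open ℚₚ.≤-Reasoning
  open +-*-Solver
  rearrange : ∀ a b c d → a * b - c * d ≡ a * (b - d) + d * (a - c)
  rearrange = solve 4 (λ a b c d → a :* b :+ (:- (c :* d)) := a :* (b :+ (:- d)) :+ d :* (a :+ (:- c))) refl

chooseδ : ∀ D ε → 0ℚ < D → 0ℚ < ε → ∃ λ δ → 0ℚ < δ × D * δ < ε
chooseδ D ε 0<D 0<ε = 1/ D * (½ * ε) , *-pos (ℚₚ.positive⁻¹ (1/ D) {{ℚₚ.1/pos⇒pos D}}) (half-pos 0<ε) , (begin-strict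
  D * (1/ D * (½ * ε))  ≡⟨ ℚₚ.*-assoc D (1/ D) (½ * ε) ⟨
  D * 1/ D * (½ * ε)    ≡⟨ cong (_* (½ * ε)) (ℚₚ.*-inverseʳ D) ⟩
  1ℚ * (½ * ε)          ≡⟨ ℚₚ.*-identityˡ (½ * ε) ⟩
  ½ * ε                 ≡⟨ ℚₚ.+-identityʳ (½ * ε) ⟨
  ½ * ε + 0ℚ            <⟨ ℚₚ.+-monoʳ-< (½ * ε) (half-pos 0<ε) ⟩
  ½ * ε + ½ * ε         ≡⟨ ½+½ ε ⟩
  ε                     ∎)
  where
  open ℚₚ.≤-Reasoning
  instance
    D-pos : Positive D
    D-pos = positive 0<D
    D-nonZero : ℚ.NonZero D
    D-nonZero = ℚₚ.pos⇒nonZero D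

*-cauchy : (x y : ℝ) → IsCauchy (λ n → seq x n * seq y n)
*-cauchy x y ε 0<ε = bounds (eventuallyBounded x) (eventuallyBounded y)
  where
  Goal : Set
  Goal = ∃ λ N → ∀ m n → N ℕ.≤ m → N ℕ.≤ n → ∣ seq x m * seq y m - seq x n * seq y n ∣ < ε

  Close : ℝ → ℚ → Set
  Close z δ = ∃ λ N → ∀ m n → N ℕ.≤ m → N ℕ.≤ n → ∣ seq z m - seq z n ∣ < δ

  Bounded : ℝ → Set
  Bounded z = ∃₂ λ B N → 0ℚ < B × (∀ n → N ℕ.≤ n → ∣ seq z n ∣ < B)

  combine : ((B , _) : Bounded x) ((C , _) : Bounded y) → ∀ δ → (B + C) * δ < ε → Close x δ → Close y δ → Goal
  combine (B , K , 0<B , x<B) (C , L , 0<C , y<C) δ Dδ<ε (M , hx) (N , hy) =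
    (K ℕ.⊔ L) ℕ.⊔ (M ℕ.⊔ N) , λ m n l l′ →
      let lo  = ℕₚ.m⊔n≤o⇒m≤o (K ℕ.⊔ L) (M ℕ.⊔ N) l
          lo′ = ℕₚ.m⊔n≤o⇒m≤o (K ℕ.⊔ L) (M ℕ.⊔ N) l′
          hi  = ℕₚ.m⊔n≤o⇒n≤o (K ℕ.⊔ L) (M ℕ.⊔ N) l
          hi′ = ℕₚ.m⊔n≤o⇒n≤o (K ℕ.⊔ L) (M ℕ.⊔ N) l′
      in ℚₚ.≤-<-trans
        (*-close (seq x m) (seq y m) (seq x n) (seq y n) 0<B 0<C
          (x<B m (ℕₚ.m⊔n≤o⇒m≤o K L lo))
          (y<C n (ℕₚ.m⊔n≤o⇒n≤o K L lo′))
          (hy m n (ℕₚ.m⊔n≤o⇒n≤o M N hi) (ℕₚ.m⊔n≤o⇒n≤o M N hi′))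
          (hx m n (ℕₚ.m⊔n≤o⇒m≤o M N hi) (ℕₚ.m⊔n≤o⇒m≤o M N hi′)))
        (subst (_< ε) (ℚₚ.*-distribʳ-+ δ B C) Dδ<ε)

  withδ : ((B , _) : Bounded x) ((C , _) : Bounded y) → (∃ λ δ → 0ℚ < δ × (B + C) * δ < ε) → Goal
  withδ bx by (δ , 0<δ , h) = combine bx by δ h (cauchy x δ 0<δ) (cauchy y δ 0<δ)

  bounds : Bounded x → Bounded y → Goal
  bounds bx@(B , _ , 0<B , _) by@(C , _ , 0<C , _) = withδ bx by (chooseδ (B + C) ε (ℚₚ.+-mono-< 0<B 0<C) 0<ε)

_*ᴿ_ : ℝ → ℝ → ℝ
x *ᴿ y = mkℝ (λ n → seq x n * seq y n) (*-cauchy x y)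

record ℂ : Set where
  constructor _+i_
  field
    re im : ℝ
open ℂ public

constᶜ : ℚ → ℂ
constᶜ c = constᴿ c +i constᴿ 0ℚ

infix 4 _≈ᶜ_
_≈ᶜ_ : ℂ → ℂ → Set
z ≈ᶜ w = re z ≈ᴿ re w × im z ≈ᴿ im w

ℂ-rawRing : RawRing 0ℓ 0ℓ
ℂ-rawRing = record
  { Carrier = ℂ
  ; _≈_     = _≈ᶜ_
  ; _+_     = λ z w → (re z +ᴿ re w) +i (im z +ᴿ im w)
  ; _*_     = λ z w → (re z *ᴿ re w +ᴿ (-ᴿ (im z *ᴿ im w))) +i (re z *ᴿ im w +ᴿ im z *ᴿ re w)
  ; -_      = λ z → (-ᴿ re z) +i (-ᴿ im z)
  ; 0#      = constᶜ 0ℚ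
  ; 1#      = constᶜ 1ℚ
  }

IsComplexRoot : Poly → ℂ → Set
IsComplexRoot f z = eval ℂ-rawRing constᶜ f z ≈ᶜ constᶜ 0ℚ

HasTwoDifferentComplexRoots : Poly → Set
HasTwoDifferentComplexRoots f = ∃₂ λ z w → ¬ z ≈ᶜ w × IsComplexRoot f z × IsComplexRoot f w

{-# OPTIONS --safe #-}
module Submission where

-- A section of y² = x³ + g x over ℚ(s) is certified to be non-torsion with a derivation.
-- Over ℚ(s)(g^¼) the curve is the constant curve Y² = X³ + X, on which P ↦ (dX/ds) / Y is an
-- additive homomorphism to the field; untwisted, this is P ↦ (2 g x′ − g′ x) / y up to a fixed
-- factor.  So in characteristic 0 a point on which it does not vanish has infinite order.
-- It vanishes only if x² / g, equivalently x / w² with w = y / x, is constant.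
--
-- With y = x w the surface is x w² = x² + f(t).  If deg f ≤ 3, take x and w linear in t such
-- that the coefficients of t³ and t² in x w² − x² − f(t) vanish; the remaining linear equation
-- gives t as a rational function of a free parameter.  If deg f = 4 and f(t₀) = 0, the
-- substitution t = t₀ + 1/u reduces to this case.  If f(t₀) ≠ 0, a projective change of
-- coordinate makes f(t) = f₀ + f₂ t² + f₃ t³ + f₄ t⁴ and t₀ = 0.  For a point (x₀ , x₀ w₀) on
-- the fibre put w = w₀ + s t and V = 2 x − w², so that V² = w⁴ − 4 f(t), and let V be the
-- quadratic in t agreeing with the square root of the right-hand side to order t³; this leaves
-- a linear equation for t.  Then V / w² can only be constant if f₂ = f₃ = f₄ = 0, that is, if
-- f is a fourth power.

open import Defs
open import Algebra.Bundles using (CommutativeRing)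
import Algebra.Properties.AbelianGroup as AbelianGroupProperties
import Algebra.Properties.Ring as RingProperties
import Algebra.Properties.Semiring.Mult as SemiringMult
import Algebra.Solver.Ring
open import Algebra.Solver.Ring.AlmostCommutativeRing using (fromCommutativeRing; _-Raw-AlmostCommutative⟶_)
open import Data.Empty using (⊥; ⊥-elim)
open import Data.Fin.Base as Fin using (Fin; toℕ; combine)
open import Data.Fin.Patterns using (0F; 1F; 2F; 3F; 4F; 5F; 6F; 7F; 8F)
open import Data.Fin.Properties using (any?; pigeonhole; combine-injective; toℕ-injective; <⇒≢)
open import Data.Integer.Base as ℤ using (ℤ; -[1+_]; _⊖_)
import Data.Integer.Properties as ℤₚ
open import Data.List.Base using ([]; _∷_; length)
open import Data.Maybe.Base using (Maybe; just; nothing)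
open import Data.Nat.Base as ℕ using (ℕ; zero; suc; s≤s; z≤n)
open import Data.Nat.Coprimality as Coprimality using (Coprime; coprime-divisor)
open import Data.Nat.Divisibility using (_∣_; divides; ∣-refl)
import Data.Nat.Properties as ℕₚ
open import Data.Product using (∃; ∃₂; ∃-syntax; _×_; _,_; proj₁; proj₂)
open import Data.Rational.Base as ℚ using (ℚ; mkℚ; 0ℚ; 1ℚ; ½; toℚᵘ)
import Data.Rational.Properties as ℚₚ
open import Data.Rational.Unnormalised.Base as ℚᵘ using (*≡*)
import Data.Rational.Unnormalised.Properties as ℚᵘₚ
open import Data.Sum.Base using (inj₁; inj₂)
open import Data.Vec.Base using ([]; _∷_; lookup)
open import Level using (0ℓ)
open import Relation.Binary.Definitions using (tri<; tri≈; tri>)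
open import Relation.Binary.PropositionalEquality as ≡ using (_≡_; _≢_; module ≡-Reasoning)
import Relation.Binary.Reasoning.Setoid as SetoidReasoning
open import Relation.Nullary using (¬_; Dec; yes; no; ¬?; _×-dec_)
open import Relation.Nullary.Decidable using (decidable-stable)

-- Adjoining g^¼ is avoided by carrying only θ = g′/(4 g). A point then has a speed m with x′ = 2 θ
-- x + 2 m y, which is its image under the homomorphism up to a fixed factor. No group axioms are
-- needed: multiples are computed one addition at a time, each sum has the sum of the speeds, and O
-- could arise only from opposite points, whose speeds cancel, whereas n m ≠ 0.
--
-- If f = κ L⁴ with L linear, rescaling makes the surface a constant curve; its sections over ℚ(s)
-- are constant points, on which the speed vanishes. This is the quartic case that two distinct
-- roots exclude.
--
-- Each base change is given by polynomials a, b, X, W in one parameter r, and identities between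
-- them are checked at every rational r. Over ℚ they are proved by exhibiting the difference of the
-- two sides as a combination of the differences in the hypotheses. In degree 4 the decisive
-- polynomials have nonzero constant terms because neither 2 nor 3 has a rational square root.

module IntegerSolver {c ℓ} (R : CommutativeRing c ℓ) where
  open CommutativeRing R
  open RingProperties ring using (-‿distribˡ-*; -‿distribʳ-*; -0#≈0#)
  open AbelianGroupProperties +-abelianGroup using () renaming (⁻¹-involutive to -‿involutive; ⁻¹-∙-comm to -‿+-comm)
  open SemiringMult semiring public using () renaming (_×_ to _·_)
  open SemiringMult semiring using (×-homo-+; ×1-homo-*)
  open import Relation.Binary.Reasoning.Setoid setoid

  private
    ι : ℤ → Carrier
    ι (ℤ.+ n)    = n · 1#
    ι -[1+ n ] = - (suc n · 1#)

    ι-⊖ : ∀ m n → ι (m ⊖ n) ≈ m · 1# + - (n · 1#)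
    ι-⊖ zero    zero    = sym (-‿inverseʳ 0#)
    ι-⊖ zero    (suc n) = sym (+-identityˡ _)
    ι-⊖ (suc m) zero    = sym (trans (+-congˡ -0#≈0#) (+-identityʳ _))
    ι-⊖ (suc m) (suc n) = begin
      ι (suc m ⊖ suc n)                  ≡⟨ ≡.cong ι (ℤₚ.[1+m]⊖[1+n]≡m⊖n m n) ⟩
      ι (m ⊖ n)                          ≈⟨ ι-⊖ m n ⟩
      M + - N                            ≈⟨ +-congʳ (sym (+-identityˡ M)) ⟩
      (0# + M) + - N                     ≈⟨ +-congʳ (+-congʳ (sym (-‿inverseʳ 1#))) ⟩
      ((1# + - 1#) + M) + - N            ≈⟨ +-congʳ (+-assoc 1# (- 1#) M) ⟩
      (1# + (- 1# + M)) + - N            ≈⟨ +-congʳ (+-congˡ (+-comm (- 1#) M)) ⟩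
      (1# + (M + - 1#)) + - N            ≈⟨ +-congʳ (sym (+-assoc 1# M (- 1#))) ⟩
      ((1# + M) + - 1#) + - N            ≈⟨ +-assoc (1# + M) (- 1#) (- N) ⟩
      (1# + M) + (- 1# + - N)            ≈⟨ +-congˡ (-‿+-comm 1# N) ⟩
      (1# + M) + - (1# + N)              ∎
      where
      M = m · 1#
      N = n · 1#

    ι-+ : ∀ i j → ι (i ℤ.+ j) ≈ ι i + ι j
    ι-+ (ℤ.+ m)    (ℤ.+ n)    = ×-homo-+ 1# m n
    ι-+ (ℤ.+ m)    -[1+ n ] = ι-⊖ m (suc n)
    ι-+ -[1+ m ] (ℤ.+ n)    = trans (ι-⊖ n (suc m)) (+-comm _ _)
    ι-+ -[1+ m ] -[1+ n ] = begin
      - (suc (suc (m ℕ.+ n)) · 1#)       ≡⟨ ≡.cong (λ k → - (suc k · 1#)) (≡.sym (ℕₚ.+-suc m n)) ⟩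
      - ((suc m ℕ.+ suc n) · 1#)         ≈⟨ -‿cong (×-homo-+ 1# (suc m) (suc n)) ⟩
      - (suc m · 1# + suc n · 1#)        ≈⟨ sym (-‿+-comm _ _) ⟩
      - (suc m · 1#) + - (suc n · 1#)    ∎

    ι-neg : ∀ i → ι (ℤ.- i) ≈ - ι i
    ι-neg (ℤ.+ zero)  = sym -0#≈0#
    ι-neg (ℤ.+ suc n) = refl
    ι-neg -[1+ n ]  = sym (-‿involutive _)

    ι-*-pos : ∀ m n → ι (ℤ.+ m ℤ.* ℤ.+ n) ≈ (m · 1#) * (n · 1#)
    ι-*-pos m n = trans (reflexive (≡.cong ι (≡.sym (ℤₚ.pos-* m n)))) (×1-homo-* m n)

    ι-* : ∀ i j → ι (i ℤ.* j) ≈ ι i * ι j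
    ι-* (ℤ.+ m)    (ℤ.+ n)    = ι-*-pos m n
    ι-* (ℤ.+ m)    -[1+ n ] = begin
      ι (ℤ.+ m ℤ.* ℤ.- ℤ.+ suc n)            ≡⟨ ≡.cong ι (≡.sym (ℤₚ.neg-distribʳ-* (ℤ.+ m) (ℤ.+ suc n))) ⟩
      ι (ℤ.- (ℤ.+ m ℤ.* ℤ.+ suc n))          ≈⟨ ι-neg (ℤ.+ m ℤ.* ℤ.+ suc n) ⟩
      - ι (ℤ.+ m ℤ.* ℤ.+ suc n)              ≈⟨ -‿cong (ι-*-pos m (suc n)) ⟩
      - ((m · 1#) * (suc n · 1#))        ≈⟨ -‿distribʳ-* _ _ ⟩
      (m · 1#) * - (suc n · 1#)          ∎
    ι-* -[1+ m ] (ℤ.+ n)    = begin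
      ι (ℤ.- ℤ.+ suc m ℤ.* ℤ.+ n)            ≡⟨ ≡.cong ι (≡.sym (ℤₚ.neg-distribˡ-* (ℤ.+ suc m) (ℤ.+ n))) ⟩
      ι (ℤ.- (ℤ.+ suc m ℤ.* ℤ.+ n))          ≈⟨ ι-neg (ℤ.+ suc m ℤ.* ℤ.+ n) ⟩
      - ι (ℤ.+ suc m ℤ.* ℤ.+ n)              ≈⟨ -‿cong (ι-*-pos (suc m) n) ⟩
      - ((suc m · 1#) * (n · 1#))        ≈⟨ -‿distribˡ-* _ _ ⟩
      - (suc m · 1#) * (n · 1#)          ∎
    ι-* -[1+ m ] -[1+ n ] = begin
      (suc m ℕ.* suc n) · 1#             ≈⟨ ×1-homo-* (suc m) (suc n) ⟩
      (suc m · 1#) * (suc n · 1#)        ≈⟨ sym (-‿involutive _) ⟩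
      - - ((suc m · 1#) * (suc n · 1#))  ≈⟨ -‿cong (-‿distribʳ-* _ _) ⟩
      - ((suc m · 1#) * - (suc n · 1#))  ≈⟨ -‿distribˡ-* _ _ ⟩
      - (suc m · 1#) * - (suc n · 1#)    ∎

    -- Coefficients in ℤ have decidable equality whatever the ring R is, so the same solver serves
    -- ℚ, polynomials, rational functions and abstract differential fields.
    ℤ-morphism : ℤ.+-*-rawRing -Raw-AlmostCommutative⟶ fromCommutativeRing R
    ℤ-morphism = record
      { ⟦_⟧ = ι ; +-homo = ι-+ ; *-homo = ι-* ; -‿homo = ι-neg ; 0-homo = refl ; 1-homo = +-identityʳ 1# }

    _coeff≟_ : ∀ i j → Maybe (ι i ≈ ι j)
    i coeff≟ j with i ℤₚ.≟ j
    ... | yes i≡j = just (reflexive (≡.cong ι i≡j))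
    ... | no  _   = nothing

  open Algebra.Solver.Ring ℤ.+-*-rawRing (fromCommutativeRing R) ℤ-morphism _coeff≟_ public
    using (Polynomial; solve; _:=_; _:+_; _:*_; _:-_; :-_; _:×_; con)

module ℚ-Solver = IntegerSolver ℚₚ.+-*-commutativeRing

-- An equation follows from hypotheses uᵢ ≈ vᵢ once the difference of its sides is Σ cᵢ (uᵢ - vᵢ).
-- The solver checks that combination; these lemmas then discard its terms one by one.
module LinearCombination {c ℓ} (R : CommutativeRing c ℓ) where
  open CommutativeRing R
  open IntegerSolver R

  difference≈0 : ∀ {x y} → x ≈ y → x - y ≈ 0#
  difference≈0 {x} {y} x≈y = trans (+-congʳ x≈y) (-‿inverseʳ y)

  ≈-from-difference : ∀ {x y} → x - y ≈ 0# → x ≈ y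
  ≈-from-difference {x} {y} h = trans (solve 2 (λ x y → x := (x :- y) :+ y) refl x y)
    (trans (+-congʳ h) (+-identityˡ y))

  *≈0 : ∀ c {x} → x ≈ 0# → c * x ≈ 0#
  *≈0 c x≈0 = trans (*-congˡ x≈0) (zeroʳ c)

  +≈0 : ∀ {x y} → x ≈ 0# → y ≈ 0# → x + y ≈ 0#
  +≈0 x≈0 y≈0 = trans (+-cong x≈0 y≈0) (+-identityˡ 0#)

  -≈0 : ∀ {x} → x ≈ 0# → - x ≈ 0#
  -≈0 x≈0 = trans (-‿cong x≈0) (trans (sym (+-identityˡ (- 0#))) (-‿inverseʳ 0#))

-- Polynomial identities behind the chord-tangent law

module GroupLawIdentities {c ℓ} (R : CommutativeRing c ℓ) where
  open CommutativeRing R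
  open IntegerSolver R

  -- Subtracting the two curve equations gives a second expression of the slope, with denominator y₁
  -- + y₂, which remains meaningful when the points coincide.
  chord-identity : ∀ l x₁ y₁ x₂ y₂ g →
    (x₂ - x₁) * (l * (y₁ + y₂) - (x₁ * x₁ + x₁ * x₂ + x₂ * x₂ + g)) ≈
    (y₁ + y₂) * (l * (x₂ - x₁) - (y₂ - y₁)) + ((y₂ * y₂ - (x₂ * x₂ * x₂ + g * x₂)) -
      (y₁ * y₁ - (x₁ * x₁ * x₁ + g * x₁)))
  chord-identity = solve 6 (λ l x₁ y₁ x₂ y₂ g →
    (x₂ :- x₁) :* (l :* (y₁ :+ y₂) :- (x₁ :* x₁ :+ x₁ :* x₂ :+ x₂ :* x₂ :+ g)) :=
    (y₁ :+ y₂) :* (l :* (x₂ :- x₁) :- (y₂ :- y₁)) :+ ((y₂ :* y₂ :- (x₂ :* x₂ :* x₂ :+ g :* x₂)) :-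
      (y₁ :* y₁ :- (x₁ :* x₁ :* x₁ :+ g :* x₁)))) refl

  -- The left side is x₂ - x₁ times the error in the claimed formula for l′; the first bracket on
  -- the right is the derivative of l (x₂ - x₁) = y₂ - y₁ with the derivatives of the coordinates
  -- inserted. The term θ l appears because l scales like g^¼.
  chord-slope-identity : ∀ l l′ x₁ y₁ x₂ y₂ g θ m₁ m₂ →
    (x₂ - x₁) * (l′ - (θ * l + (m₁ * (x₁ - (l * l - x₁ - x₂)) + m₂ * (x₂ - (l * l - x₁ - x₂))))) ≈
    (l′ * (x₂ - x₁) + l * ((2 · (θ * x₂) + 2 · (m₂ * y₂)) - (2 · (θ * x₁) + 2 · (m₁ * y₁))) -
      ((3 · (θ * y₂) + m₂ * (3 · (x₂ * x₂) + g)) - (3 · (θ * y₁) + m₁ * (3 · (x₁ * x₁) + g)))) +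
      ((l * (m₁ + m₂) - 3 · θ) * (l * (x₂ - x₁) - (y₂ - y₁)) + (m₁ - m₂) *
      (l * (y₁ + y₂) - (x₁ * x₁ + x₁ * x₂ + x₂ * x₂ + g)))
  chord-slope-identity = solve 10 (λ l l′ x₁ y₁ x₂ y₂ g θ m₁ m₂ →
    (x₂ :- x₁) :* (l′ :- (θ :* l :+ (m₁ :* (x₁ :- (l :* l :- x₁ :- x₂)) :+ m₂ :* (x₂ :- (l :* l :- x₁ :- x₂)))))
      :=
    (l′ :* (x₂ :- x₁) :+ l :* ((2 :× (θ :* x₂) :+ 2 :× (m₂ :* y₂)) :- (2 :× (θ :* x₁) :+ 2 :× (m₁ :* y₁))) :-
      ((3 :× (θ :* y₂) :+ m₂ :* (3 :× (x₂ :* x₂) :+ g)) :- (3 :× (θ :* y₁) :+ m₁ :* (3 :× (x₁ :* x₁) :+ g)))) :+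
      ((l :* (m₁ :+ m₂) :- 3 :× θ) :* (l :* (x₂ :- x₁) :- (y₂ :- y₁)) :+ (m₁ :- m₂) :*
      (l :* (y₁ :+ y₂) :- (x₁ :* x₁ :+ x₁ :* x₂ :+ x₂ :* x₂ :+ g)))) refl

  -- The counterpart for a doubling, from the derivative of 2 l y = 3 x² + g. The two speeds stay
  -- separate, so that the formula for l′ has the shape of the chord case.
  tangent-slope-identity : ∀ l l′ x y g θ m₁ m₂ →
    (y + y) * (l′ - (θ * l + (m₁ * (x - (l * l - x - x)) + m₂ * (x - (l * l - x - x))))) ≈
    (l′ * (y + y) + l * ((3 · (θ * y) + m₁ * (3 · (x * x) + g)) + (3 · (θ * y) + m₂ * (3 · (x * x) + g))) -
      (3 · x * ((2 · (θ * x) + 2 · (m₁ * y)) + (2 · (θ * x) + 2 · (m₂ * y))) + 4 · (θ * g))) +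
      ((m₁ + m₂) * l - 4 · θ) * (l * (y + y) - (3 · (x * x) + g))
  tangent-slope-identity = solve 8 (λ l l′ x y g θ m₁ m₂ →
    (y :+ y) :* (l′ :- (θ :* l :+ (m₁ :* (x :- (l :* l :- x :- x)) :+ m₂ :* (x :- (l :* l :- x :- x))))) :=
    (l′ :* (y :+ y) :+ l :* ((3 :× (θ :* y) :+ m₁ :* (3 :× (x :* x) :+ g)) :+
      (3 :× (θ :* y) :+ m₂ :* (3 :× (x :* x) :+ g))) :- (3 :× x :*
      ((2 :× (θ :* x) :+ 2 :× (m₁ :* y)) :+ (2 :× (θ :* x) :+ 2 :× (m₂ :* y))) :+ 4 :× (θ :* g))) :+
      ((m₁ :+ m₂) :* l :- 4 :× θ) :* (l :* (y :+ y) :- (3 :× (x :* x) :+ g))) refl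

  -- The bracket is the cofactor of x₁ - x₃ when the curve equation at the first point is subtracted
  -- from that at the third. Both expressions of the slope together make it vanish.
  bracket-identity : ∀ l x₁ y₁ x₂ y₂ g →
    (l * l * (x₁ - (l * l - x₁ - x₂)) - 2 · (l * y₁) + (x₁ * x₁ + x₁ * (l * l - x₁ - x₂) + (l * l - x₁ - x₂) *
      (l * l - x₁ - x₂) + g)) ≈
    - (l * (y₁ + y₂) - (x₁ * x₁ + x₁ * x₂ + x₂ * x₂ + g)) + (- l) * (l * (x₂ - x₁) - (y₂ - y₁))
  bracket-identity = solve 6 (λ l x₁ y₁ x₂ y₂ g →
    (l :* l :* (x₁ :- (l :* l :- x₁ :- x₂)) :- 2 :× (l :* y₁) :+
      (x₁ :* x₁ :+ x₁ :* (l :* l :- x₁ :- x₂) :+ (l :* l :- x₁ :- x₂) :* (l :* l :- x₁ :- x₂) :+ g)) :=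
    :- (l :* (y₁ :+ y₂) :- (x₁ :* x₁ :+ x₁ :* x₂ :+ x₂ :* x₂ :+ g)) :+ (:- l) :*
      (l :* (x₂ :- x₁) :- (y₂ :- y₁))) refl

  third-curve-identity : ∀ l x₁ y₁ x₂ g →
    (l * (x₁ - (l * l - x₁ - x₂)) - y₁) * (l * (x₁ - (l * l - x₁ - x₂)) - y₁) -
      ((l * l - x₁ - x₂) * (l * l - x₁ - x₂) * (l * l - x₁ - x₂) + g * (l * l - x₁ - x₂)) ≈
    (y₁ * y₁ - (x₁ * x₁ * x₁ + g * x₁)) + (x₁ - (l * l - x₁ - x₂)) *
      (l * l * (x₁ - (l * l - x₁ - x₂)) - 2 · (l * y₁) + (x₁ * x₁ + x₁ * (l * l - x₁ - x₂) + (l * l - x₁ - x₂) *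
      (l * l - x₁ - x₂) + g))
  third-curve-identity = solve 5 (λ l x₁ y₁ x₂ g →
    (l :* (x₁ :- (l :* l :- x₁ :- x₂)) :- y₁) :* (l :* (x₁ :- (l :* l :- x₁ :- x₂)) :- y₁) :-
      ((l :* l :- x₁ :- x₂) :* (l :* l :- x₁ :- x₂) :* (l :* l :- x₁ :- x₂) :+ g :* (l :* l :- x₁ :- x₂)) :=
    (y₁ :* y₁ :- (x₁ :* x₁ :* x₁ :+ g :* x₁)) :+ (x₁ :- (l :* l :- x₁ :- x₂)) :*
      (l :* l :* (x₁ :- (l :* l :- x₁ :- x₂)) :- 2 :× (l :* y₁) :+
      (x₁ :* x₁ :+ x₁ :* (l :* l :- x₁ :- x₂) :+ (l :* l :- x₁ :- x₂) :* (l :* l :- x₁ :- x₂) :+ g))) refl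

  third-∂x-identity : ∀ l x₁ y₁ x₂ y₂ θ m₁ m₂ →
    ((θ * l + (m₁ * (x₁ - (l * l - x₁ - x₂)) + m₂ * (x₂ - (l * l - x₁ - x₂)))) * l + l *
      (θ * l + (m₁ * (x₁ - (l * l - x₁ - x₂)) + m₂ * (x₂ - (l * l - x₁ - x₂))))) -
      (2 · (θ * x₁) + 2 · (m₁ * y₁)) - (2 · (θ * x₂) + 2 · (m₂ * y₂)) -
      (2 · (θ * (l * l - x₁ - x₂)) + 2 · ((m₁ + m₂) * (l * (x₁ - (l * l - x₁ - x₂)) - y₁))) ≈
    2 · m₂ * (l * (x₂ - x₁) - (y₂ - y₁))
  third-∂x-identity = solve 8 (λ l x₁ y₁ x₂ y₂ θ m₁ m₂ →
    ((θ :* l :+ (m₁ :* (x₁ :- (l :* l :- x₁ :- x₂)) :+ m₂ :* (x₂ :- (l :* l :- x₁ :- x₂)))) :* l :+ l :*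
      (θ :* l :+ (m₁ :* (x₁ :- (l :* l :- x₁ :- x₂)) :+ m₂ :* (x₂ :- (l :* l :- x₁ :- x₂))))) :-
      (2 :× (θ :* x₁) :+ 2 :× (m₁ :* y₁)) :- (2 :× (θ :* x₂) :+ 2 :× (m₂ :* y₂)) :-
      (2 :× (θ :* (l :* l :- x₁ :- x₂)) :+ 2 :× ((m₁ :+ m₂) :* (l :* (x₁ :- (l :* l :- x₁ :- x₂)) :- y₁))) :=
    2 :× m₂ :* (l :* (x₂ :- x₁) :- (y₂ :- y₁))) refl

  third-∂y-identity : ∀ l x₁ y₁ x₂ g θ m₁ m₂ →
    ((θ * l + (m₁ * (x₁ - (l * l - x₁ - x₂)) + m₂ * (x₂ - (l * l - x₁ - x₂)))) * (x₁ - (l * l - x₁ - x₂)) + l *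
      ((2 · (θ * x₁) + 2 · (m₁ * y₁)) - (2 · (θ * (l * l - x₁ - x₂)) + 2 ·
      ((m₁ + m₂) * (l * (x₁ - (l * l - x₁ - x₂)) - y₁))))) - (3 · (θ * y₁) + m₁ * (3 · (x₁ * x₁) + g)) -
      (3 · (θ * (l * (x₁ - (l * l - x₁ - x₂)) - y₁)) + (m₁ + m₂) *
      (3 · ((l * l - x₁ - x₂) * (l * l - x₁ - x₂)) + g)) ≈
    (- (2 · m₁ + m₂)) * (l * l * (x₁ - (l * l - x₁ - x₂)) - 2 · (l * y₁) +
      (x₁ * x₁ + x₁ * (l * l - x₁ - x₂) + (l * l - x₁ - x₂) * (l * l - x₁ - x₂) + g))
  third-∂y-identity = solve 8 (λ l x₁ y₁ x₂ g θ m₁ m₂ →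
    ((θ :* l :+ (m₁ :* (x₁ :- (l :* l :- x₁ :- x₂)) :+ m₂ :* (x₂ :- (l :* l :- x₁ :- x₂)))) :*
      (x₁ :- (l :* l :- x₁ :- x₂)) :+ l :* ((2 :× (θ :* x₁) :+ 2 :× (m₁ :* y₁)) :-
      (2 :× (θ :* (l :* l :- x₁ :- x₂)) :+ 2 :× ((m₁ :+ m₂) :* (l :* (x₁ :- (l :* l :- x₁ :- x₂)) :- y₁))))) :-
      (3 :× (θ :* y₁) :+ m₁ :* (3 :× (x₁ :* x₁) :+ g)) :- (3 :× (θ :* (l :* (x₁ :- (l :* l :- x₁ :- x₂)) :- y₁))
      :+ (m₁ :+ m₂) :* (3 :× ((l :* l :- x₁ :- x₂) :* (l :* l :- x₁ :- x₂)) :+ g)) :=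
    (:- (2 :× m₁ :+ m₂)) :* (l :* l :* (x₁ :- (l :* l :- x₁ :- x₂)) :- 2 :× (l :* y₁) :+
      (x₁ :* x₁ :+ x₁ :* (l :* l :- x₁ :- x₂) :+ (l :* l :- x₁ :- x₂) :* (l :* l :- x₁ :- x₂) :+ g))) refl

-- Differential fields and the additivity of the speed

record DifferentialField c ℓ : Set (Level.suc (c Level.⊔ ℓ)) where
  field commutativeRing : CommutativeRing c ℓ
  open CommutativeRing commutativeRing public
  open IntegerSolver commutativeRing using (_·_)
  field
    noZeroDivisors : ∀ {x y} → x * y ≈ 0# → ¬ x ≈ 0# → y ≈ 0#
    torsionFree    : ∀ n {x} → suc n · x ≈ 0# → x ≈ 0#
    inverse        : ∀ {x} → ¬ x ≈ 0# → ∃ λ i → i * x ≈ 1#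
    ∂              : Carrier → Carrier
    ∂-cong         : ∀ {x y} → x ≈ y → ∂ x ≈ ∂ y
    ∂-+            : ∀ x y → ∂ (x + y) ≈ ∂ x + ∂ y
    ∂-*            : ∀ x y → ∂ (x * y) ≈ ∂ x * y + x * ∂ y

  ∂-0 : ∂ 0# ≈ 0#
  ∂-0 = identityʳ-unique (∂ 0#) (∂ 0#) (trans (sym (∂-+ 0# 0#)) (∂-cong (+-identityˡ 0#)))
    where open AbelianGroupProperties +-abelianGroup

  ∂-neg : ∀ x → ∂ (- x) ≈ - ∂ x
  ∂-neg x = inverseʳ-unique (∂ x) (∂ (- x)) (trans (sym (∂-+ x (- x))) (trans (∂-cong (-‿inverseʳ x)) ∂-0))
    where open AbelianGroupProperties +-abelianGroup

  ∂-- : ∀ x y → ∂ (x - y) ≈ ∂ x - ∂ y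
  ∂-- x y = trans (∂-+ x (- y)) (+-congˡ (∂-neg y))

module Flow {c ℓ} (F : DifferentialField c ℓ) where
  open DifferentialField F
  open IntegerSolver commutativeRing
  open LinearCombination commutativeRing
  open GroupLawIdentities commutativeRing
  open SemiringMult semiring using (×-congʳ)
  open SetoidReasoning setoid

  cancel : ∀ {z x y} → ¬ z ≈ 0# → z * (x - y) ≈ 0# → x ≈ y
  cancel z≉0 h = ≈-from-difference (noZeroDivisors h z≉0)

  module Along (g θ : Carrier) (∂g : ∂ g ≈ 4 · (θ * g)) where
    -- θ is the logarithmic derivative of g^¼, and (x , y) = (g^½ X , g^¾ Y) with Y² = X³ + X:
    -- the equations say that (X , Y) moves along the invariant vector field of that
    -- constant curve, with speed proportional to m.
    record Moves (m x y : Carrier) : Set ℓ where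
      constructor moves
      field
        curve : y * y ≈ x * x * x + g * x
        ∂x    : ∂ x ≈ 2 · (θ * x) + 2 · (m * y)
        ∂y    : ∂ y ≈ 3 · (θ * y) + m * (3 · (x * x) + g)
    open Moves

    private
      x₃ : (l x₁ x₂ : Carrier) → Carrier
      x₃ l x₁ x₂ = l * l - x₁ - x₂

      y₃ : (l x₁ y₁ x₂ : Carrier) → Carrier
      y₃ l x₁ y₁ x₂ = l * (x₁ - x₃ l x₁ x₂) - y₁

    -- Additivity of the speed. Both expressions of the slope are assumed: `line` becomes 0 = 0 for
    -- a doubling and `secant` for a chord between opposite points with different abscissas never
    -- has to be divided by, so that chords and tangents can share this argument.
    third : ∀ {l x₁ y₁ x₂ y₂ m₁ m₂} → Moves m₁ x₁ y₁ → Moves m₂ x₂ y₂ →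
      l * (x₂ - x₁) ≈ y₂ - y₁ →
      l * (y₁ + y₂) ≈ x₁ * x₁ + x₁ * x₂ + x₂ * x₂ + g →
      ∂ l ≈ θ * l + (m₁ * (x₁ - (l * l - x₁ - x₂)) + m₂ * (x₂ - (l * l - x₁ - x₂))) →
      Moves (m₁ + m₂) (l * l - x₁ - x₂) (l * (x₁ - (l * l - x₁ - x₂)) - y₁)
    third {l} {x₁} {y₁} {x₂} {y₂} {m₁} {m₂} M₁ M₂ line secant ∂l = moves
      (≈-from-difference (trans (third-curve-identity l x₁ y₁ x₂ g)
        (+≈0 (difference≈0 (curve M₁)) (*≈0 _ bracket))))
      ∂x₃
      (≈-from-difference (trans (+-congʳ ∂y₃) (trans (third-∂y-identity l x₁ y₁ x₂ g θ m₁ m₂) (*≈0 _ bracket))))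
      where
      X₃ = x₃ l x₁ x₂
      Y₃ = y₃ l x₁ y₁ x₂
      L′ = θ * l + (m₁ * (x₁ - X₃) + m₂ * (x₂ - X₃))
      bracket : l * l * (x₁ - X₃) - 2 · (l * y₁) + (x₁ * x₁ + x₁ * X₃ + X₃ * X₃ + g) ≈ 0#
      bracket = trans (bracket-identity l x₁ y₁ x₂ y₂ g)
        (+≈0 (-≈0 (difference≈0 secant)) (*≈0 _ (difference≈0 line)))
      ∂x₃ : ∂ X₃ ≈ 2 · (θ * X₃) + 2 · ((m₁ + m₂) * Y₃)
      ∂x₃ = ≈-from-difference (begin
        ∂ (l * l - x₁ - x₂) - T
          ≈⟨ +-congʳ (trans (∂-- (l * l - x₁) x₂) (+-congʳ (trans (∂-- (l * l) x₁) (+-congʳ (∂-* l l))))) ⟩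
        (∂ l * l + l * ∂ l) - ∂ x₁ - ∂ x₂ - T
          ≈⟨ +-congʳ (+-cong (+-cong (+-cong (*-congʳ ∂l) (*-congˡ ∂l)) (-‿cong (∂x M₁))) (-‿cong (∂x M₂))) ⟩
        (L′ * l + l * L′) - (2 · (θ * x₁) + 2 · (m₁ * y₁)) - (2 · (θ * x₂) + 2 · (m₂ * y₂)) - T
          ≈⟨ third-∂x-identity l x₁ y₁ x₂ y₂ θ m₁ m₂ ⟩
        2 · m₂ * (l * (x₂ - x₁) - (y₂ - y₁))
          ≈⟨ *≈0 _ (difference≈0 line) ⟩
        0# ∎)
        where T = 2 · (θ * X₃) + 2 · ((m₁ + m₂) * Y₃)
      ∂y₃ : ∂ Y₃ ≈ (L′ * (x₁ - X₃) + l * ((2 · (θ * x₁) + 2 · (m₁ * y₁)) - (2 · (θ * X₃) + 2 · ((m₁ + m₂) * Y₃))))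
                   - (3 · (θ * y₁) + m₁ * (3 · (x₁ * x₁) + g))
      ∂y₃ = trans (∂-- (l * (x₁ - X₃)) y₁) (+-cong
        (trans (∂-* l (x₁ - X₃)) (+-cong (*-congʳ ∂l) (*-congˡ (trans (∂-- x₁ X₃) (+-cong (∂x M₁) (-‿cong ∂x₃))))))
        (-‿cong (∂y M₁)))

    chord : ∀ {l x₁ y₁ x₂ y₂ m₁ m₂} → Moves m₁ x₁ y₁ → Moves m₂ x₂ y₂ →
      ¬ x₂ - x₁ ≈ 0# → l * (x₂ - x₁) ≈ y₂ - y₁ →
      Moves (m₁ + m₂) (l * l - x₁ - x₂) (l * (x₁ - (l * l - x₁ - x₂)) - y₁)
    chord {l} {x₁} {y₁} {x₂} {y₂} {m₁} {m₂} M₁ M₂ x₂≉x₁ line = third M₁ M₂ line secant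
      (cancel x₂≉x₁ (trans (chord-slope-identity l (∂ l) x₁ y₁ x₂ y₂ g θ m₁ m₂)
        (+≈0 (difference≈0 ∂line) (+≈0 (*≈0 _ (difference≈0 line)) (*≈0 _ (difference≈0 secant))))))
      where
      secant : l * (y₁ + y₂) ≈ x₁ * x₁ + x₁ * x₂ + x₂ * x₂ + g
      secant = cancel x₂≉x₁ (trans (chord-identity l x₁ y₁ x₂ y₂ g)
        (+≈0 (*≈0 _ (difference≈0 line)) (+≈0 (difference≈0 (curve M₂)) (-≈0 (difference≈0 (curve M₁))))))
      ∂line : ∂ l * (x₂ - x₁) + l * ((2 · (θ * x₂) + 2 · (m₂ * y₂)) - (2 · (θ * x₁) + 2 · (m₁ * y₁)))
            ≈ (3 · (θ * y₂) + m₂ * (3 · (x₂ * x₂) + g)) - (3 · (θ * y₁) + m₁ * (3 · (x₁ * x₁) + g))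
      ∂line = begin
        ∂ l * (x₂ - x₁) + l * ((2 · (θ * x₂) + 2 · (m₂ * y₂)) - (2 · (θ * x₁) + 2 · (m₁ * y₁)))
          ≈⟨ +-congˡ (*-congˡ (trans (∂-- x₂ x₁) (+-cong (∂x M₂) (-‿cong (∂x M₁))))) ⟨
        ∂ l * (x₂ - x₁) + l * ∂ (x₂ - x₁)  ≈⟨ ∂-* l (x₂ - x₁) ⟨
        ∂ (l * (x₂ - x₁))                  ≈⟨ ∂-cong line ⟩
        ∂ (y₂ - y₁)                        ≈⟨ trans (∂-- y₂ y₁) (+-cong (∂y M₂) (-‿cong (∂y M₁))) ⟩
        (3 · (θ * y₂) + m₂ * (3 · (x₂ * x₂) + g)) - (3 · (θ * y₁) + m₁ * (3 · (x₁ * x₁) + g)) ∎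

    Moves-resp : ∀ {m x y x′ y′} → x ≈ x′ → y ≈ y′ → Moves m x y → Moves m x′ y′
    Moves-resp {m} {x} {y} {x′} {y′} p q (moves c dx dy) = moves
      (trans (*-cong (sym q) (sym q)) (trans c (+-cong (*-cong (*-cong p p) p) (*-congˡ p))))
      (trans (∂-cong (sym p)) (trans dx (+-cong (×-congʳ 2 (*-congˡ p)) (×-congʳ 2 (*-congˡ q)))))
      (trans (∂-cong (sym q)) (trans dy (+-cong (×-congʳ 3 (*-congˡ q)) (*-congˡ (+-congʳ (×-congʳ 3 (*-cong p p)))))))

    Moves-resp-speed : ∀ {m m′ x y} → m ≈ m′ → Moves m x y → Moves m′ x y
    Moves-resp-speed p (moves c dx dy) = moves c
      (trans dx (+-congˡ (×-congʳ 2 (*-congʳ p)))) (trans dy (+-congˡ (*-congʳ p)))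

    -- Equal abscissas and y₁ + y₂ ≠ 0 force the two points to coincide; `secant` is then the
    -- tangent condition.
    tangent : ∀ {l x₁ y₁ x₂ y₂ m₁ m₂} → Moves m₁ x₁ y₁ → Moves m₂ x₂ y₂ →
      x₂ - x₁ ≈ 0# → ¬ y₁ + y₂ ≈ 0# → l * (y₁ + y₂) ≈ x₁ * x₁ + x₁ * x₁ + x₁ * x₁ + g →
      Moves (m₁ + m₂) (l * l - x₁ - x₂) (l * (x₁ - (l * l - x₁ - x₂)) - y₁)
    tangent {l} {x₁} {y₁} {x₂} {y₂} {m₁} {m₂} M₁ M₂ x₂-x₁≈0 y₁+y₂≉0 slope =
      third M₁ M₂
        (trans (*-congˡ x₂-x₁≈0) (trans (zeroʳ l) (sym (difference≈0 y₂≈y₁))))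
        (trans slope (+-congʳ (+-cong (+-congˡ (*-congˡ (sym x₂≈x₁))) (*-cong (sym x₂≈x₁) (sym x₂≈x₁)))))
        (trans ∂l (+-congˡ (+-cong (*-congˡ (+-congˡ (-‿cong x₃≈))) (*-congˡ (+-cong (sym x₂≈x₁) (-‿cong x₃≈))))))
      where
      x₂≈x₁ : x₂ ≈ x₁
      x₂≈x₁ = ≈-from-difference x₂-x₁≈0
      y₂≈y₁ : y₂ ≈ y₁
      y₂≈y₁ = cancel y₁+y₂≉0 (trans
        (solve 3 (λ y₁ y₂ t → (y₁ :+ y₂) :* (y₂ :- y₁) := (y₂ :* y₂ :- t) :- (y₁ :* y₁ :- t)) refl y₁ y₂
          (x₁ * x₁ * x₁ + g * x₁))
        (+≈0 (difference≈0 (curve (Moves-resp x₂≈x₁ refl M₂))) (-≈0 (difference≈0 (curve M₁)))))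
      M₂′ : Moves m₂ x₁ y₁
      M₂′ = Moves-resp x₂≈x₁ y₂≈y₁ M₂
      x₃≈ : l * l - x₁ - x₁ ≈ l * l - x₁ - x₂
      x₃≈ = +-congˡ (-‿cong (sym x₂≈x₁))
      2y≉0 : ¬ y₁ + y₁ ≈ 0#
      2y≉0 h = y₁+y₂≉0 (trans (+-congˡ y₂≈y₁) h)
      slope′ : l * (y₁ + y₁) ≈ 3 · (x₁ * x₁) + g
      slope′ = trans (*-congˡ (+-congˡ (sym y₂≈y₁))) (trans slope
        (solve 2 (λ x g → x :* x :+ x :* x :+ x :* x :+ g := 3 :× (x :* x) :+ g) refl x₁ g))
      -- In the derivative of 3 x₁², one factor ∂ x₁ is rewritten by `M₁` and the other by `M₂′`,
      -- which keeps the result symmetric in the two speeds.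
      ∂slope : ∂ l * (y₁ + y₁) + l * ((3 · (θ * y₁) + m₁ * (3 · (x₁ * x₁) + g)) + (3 · (θ * y₁) + m₂ * (3 · (x₁ * x₁) + g)))
             ≈ 3 · x₁ * ((2 · (θ * x₁) + 2 · (m₁ * y₁)) + (2 · (θ * x₁) + 2 · (m₂ * y₁))) + 4 · (θ * g)
      ∂slope = begin
        ∂ l * (y₁ + y₁) + l * ((3 · (θ * y₁) + m₁ * (3 · (x₁ * x₁) + g)) + (3 · (θ * y₁) + m₂ * (3 · (x₁ * x₁) + g)))
          ≈⟨ +-congˡ (*-congˡ (trans (∂-+ y₁ y₁) (+-cong (∂y M₁) (∂y M₂′)))) ⟨
        ∂ l * (y₁ + y₁) + l * ∂ (y₁ + y₁)  ≈⟨ ∂-* l (y₁ + y₁) ⟨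
        ∂ (l * (y₁ + y₁))                  ≈⟨ ∂-cong slope′ ⟩
        ∂ (3 · (x₁ * x₁) + g)              ≈⟨ ∂-+ (3 · (x₁ * x₁)) g ⟩
        ∂ (3 · (x₁ * x₁)) + ∂ g            ≈⟨ +-cong ∂3x² ∂g ⟩
        3 · (∂ x₁ * x₁ + x₁ * ∂ x₁) + 4 · (θ * g)
          ≈⟨ +-congʳ (×-congʳ 3 (+-cong (*-congʳ (∂x M₁)) (*-congˡ (∂x M₂′)))) ⟩
        3 · ((2 · (θ * x₁) + 2 · (m₁ * y₁)) * x₁ + x₁ * (2 · (θ * x₁) + 2 · (m₂ * y₁))) + 4 · (θ * g)
          ≈⟨ solve 6 (λ x y θ m n g → 3 :× ((2 :× (θ :* x) :+ 2 :× (m :* y)) :* x :+ x :* (2 :× (θ :* x) :+ 2 :× (n :* y)))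
            :+ 4 :× (θ :* g)
               := 3 :× x :* ((2 :× (θ :* x) :+ 2 :× (m :* y)) :+ (2 :× (θ :* x) :+ 2 :× (n :* y))) :+ 4 :×
                 (θ :* g)) refl x₁ y₁ θ m₁ m₂ g ⟩
        3 · x₁ * ((2 · (θ * x₁) + 2 · (m₁ * y₁)) + (2 · (θ * x₁) + 2 · (m₂ * y₁))) + 4 · (θ * g) ∎
        where
        x² = x₁ * x₁
        ∂3x² : ∂ (3 · x²) ≈ 3 · (∂ x₁ * x₁ + x₁ * ∂ x₁)
        ∂3x² = trans (∂-+ x² (2 · x²)) (+-cong (∂-* x₁ x₁) (trans (∂-+ x² (1 · x²)) (+-cong (∂-* x₁ x₁)
          (trans (∂-+ x² 0#) (+-cong (∂-* x₁ x₁) ∂-0)))))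
      ∂l : ∂ l ≈ θ * l + (m₁ * (x₁ - (l * l - x₁ - x₁)) + m₂ * (x₁ - (l * l - x₁ - x₁)))
      ∂l = cancel 2y≉0 (trans (tangent-slope-identity l (∂ l) x₁ y₁ g θ m₁ m₂)
        (+≈0 (difference≈0 ∂slope) (*≈0 _ (difference≈0 slope′))))

    -- With m = m₁ + m₂, comparing the derivatives of the coordinates of P and -P gives 2 m y = 0
    -- and m (3 x² + g) = 0. If m ≠ 0, the point is singular on the curve, and a singular point
    -- forces g = 0.
    opposite : ∀ {x₁ y₁ x₂ y₂ m₁ m₂} → ¬ g ≈ 0# → Moves m₁ x₁ y₁ → Moves m₂ x₂ y₂ →
      x₂ - x₁ ≈ 0# → y₁ + y₂ ≈ 0# → ¬ ¬ m₁ + m₂ ≈ 0#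
    opposite {x₁} {y₁} {x₂} {y₂} {m₁} {m₂} g≉0 M₁ M₂ x₂-x₁≈0 y₁+y₂≈0 m≉0 = g≉0 (begin
        g                          ≈⟨ solve 2 (λ x g → g := (3 :× (x :* x) :+ g) :- 3 :× x :* x) refl x₁ g ⟩
        (3 · (x₁ * x₁) + g) - 3 · x₁ * x₁  ≈⟨ +≈0 3x²+g≈0 (-≈0 (*≈0 _ x₁≈0)) ⟩
        0#                         ∎)
      where
      y₂≈-y₁ : y₂ ≈ - y₁
      y₂≈-y₁ = ≈-from-difference (trans (solve 2 (λ y₁ y₂ → y₂ :- (:- y₁) := y₁ :+ y₂) refl y₁ y₂) y₁+y₂≈0)
      M₂′ : Moves m₂ x₁ (- y₁)
      M₂′ = Moves-resp (≈-from-difference x₂-x₁≈0) y₂≈-y₁ M₂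
      y₁≈0 : y₁ ≈ 0#
      y₁≈0 = noZeroDivisors (torsionFree 1 (trans
        (solve 5 (λ x y θ m n → 2 :× ((m :+ n) :* y) :=
            (2 :× (θ :* x) :+ 2 :× (m :* y)) :- (2 :× (θ :* x) :+ 2 :× (n :* (:- y)))) refl x₁ y₁ θ m₁ m₂)
        (difference≈0 (trans (sym (∂x M₁)) (∂x M₂′))))) m≉0
      3x²+g≈0 : 3 · (x₁ * x₁) + g ≈ 0#
      3x²+g≈0 = noZeroDivisors (trans
        (solve 5 (λ y θ m n s → (m :+ n) :* s := (3 :× (θ :* y) :+ m :* s) :- (:- (3 :× (θ :* (:- y)) :+ n :* s))) refl
          y₁ θ m₁ m₂ (3 · (x₁ * x₁) + g))
        (difference≈0 (trans (sym (∂y M₁)) (trans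
          (sym (trans (-‿cong (∂-neg y₁)) (solve 1 (λ y → :- (:- y) := y) refl (∂ y₁)))) (-‿cong (∂y M₂′)))))) m≉0
      x₁≈0 : x₁ ≈ 0#
      x₁≈0 = noZeroDivisors (torsionFree 1 (trans
        (solve 3 (λ x y g → 2 :× (g :* x) := (:- x) :* (3 :× (x :* x) :+ g) :+
          ((3 :× y) :* y :- 3 :× (y :* y :- (x :* x :* x :+ g :* x)))) refl x₁ y₁ g)
        (+≈0 (*≈0 _ 3x²+g≈0) (+≈0 (*≈0 _ y₁≈0) (-≈0 (3×≈0 (difference≈0 (curve M₁)))))))) g≉0
        where
        3×≈0 : ∀ {z} → z ≈ 0# → 3 · z ≈ 0#
        3×≈0 z≈0 = +≈0 z≈0 (+≈0 z≈0 (+≈0 z≈0 refl))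

-- The speed of a section and its non-vanishing

module FlowOfSection {c ℓ} (F : DifferentialField c ℓ) where
  open DifferentialField F
  open IntegerSolver commutativeRing
  open LinearCombination commutativeRing
  open Flow F
  open SemiringMult semiring using (×-comm-*)
  open SetoidReasoning setoid

  -- Since (x/w²)′ = (w x′ - 2 x w′)/w³, `wronskian` expresses that x/w² is not constant. It also
  -- yields that x, w and g are nonzero.
  module At {x w g : Carrier} (factored : x * (w * w) ≈ x * x + g) (wronskian : ¬ w * ∂ x ≈ x * ∂ w + x * ∂ w) where
    x≉0 : ¬ x ≈ 0#
    x≉0 x≈0 = wronskian (trans
      (trans (*-congˡ (trans (∂-cong x≈0) ∂-0)) (zeroʳ w))
      (sym (+≈0 (trans (*-congʳ x≈0) (zeroˡ (∂ w))) (trans (*-congʳ x≈0) (zeroˡ (∂ w))))))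

    w≉0 : ¬ w ≈ 0#
    w≉0 w≈0 = wronskian (trans (trans (*-congʳ w≈0) (zeroˡ (∂ x))) (sym (+≈0 x∂w≈0 x∂w≈0)))
      where
      x∂w≈0 : x * ∂ w ≈ 0#
      x∂w≈0 = *≈0 x (trans (∂-cong w≈0) ∂-0)

    -- For g = 0 the equation becomes w² = x, so that x/w² is the constant 1.
    g≉0 : ¬ g ≈ 0#
    g≉0 g≈0 = wronskian (begin
      w * ∂ x                   ≈⟨ *-congˡ (trans (∂-cong (sym w²≈x)) (∂-* w w)) ⟩
      w * (∂ w * w + w * ∂ w)   ≈⟨ solve 2 (λ w v → w :* (v :* w :+ w :* v) := (w :* w) :* v :+ (w :* w) :* v) refl w
        (∂ w) ⟩
      w * w * ∂ w + w * w * ∂ w ≈⟨ +-cong (*-congʳ w²≈x) (*-congʳ w²≈x) ⟩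
      x * ∂ w + x * ∂ w         ∎)
      where
      w²≈x : w * w ≈ x
      w²≈x = ≈-from-difference (noZeroDivisors (trans
        (solve 3 (λ x w g → x :* (w :* w :- x) := (x :* (w :* w) :- (x :* x :+ g)) :+ g) refl x w g)
        (+≈0 (difference≈0 factored) g≈0)) x≉0)

    y : Carrier
    y = x * w

    y≉0 : ¬ y ≈ 0#
    y≉0 h = w≉0 (noZeroDivisors h x≉0)

    private
      divide : ∀ n z u → ¬ z ≈ 0# → ∃ λ v → suc n · (v * z) ≈ u
      divide n z u z≉0 = go (inverse {suc n · z} λ e → z≉0 (torsionFree n e))
        where
        go : (∃ λ i → i * (suc n · z) ≈ 1#) → ∃ λ v → suc n · (v * z) ≈ u
        go (i , h) = u * i , (begin
          suc n · (u * i * z)    ≈⟨ ×-comm-* (suc n) (u * i) z ⟨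
          u * i * (suc n · z)    ≈⟨ *-assoc u i (suc n · z) ⟩
          u * (i * (suc n · z))  ≈⟨ *-congˡ h ⟩
          u * 1#                 ≈⟨ *-identityʳ u ⟩
          u                      ∎)

    θ : Carrier
    θ = proj₁ (divide 3 g (∂ g) g≉0)

    ∂g : ∂ g ≈ 4 · (θ * g)
    ∂g = sym (proj₂ (divide 3 g (∂ g) g≉0))

    m : Carrier
    m = proj₁ (divide 1 y (∂ x - 2 · (θ * x)) y≉0)

    open Along g θ ∂g

    curve : y * y ≈ x * x * x + g * x
    curve = begin
      x * w * (x * w)    ≈⟨ solve 2 (λ x w → x :* w :* (x :* w) := x :* (x :* (w :* w))) refl x w ⟩
      x * (x * (w * w))  ≈⟨ *-congˡ factored ⟩
      x * (x * x + g)    ≈⟨ solve 2 (λ x g → x :* (x :* x :+ g) := x :* x :* x :+ g :* x) refl x g ⟩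
      x * x * x + g * x  ∎

    ∂x : ∂ x ≈ 2 · (θ * x) + 2 · (m * y)
    ∂x = trans (solve 2 (λ u v → u := v :+ (u :- v)) refl (∂ x) (2 · (θ * x)))
      (+-congˡ (sym (proj₂ (divide 1 y (∂ x - 2 · (θ * x)) y≉0))))

    -- The speed m was chosen to satisfy `∂x`; the second equation then follows by differentiating
    -- the curve equation and dividing by 2 y.
    ∂y : ∂ y ≈ 3 · (θ * y) + m * (3 · (x * x) + g)
    ∂y = cancel (λ e → y≉0 (torsionFree 1 e)) (trans
      (solve 7 (λ x y g θ m x′ y′ → 2 :× y :* (y′ :- (3 :× (θ :* y) :+ m :* (3 :× (x :* x) :+ g))) :=
        ((y′ :* y :+ y :* y′) :- (((x′ :* x :+ x :* x′) :* x :+ x :* x :* x′) :+ (4 :× (θ :* g) :* x :+ g :* x′)))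
        :+ ((3 :× (x :* x) :+ g) :* (x′ :- (2 :× (θ :* x) :+ 2 :× (m :* y)))
        :+ (:- (6 :× θ)) :* (y :* y :- (x :* x :* x :+ g :* x)))) refl x y g θ m (∂ x) (∂ y))
      (+≈0 (difference≈0 ∂curve) (+≈0 (*≈0 _ (difference≈0 ∂x)) (*≈0 _ (difference≈0 curve)))))
      where
      ∂curve : ∂ y * y + y * ∂ y ≈ ((∂ x * x + x * ∂ x) * x + x * x * ∂ x) + (4 · (θ * g) * x + g * ∂ x)
      ∂curve = begin
        ∂ y * y + y * ∂ y              ≈⟨ ∂-* y y ⟨
        ∂ (y * y)                      ≈⟨ ∂-cong curve ⟩
        ∂ (x * x * x + g * x)          ≈⟨ ∂-+ (x * x * x) (g * x) ⟩
        ∂ (x * x * x) + ∂ (g * x)      ≈⟨ +-cong (trans (∂-* (x * x) x) (+-congʳ (*-congʳ (∂-* x x))))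
                                                 (trans (∂-* g x) (+-congʳ (*-congʳ ∂g))) ⟩
        ((∂ x * x + x * ∂ x) * x + x * x * ∂ x) + (4 · (θ * g) * x + g * ∂ x) ∎

    section-moves : Moves m x y
    section-moves = moves curve ∂x ∂y

    -- The Wronskian w x′ - 2 x w′ equals 4 g m. The identity below is this equation multiplied by
    -- y, modulo `∂x`, `factored` and the derivative of `factored`.
    m≉0 : ¬ m ≈ 0#
    m≉0 m≈0 = wronskian (cancel y≉0 (trans
      (solve 7 (λ x w g θ m x′ w′ → x :* w :* (w :* x′ :- (x :* w′ :+ x :* w′)) :=
        (2 :× g :* (x′ :- (2 :× (θ :* x) :+ 2 :× (m :* (x :* w)))) :+ (4 :× g :* (x :* w)) :* m)
        :+ (((:- x) :* (((x′ :* (w :* w)) :+ x :* (w′ :* w :+ w :* w′)) :- ((x′ :* x :+ x :* x′) :+ 4 :× (θ :* g))))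
        :+ (2 :× x′) :* (x :* (w :* w) :- (x :* x :+ g))))
        refl x w g θ m (∂ x) (∂ w))
      (+≈0 (+≈0 (*≈0 _ (difference≈0 ∂x)) (*≈0 _ m≈0))
        (+≈0 (*≈0 _ (difference≈0 ∂factored)) (*≈0 _ (difference≈0 factored))))))
      where
      ∂factored : ∂ x * (w * w) + x * (∂ w * w + w * ∂ w) ≈ (∂ x * x + x * ∂ x) + 4 · (θ * g)
      ∂factored = begin
        ∂ x * (w * w) + x * (∂ w * w + w * ∂ w)  ≈⟨ +-congˡ (*-congˡ (∂-* w w)) ⟨
        ∂ x * (w * w) + x * ∂ (w * w)            ≈⟨ ∂-* x (w * w) ⟨
        ∂ (x * (w * w))                          ≈⟨ ∂-cong factored ⟩
        ∂ (x * x + g)                            ≈⟨ ∂-+ (x * x) g ⟩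
        ∂ (x * x) + ∂ g                          ≈⟨ +-cong (∂-* x x) ∂g ⟩
        (∂ x * x + x * ∂ x) + 4 · (θ * g)        ∎

-- Polynomials over ℚ as functions on ℚ

module Polynomials where
  open import Data.Rational.Base using (_+_; _*_; -_; _-_; _<_; _≤_; ∣_∣)
  open ≡
  open ≡-Reasoning
  open ℚ-Solver

  noZeroDivisorsℚ : ∀ {a b} → a * b ≡ 0ℚ → a ≢ 0ℚ → b ≡ 0ℚ
  noZeroDivisorsℚ {a} {b} ab≡0 a≢0 = *-nonZeroℚ a b a≢0 ab≡0

  *-≢0 : ∀ {a b} → a ≢ 0ℚ → b ≢ 0ℚ → a * b ≢ 0ℚ
  *-≢0 a≢0 b≢0 ab≡0 = b≢0 (noZeroDivisorsℚ ab≡0 a≢0)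

  square≡0 : ∀ {a} → a * a ≡ 0ℚ → a ≡ 0ℚ
  square≡0 {a} aa≡0 with a ℚₚ.≟ 0ℚ
  ... | yes a≡0 = a≡0
  ... | no  a≢0 = noZeroDivisorsℚ aa≡0 a≢0

  x-y≡0⇒x≡y : ∀ {x y : ℚ} → x - y ≡ 0ℚ → x ≡ y
  x-y≡0⇒x≡y {x} {y} e = begin
    x            ≡⟨ solve 2 (λ x y → x := (x :- y) :+ y) refl x y ⟩
    (x - y) + y  ≡⟨ cong (_+ y) e ⟩
    0ℚ + y       ≡⟨ ℚₚ.+-identityˡ y ⟩
    y            ∎

  x≡y⇒x-y≡0 : ∀ {x y : ℚ} → x ≡ y → x - y ≡ 0ℚ
  x≡y⇒x-y≡0 {x} refl = ℚₚ.+-inverseʳ x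

  ev-+ : ∀ p q r → evalℚ (p +ₚ q) r ≡ evalℚ p r + evalℚ q r
  ev-+ []      q       r = sym (ℚₚ.+-identityˡ _)
  ev-+ (a ∷ p) []      r = sym (ℚₚ.+-identityʳ _)
  ev-+ (a ∷ p) (b ∷ q) r = trans (cong (λ e → (a + b) + r * e) (ev-+ p q r))
    (solve 5 (λ a b r x y → (a :+ b) :+ r :* (x :+ y) := (a :+ r :* x) :+ (b :+ r :* y)) refl
      a b r (evalℚ p r) (evalℚ q r))

  ev-scale : ∀ c p r → evalℚ (scale c p) r ≡ c * evalℚ p r
  ev-scale c []      r = sym (ℚₚ.*-zeroʳ c)
  ev-scale c (a ∷ p) r = trans (cong (λ e → c * a + r * e) (ev-scale c p r))
    (solve 4 (λ c a r x → c :* a :+ r :* (c :* x) := c :* (a :+ r :* x)) refl c a r (evalℚ p r))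

  ev-neg : ∀ p r → evalℚ (-ₚ p) r ≡ - evalℚ p r
  ev-neg []      r = refl
  ev-neg (a ∷ p) r = trans (cong (λ e → - a + r * e) (ev-neg p r))
    (solve 3 (λ a r x → :- a :+ r :* (:- x) := :- (a :+ r :* x)) refl a r (evalℚ p r))

  ev-* : ∀ p q r → evalℚ (p *ₚ q) r ≡ evalℚ p r * evalℚ q r
  ev-* []      q r = sym (ℚₚ.*-zeroˡ (evalℚ q r))
  ev-* (a ∷ p) q r = begin
    evalℚ (scale a q +ₚ (0ℚ ∷ (p *ₚ q))) r
      ≡⟨ ev-+ (scale a q) (0ℚ ∷ (p *ₚ q)) r ⟩
    evalℚ (scale a q) r + (0ℚ + r * evalℚ (p *ₚ q) r)
      ≡⟨ cong₂ (λ u v → u + (0ℚ + r * v)) (ev-scale a q r) (ev-* p q r) ⟩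
    a * evalℚ q r + (0ℚ + r * (evalℚ p r * evalℚ q r))
      ≡⟨ solve 4 (λ a r x y → a :* y :+ (con (ℤ.+ 0) :+ r :* (x :* y)) := (a :+ r :* x) :* y) refl
          a r (evalℚ p r) (evalℚ q r) ⟩
    (a + r * evalℚ p r) * evalℚ q r ∎

  ev-zero : ∀ p r → p ≈ₚ 0ₚ → evalℚ p r ≡ 0ℚ
  ev-zero []      r h = refl
  ev-zero (a ∷ p) r h = begin
    a + r * evalℚ p r  ≡⟨ cong₂ (λ u v → u + r * v) (h 0) (ev-zero p r λ i → h (suc i)) ⟩
    0ℚ + r * 0ℚ        ≡⟨ cong (0ℚ +_) (ℚₚ.*-zeroʳ r) ⟩
    0ℚ                 ∎

  coeff-neg : ∀ p i → coeff (-ₚ p) i ≡ - coeff p i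
  coeff-neg []      i       = refl
  coeff-neg (a ∷ p) zero    = refl
  coeff-neg (a ∷ p) (suc i) = coeff-neg p i

  ≈ₚ⇒-≈0 : ∀ p q → p ≈ₚ q → p +ₚ (-ₚ q) ≈ₚ 0ₚ
  ≈ₚ⇒-≈0 p q h i = begin
    coeff (p +ₚ (-ₚ q)) i       ≡⟨ coeff-+ p (-ₚ q) i ⟩
    coeff p i + coeff (-ₚ q) i  ≡⟨ cong₂ _+_ (h i) (coeff-neg q i) ⟩
    coeff q i - coeff q i       ≡⟨ ℚₚ.+-inverseʳ (coeff q i) ⟩
    0ℚ                          ∎

  -≈0⇒≈ₚ : ∀ p q → p +ₚ (-ₚ q) ≈ₚ 0ₚ → p ≈ₚ q
  -≈0⇒≈ₚ p q h i = x-y≡0⇒x≡y (trans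
    (sym (trans (coeff-+ p (-ₚ q) i) (cong (coeff p i +_) (coeff-neg q i)))) (h i))

  ≈ₚ⇒ev≡ : ∀ p q → p ≈ₚ q → ∀ r → evalℚ p r ≡ evalℚ q r
  ≈ₚ⇒ev≡ p q h r = x-y≡0⇒x≡y (begin
    evalℚ p r - evalℚ q r            ≡⟨ cong (evalℚ p r +_) (ev-neg q r) ⟨
    evalℚ p r + evalℚ (-ₚ q) r       ≡⟨ ev-+ p (-ₚ q) r ⟨
    evalℚ (p +ₚ (-ₚ q)) r            ≡⟨ ev-zero (p +ₚ (-ₚ q)) r (≈ₚ⇒-≈0 p q h) ⟩
    0ℚ                               ∎)

  -- The coefficients of c p(2x) − p(x); passing from a + x p(x) to 2p(2x) − p(x)
  -- eliminates the constant term a of a polynomial vanishing off 0.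
  private
    dilate : ℚ → Poly → Poly
    dilate c []      = []
    dilate c (a ∷ p) = (c * a - a) ∷ dilate (c + c) p

    length-dilate : ∀ c p → length (dilate c p) ≡ length p
    length-dilate c []      = refl
    length-dilate c (a ∷ p) = cong suc (length-dilate (c + c) p)

    ev-dilate : ∀ c p r → evalℚ (dilate c p) r ≡ c * evalℚ p (r + r) - evalℚ p r
    ev-dilate c []      r = sym (trans (cong (_- 0ℚ) (ℚₚ.*-zeroʳ c)) refl)
    ev-dilate c (a ∷ p) r = trans (cong (λ e → (c * a - a) + r * e) (ev-dilate (c + c) p r))
      (solve 5 (λ c a r x y → (c :* a :- a) :+ r :* ((c :+ c) :* x :- y) := c :* (a :+ (r :+ r) :* x) :- (a :+ r :* y))
        refl c a r (evalℚ p (r + r)) (evalℚ p r))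

    -- The coefficient of xⁱ is multiplied by 2ⁱ c - 1, which is positive because c > 1.
    dilate≈0 : ∀ c p → 1ℚ < c → dilate c p ≈ₚ 0ₚ → p ≈ₚ 0ₚ
    dilate≈0 c []      1<c h i       = refl
    dilate≈0 c (a ∷ p) 1<c h zero    = noZeroDivisorsℚ {c - 1ℚ}
      (trans (solve 2 (λ c a → (c :- con (ℤ.+ 1)) :* a := c :* a :- a) refl c a) (h 0))
      (λ c-1≡0 → ℚₚ.<-irrefl (sym (x-y≡0⇒x≡y c-1≡0)) 1<c)
      where import Data.Integer.Base as ℤ
    dilate≈0 c (a ∷ p) 1<c h (suc i) = dilate≈0 (c + c) p
      (ℚₚ.<-trans 1<c (subst (_< c + c) (ℚₚ.+-identityʳ c)
        (ℚₚ.+-monoʳ-< c (ℚₚ.<-trans (ℚₚ.positive⁻¹ 1ℚ) 1<c)))) (λ j → h (suc j)) i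

  r+r≢0 : ∀ {r} → r ≢ 0ℚ → r + r ≢ 0ℚ
  r+r≢0 {r} r≢0 e = r≢0 (trans (sym (½+½ r)) (trans (sym (ℚₚ.*-distribˡ-+ ℚ.½ r r))
    (trans (cong (ℚ.½ *_) e) (ℚₚ.*-zeroʳ ℚ.½))))

  -- The induction cancels a factor r in f(2r) - f(r) = r (2 p(2r) - p(r)), so the vanishing can
  -- only be passed on away from 0. `dilate` preserves length, which makes the length the measure of
  -- the recursion.
  vanishing⇒≈0 : ∀ n p → length p ≡ n → (∀ r → r ≢ 0ℚ → evalℚ p r ≡ 0ℚ) → p ≈ₚ 0ₚ
  vanishing⇒≈0 zero    []      _   h i = refl
  vanishing⇒≈0 (suc n) (a ∷ p) len h = λ { zero → a≡0 ; (suc i) → p≈0 i }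
    where
    p≈0 : p ≈ₚ 0ₚ
    p≈0 = dilate≈0 (1ℚ + 1ℚ) p (ℚₚ.+-monoʳ-< 1ℚ (ℚₚ.positive⁻¹ 1ℚ))
      (vanishing⇒≈0 n (dilate (1ℚ + 1ℚ) p) (trans (length-dilate (1ℚ + 1ℚ) p) (ℕₚ.suc-injective len)) λ r r≢0 →
        trans (ev-dilate (1ℚ + 1ℚ) p r) (noZeroDivisorsℚ {r} (begin
          r * ((1ℚ + 1ℚ) * evalℚ p (r + r) - evalℚ p r)
            ≡⟨ solve 4 (λ a r x y → r :* ((con (ℤ.+ 1) :+ con (ℤ.+ 1)) :* x :- y)
                           := (a :+ (r :+ r) :* x) :- (a :+ r :* y)) refl a r (evalℚ p (r + r)) (evalℚ p r) ⟩
          evalℚ (a ∷ p) (r + r) - evalℚ (a ∷ p) r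
            ≡⟨ cong₂ _-_ (h (r + r) (r+r≢0 r≢0)) (h r r≢0) ⟩
          0ℚ ∎) r≢0))
    a≡0 : a ≡ 0ℚ
    a≡0 = begin
      a                    ≡⟨ ℚₚ.+-identityʳ a ⟨
      a + 1ℚ * 0ℚ          ≡⟨ cong (λ e → a + 1ℚ * e) (ev-zero p 1ℚ p≈0) ⟨
      a + 1ℚ * evalℚ p 1ℚ  ≡⟨ h 1ℚ (λ ()) ⟩
      0ℚ                   ∎

  ev≡⇒≈ₚ : ∀ p q → (∀ r → r ≢ 0ℚ → evalℚ p r ≡ evalℚ q r) → p ≈ₚ q
  ev≡⇒≈ₚ p q h = -≈0⇒≈ₚ p q (vanishing⇒≈0 _ (p +ₚ (-ₚ q)) refl λ r r≢0 → begin
    evalℚ (p +ₚ (-ₚ q)) r       ≡⟨ ev-+ p (-ₚ q) r ⟩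
    evalℚ p r + evalℚ (-ₚ q) r  ≡⟨ cong (evalℚ p r +_) (ev-neg q r) ⟩
    evalℚ p r - evalℚ q r       ≡⟨ x≡y⇒x-y≡0 (h r r≢0) ⟩
    0ℚ                          ∎)

  -- _≈ₚ_ as a record, so that p and q can be inferred from a proof.
  infix 4 _≋_
  record _≋_ (p q : Poly) : Set where
    constructor coeffwise
    field coeffs : p ≈ₚ q
  open _≋_ public

  pointwise : ∀ {p q} → (∀ r → evalℚ p r ≡ evalℚ q r) → p ≋ q
  pointwise {p} {q} h = coeffwise (ev≡⇒≈ₚ p q λ r _ → h r)

  ev-cong : ∀ {p q} → p ≋ q → ∀ r → evalℚ p r ≡ evalℚ q r
  ev-cong {p} {q} h = ≈ₚ⇒ev≡ p q (coeffs h)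

  ev-+≡ : ∀ p q {r u v} → evalℚ p r ≡ u → evalℚ q r ≡ v → evalℚ (p +ₚ q) r ≡ u + v
  ev-+≡ p q {r} h k = trans (ev-+ p q r) (cong₂ _+_ h k)

  ev-*≡ : ∀ p q {r u v} → evalℚ p r ≡ u → evalℚ q r ≡ v → evalℚ (p *ₚ q) r ≡ u * v
  ev-*≡ p q {r} h k = trans (ev-* p q r) (cong₂ _*_ h k)

  ev-neg≡ : ∀ p {r u} → evalℚ p r ≡ u → evalℚ (-ₚ p) r ≡ - u
  ev-neg≡ p {r} h = trans (ev-neg p r) (cong -_ h)

  ev-1ₚ : ∀ r → evalℚ 1ₚ r ≡ 1ℚ
  ev-1ₚ r = cong (1ℚ +_) (ℚₚ.*-zeroʳ r)

  -- Polynomials with equal values on the infinite field ℚ are equal, so every ring law is inherited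
  -- pointwise from ℚ.
  Poly-commutativeRing : CommutativeRing 0ℓ 0ℓ
  Poly-commutativeRing = record
    { Carrier = Poly ; _≈_ = _≋_ ; _+_ = _+ₚ_ ; _*_ = _*ₚ_ ; -_ = -ₚ_ ; 0# = 0ₚ ; 1# = 1ₚ
    ; isCommutativeRing = record
      { isRing = record
        { +-isAbelianGroup = record
          { isGroup = record
            { isMonoid = record
              { isSemigroup = record
                { isMagma = record
                  { isEquivalence = record
                    { refl  = pointwise λ _ → refl
                    ; sym   = λ h → pointwise λ r → sym (ev-cong h r)
                    ; trans = λ h k → pointwise λ r → trans (ev-cong h r) (ev-cong k r) }
                  ; ∙-cong = λ {p} {p′} {q} {q′} h k → pointwise λ r →
                      trans (ev-+≡ p q (ev-cong h r) (ev-cong k r)) (sym (ev-+ p′ q′ r)) }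
                ; assoc = λ p q s → pointwise λ r → trans (ev-+≡ (p +ₚ q) s (ev-+ p q r) refl)
                    (trans (ℚₚ.+-assoc (evalℚ p r) (evalℚ q r) (evalℚ s r)) (sym (ev-+≡ p (q +ₚ s) refl (ev-+ q s r)))) }
              ; identity = (λ p → pointwise λ _ → refl) , λ p → +-comm p 0ₚ }
            ; inverse = (λ p → pointwise λ r → trans (ev-+≡ (-ₚ p) p (ev-neg p r) refl) (ℚₚ.+-inverseˡ (evalℚ p r)))
                      , λ p → pointwise λ r → trans (ev-+≡ p (-ₚ p) refl (ev-neg p r)) (ℚₚ.+-inverseʳ (evalℚ p r))
            ; ⁻¹-cong = λ {p} {q} h → pointwise λ r → trans (ev-neg≡ p (ev-cong h r)) (sym (ev-neg q r)) }
          ; comm = +-comm }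
        ; *-cong = λ {p} {p′} {q} {q′} h k → pointwise λ r →
            trans (ev-*≡ p q (ev-cong h r) (ev-cong k r)) (sym (ev-* p′ q′ r))
        ; *-assoc = λ p q s → pointwise λ r → trans (ev-*≡ (p *ₚ q) s (ev-* p q r) refl)
            (trans (ℚₚ.*-assoc (evalℚ p r) (evalℚ q r) (evalℚ s r)) (sym (ev-*≡ p (q *ₚ s) refl (ev-* q s r))))
        ; *-identity = (λ p → pointwise λ r → trans (ev-*≡ 1ₚ p (ev-1ₚ r) refl) (ℚₚ.*-identityˡ _))
                     , λ p → pointwise λ r → trans (ev-*≡ p 1ₚ refl (ev-1ₚ r)) (ℚₚ.*-identityʳ _)
        ; distrib = (λ p q s → pointwise λ r → trans (ev-*≡ p (q +ₚ s) refl (ev-+ q s r))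
            (trans (ℚₚ.*-distribˡ-+ (evalℚ p r) (evalℚ q r) (evalℚ s r))
              (sym (ev-+≡ (p *ₚ q) (p *ₚ s) (ev-* p q r) (ev-* p s r)))))
          , λ p q s → pointwise λ r → trans (ev-*≡ (q +ₚ s) p (ev-+ q s r) refl)
            (trans (ℚₚ.*-distribʳ-+ (evalℚ p r) (evalℚ q r) (evalℚ s r))
              (sym (ev-+≡ (q *ₚ p) (s *ₚ p) (ev-* q p r) (ev-* s p r)))) }
      ; *-comm = λ p q → pointwise λ r → trans (ev-* p q r) (trans (ℚₚ.*-comm (evalℚ p r) (evalℚ q r))
        (sym (ev-* q p r))) } }
    where
    +-comm : ∀ p q → p +ₚ q ≋ q +ₚ p
    +-comm p q = pointwise λ r → trans (ev-+ p q r) (trans (ℚₚ.+-comm (evalℚ p r) (evalℚ q r)) (sym (ev-+ q p r)))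

  noZeroDivisorsₚ : ∀ {p q} → p *ₚ q ≋ 0ₚ → ¬ p ≋ 0ₚ → q ≋ 0ₚ
  noZeroDivisorsₚ {p} {q} pq≈0 p≉0 with zero? q
  ... | yes q≈0 = coeffwise q≈0
  ... | no  q≉0 = ⊥-elim (*ₚ-nonZero p q (λ h → p≉0 (coeffwise h)) q≉0 (coeffs pq≈0))

  ∂ₚ : Poly → Poly
  ∂ₚ []      = []
  ∂ₚ (a ∷ p) = p +ₚ (0ℚ ∷ ∂ₚ p)

  ev-∂∷ : ∀ a p {r u v} → evalℚ p r ≡ u → evalℚ (∂ₚ p) r ≡ v → evalℚ (∂ₚ (a ∷ p)) r ≡ u + r * v
  ev-∂∷ a p {r} h k = ev-+≡ p (0ℚ ∷ ∂ₚ p) h (trans (ℚₚ.+-identityˡ _) (cong (r *_) k))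

  ev-∂+ : ∀ p q r → evalℚ (∂ₚ (p +ₚ q)) r ≡ evalℚ (∂ₚ p) r + evalℚ (∂ₚ q) r
  ev-∂+ []      q       r = sym (ℚₚ.+-identityˡ _)
  ev-∂+ (a ∷ p) []      r = sym (ℚₚ.+-identityʳ _)
  ev-∂+ (a ∷ p) (b ∷ q) r = trans (ev-∂∷ (a + b) (p +ₚ q) (ev-+ p q r) (ev-∂+ p q r))
    (trans (solve 5 (λ r x y x′ y′ → (x :+ y) :+ r :* (x′ :+ y′) := (x :+ r :* x′) :+ (y :+ r :* y′)) refl
      r (evalℚ p r) (evalℚ q r) (evalℚ (∂ₚ p) r) (evalℚ (∂ₚ q) r))
    (sym (cong₂ _+_ (ev-∂∷ a p refl refl) (ev-∂∷ b q refl refl))))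

  ev-∂scale : ∀ c p r → evalℚ (∂ₚ (scale c p)) r ≡ c * evalℚ (∂ₚ p) r
  ev-∂scale c []      r = sym (ℚₚ.*-zeroʳ c)
  ev-∂scale c (a ∷ p) r = trans (ev-∂∷ (c * a) (scale c p) (ev-scale c p r) (ev-∂scale c p r))
    (trans (solve 4 (λ c r x x′ → c :* x :+ r :* (c :* x′) := c :* (x :+ r :* x′)) refl
      c r (evalℚ p r) (evalℚ (∂ₚ p) r))
    (cong (c *_) (sym (ev-∂∷ a p refl refl))))

  ev-∂neg : ∀ p r → evalℚ (∂ₚ (-ₚ p)) r ≡ - evalℚ (∂ₚ p) r
  ev-∂neg []      r = refl
  ev-∂neg (a ∷ p) r = trans (ev-∂∷ (- a) (-ₚ p) (ev-neg p r) (ev-∂neg p r))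
    (trans (solve 3 (λ r x x′ → :- x :+ r :* (:- x′) := :- (x :+ r :* x′)) refl r (evalℚ p r) (evalℚ (∂ₚ p) r))
    (cong -_ (sym (ev-∂∷ a p refl refl))))

  ev-∂* : ∀ p q r → evalℚ (∂ₚ (p *ₚ q)) r ≡ evalℚ (∂ₚ p) r * evalℚ q r + evalℚ p r * evalℚ (∂ₚ q) r
  ev-∂* []      q r = solve 2 (λ x y → con (ℤ.+ 0) := con (ℤ.+ 0) :* x :+ con (ℤ.+ 0) :* y) refl
    (evalℚ q r) (evalℚ (∂ₚ q) r)
  ev-∂* (a ∷ p) q r = trans
    (trans (ev-∂+ (scale a q) (0ℚ ∷ (p *ₚ q)) r)
      (cong₂ _+_ (ev-∂scale a q r) (ev-∂∷ 0ℚ (p *ₚ q) (ev-* p q r) (ev-∂* p q r))))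
    (trans (solve 6 (λ a r x y x′ y′ → a :* y′ :+ (x :* y :+ r :* (x′ :* y :+ x :* y′))
        := (x :+ r :* x′) :* y :+ (a :+ r :* x) :* y′) refl
      a r (evalℚ p r) (evalℚ q r) (evalℚ (∂ₚ p) r) (evalℚ (∂ₚ q) r))
    (cong (λ u → u * evalℚ q r + (a + r * evalℚ p r) * evalℚ (∂ₚ q) r) (sym (ev-∂∷ a p refl refl))))

  ∂ₚ-zero : ∀ p → p ≈ₚ 0ₚ → ∂ₚ p ≈ₚ 0ₚ
  ∂ₚ-zero []      h i = refl
  ∂ₚ-zero (a ∷ p) h i = trans (coeff-+ p (0ℚ ∷ ∂ₚ p) i) (cong₂ _+_ (h (suc i)) (shifted i))
    where
    shifted : ∀ i → coeff (0ℚ ∷ ∂ₚ p) i ≡ 0ℚ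
    shifted zero    = refl
    shifted (suc i) = ∂ₚ-zero p (λ j → h (suc j)) i

  ∂ₚ-cong : ∀ {p q} → p ≋ q → ∂ₚ p ≋ ∂ₚ q
  ∂ₚ-cong {p} {q} h = pointwise λ r → x-y≡0⇒x≡y (begin
    evalℚ (∂ₚ p) r - evalℚ (∂ₚ q) r          ≡⟨ cong (evalℚ (∂ₚ p) r +_) (ev-∂neg q r) ⟨
    evalℚ (∂ₚ p) r + evalℚ (∂ₚ (-ₚ q)) r     ≡⟨ ev-∂+ p (-ₚ q) r ⟨
    evalℚ (∂ₚ (p +ₚ (-ₚ q))) r               ≡⟨ ev-zero (∂ₚ (p +ₚ (-ₚ q))) r
      (∂ₚ-zero (p +ₚ (-ₚ q)) (≈ₚ⇒-≈0 p q (coeffs h))) ⟩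
    0ℚ                                       ∎)

  ∂ₚ-+ : ∀ p q → ∂ₚ (p +ₚ q) ≋ ∂ₚ p +ₚ ∂ₚ q
  ∂ₚ-+ p q = pointwise λ r → trans (ev-∂+ p q r) (sym (ev-+ (∂ₚ p) (∂ₚ q) r))

  ∂ₚ-* : ∀ p q → ∂ₚ (p *ₚ q) ≋ ∂ₚ p *ₚ q +ₚ p *ₚ ∂ₚ q
  ∂ₚ-* p q = pointwise λ r → trans (ev-∂* p q r)
    (sym (ev-+≡ (∂ₚ p *ₚ q) (p *ₚ ∂ₚ q) (ev-* (∂ₚ p) q r) (ev-* p (∂ₚ q) r)))

  private
    -- The hypothesis is (xⁿ p)′ q = xⁿ p q′ divided by xⁿ⁻¹. Its value at 0 is n p(0) q(0) = 0,
    -- hence p(0) = 0; extracting a factor x from p replaces n by n + 1, and no coefficient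
    -- survives.
    wronskian-shifted : ∀ n p q → 0ℚ < n → evalℚ q 0ℚ ≢ 0ℚ →
      (∀ x → x ≢ 0ℚ → (n * evalℚ p x + x * evalℚ (∂ₚ p) x) * evalℚ q x ≡ x * evalℚ p x * evalℚ (∂ₚ q) x) →
      p ≈ₚ 0ₚ
    wronskian-shifted n []      q 0<n q₀≢0 h i = refl
    wronskian-shifted n (a ∷ p) q 0<n q₀≢0 h = λ { zero → a≡0 ; (suc i) → p≈0 i }
      where
      lhs rhs : Poly
      lhs = (scale n (a ∷ p) +ₚ (0ℚ ∷ ∂ₚ (a ∷ p))) *ₚ q
      rhs = (0ℚ ∷ (a ∷ p)) *ₚ ∂ₚ q
      ev-lhs : ∀ x → evalℚ lhs x ≡ (n * evalℚ (a ∷ p) x + x * evalℚ (∂ₚ (a ∷ p)) x) * evalℚ q x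
      ev-lhs x = ev-*≡ (scale n (a ∷ p) +ₚ (0ℚ ∷ ∂ₚ (a ∷ p))) q {x}
        (ev-+≡ (scale n (a ∷ p)) (0ℚ ∷ ∂ₚ (a ∷ p)) {x} (ev-scale n (a ∷ p) x)
          (ℚₚ.+-identityˡ (x * evalℚ (∂ₚ (a ∷ p)) x))) refl
      ev-rhs : ∀ x → evalℚ rhs x ≡ x * evalℚ (a ∷ p) x * evalℚ (∂ₚ q) x
      ev-rhs x = ev-*≡ (0ℚ ∷ (a ∷ p)) (∂ₚ q) {x} (ℚₚ.+-identityˡ (x * evalℚ (a ∷ p) x)) refl
      at-0 : (n * evalℚ (a ∷ p) 0ℚ + 0ℚ * evalℚ (∂ₚ (a ∷ p)) 0ℚ) * evalℚ q 0ℚ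
           ≡ 0ℚ * evalℚ (a ∷ p) 0ℚ * evalℚ (∂ₚ q) 0ℚ
      at-0 = trans (sym (ev-lhs 0ℚ)) (trans
        (≈ₚ⇒ev≡ lhs rhs (ev≡⇒≈ₚ lhs rhs λ x x≢0 → trans (ev-lhs x) (trans (h x x≢0) (sym (ev-rhs x)))) 0ℚ)
        (ev-rhs 0ℚ))
      zeros : ∀ n a u q w → n * q * a ≡ (n * (a + 0ℚ * u) + 0ℚ * w) * q
      zeros = solve 5 (λ n a u q w → n :* q :* a := (n :* (a :+ con (ℤ.+ 0) :* u) :+ con (ℤ.+ 0) :* w) :* q) refl
      zeros′ : ∀ u v → 0ℚ * u * v ≡ 0ℚ
      zeros′ = solve 2 (λ u v → con (ℤ.+ 0) :* u :* v := con (ℤ.+ 0)) refl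
      a≡0 : a ≡ 0ℚ
      a≡0 = noZeroDivisorsℚ {n * evalℚ q 0ℚ} (trans (zeros n a (evalℚ p 0ℚ) (evalℚ q 0ℚ) (evalℚ (∂ₚ (a ∷ p)) 0ℚ))
        (trans at-0 (zeros′ (evalℚ (a ∷ p) 0ℚ) (evalℚ (∂ₚ q) 0ℚ))))
        (*-≢0 (λ n≡0 → ℚₚ.<-irrefl (sym n≡0) 0<n) q₀≢0)
      regroup : ∀ n u v u′ v′ x → x * (((1ℚ + n) * u + x * u′) * v - x * u * v′)
              ≡ (n * (0ℚ + x * u) + x * (u + x * u′)) * v - x * (0ℚ + x * u) * v′
      regroup = solve 6 (λ n u v u′ v′ x → x :* (((con (ℤ.+ 1) :+ n) :* u :+ x :* u′) :* v :- x :* u :* v′)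
        := (n :* (con (ℤ.+ 0) :+ x :* u) :+ x :* (u :+ x :* u′)) :* v :- x :* (con (ℤ.+ 0) :+ x :* u) :* v′) refl
      divided : ∀ x → (n * (a + x * evalℚ p x) + x * (evalℚ p x + x * evalℚ (∂ₚ p) x)) * evalℚ q x
                      ≡ x * (a + x * evalℚ p x) * evalℚ (∂ₚ q) x →
        x * (((1ℚ + n) * evalℚ p x + x * evalℚ (∂ₚ p) x) * evalℚ q x - x * evalℚ p x * evalℚ (∂ₚ q) x) ≡ 0ℚ
      divided x e = trans (regroup n (evalℚ p x) (evalℚ q x) (evalℚ (∂ₚ p) x) (evalℚ (∂ₚ q) x) x)
        (x≡y⇒x-y≡0 (subst (λ a → (n * (a + x * evalℚ p x) + x * (evalℚ p x + x * evalℚ (∂ₚ p) x)) * evalℚ q x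
                      ≡ x * (a + x * evalℚ p x) * evalℚ (∂ₚ q) x) a≡0 e))
      p≈0 : p ≈ₚ 0ₚ
      p≈0 = wronskian-shifted (1ℚ + n) p q (ℚₚ.+-mono-< (ℚₚ.positive⁻¹ 1ℚ) 0<n) q₀≢0 λ x x≢0 →
        x-y≡0⇒x≡y (noZeroDivisorsℚ {x} (divided x (trans
          (cong (λ w → (n * evalℚ (a ∷ p) x + x * w) * evalℚ q x) (sym (ev-∂∷ a p refl refl))) (h x x≢0))) x≢0)

    wronskian-vanishing : ∀ p q → evalℚ p 0ℚ ≡ 0ℚ → evalℚ q 0ℚ ≢ 0ℚ →
      (∀ x → evalℚ (∂ₚ p) x * evalℚ q x ≡ evalℚ p x * evalℚ (∂ₚ q) x) → p ≈ₚ 0ₚ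
    wronskian-vanishing []      q p₀≡0 q₀≢0 h i = refl
    wronskian-vanishing (a ∷ p) q p₀≡0 q₀≢0 h = λ { zero → a≡0 ; (suc i) → p≈0 i }
      where
      a≡0 : a ≡ 0ℚ
      a≡0 = trans (solve 2 (λ a u → a := a :+ con (ℤ.+ 0) :* u) refl a (evalℚ p 0ℚ)) p₀≡0
      p≈0 : p ≈ₚ 0ₚ
      p≈0 = wronskian-shifted 1ℚ p q (ℚₚ.positive⁻¹ 1ℚ) q₀≢0 λ x _ → begin
        (1ℚ * evalℚ p x + x * evalℚ (∂ₚ p) x) * evalℚ q x  ≡⟨ cong (λ u → (u + x * evalℚ (∂ₚ p) x) * evalℚ q x)
          (ℚₚ.*-identityˡ (evalℚ p x)) ⟩
        (evalℚ p x + x * evalℚ (∂ₚ p) x) * evalℚ q x       ≡⟨ cong (_* evalℚ q x) (ev-∂∷ a p refl refl) ⟨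
        evalℚ (∂ₚ (a ∷ p)) x * evalℚ q x                   ≡⟨ h x ⟩
        (a + x * evalℚ p x) * evalℚ (∂ₚ q) x               ≡⟨ cong (λ a → (a + x * evalℚ p x) * evalℚ (∂ₚ q) x) a≡0 ⟩
        (0ℚ + x * evalℚ p x) * evalℚ (∂ₚ q) x              ≡⟨ cong (_* evalℚ (∂ₚ q) x) (ℚₚ.+-identityˡ (x * evalℚ p x)) ⟩
        x * evalℚ p x * evalℚ (∂ₚ q) x                     ∎

  -- With k = p(0)/q(0) the polynomial p - k q vanishes at 0 and still has zero Wronskian with q,
  -- hence is zero. The base point 0 is the reason for asking q(0) ≠ 0.
  wronskian≈0⇒proportional : ∀ p q → evalℚ q 0ℚ ≢ 0ℚ → ∂ₚ p *ₚ q ≋ p *ₚ ∂ₚ q →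
    ∃ λ k → ∀ x → evalℚ p x ≡ k * evalℚ q x
  wronskian≈0⇒proportional p q q₀≢0 h = k , λ x → x-y≡0⇒x≡y (trans (sym (ev-s x)) (ev-zero s x s≈0))
    where
    instance _ = ℚ.≢-nonZero q₀≢0
    k : ℚ
    k = evalℚ p 0ℚ * ℚ.1/ evalℚ q 0ℚ
    s : Poly
    s = p +ₚ (-ₚ scale k q)
    ev-s : ∀ x → evalℚ s x ≡ evalℚ p x - k * evalℚ q x
    ev-s x = ev-+≡ p (-ₚ scale k q) refl (ev-neg≡ (scale k q) (ev-scale k q x))
    ev-∂s : ∀ x → evalℚ (∂ₚ s) x ≡ evalℚ (∂ₚ p) x - k * evalℚ (∂ₚ q) x
    ev-∂s x = trans (ev-∂+ p (-ₚ scale k q) x)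
      (cong (evalℚ (∂ₚ p) x +_) (trans (ev-∂neg (scale k q) x) (cong -_ (ev-∂scale k q x))))
    ev-h : ∀ x → evalℚ (∂ₚ p) x * evalℚ q x ≡ evalℚ p x * evalℚ (∂ₚ q) x
    ev-h x = trans (sym (ev-* (∂ₚ p) q x)) (trans (ev-cong h x) (ev-* p (∂ₚ q) x))
    s₀≡0 : evalℚ s 0ℚ ≡ 0ℚ
    s₀≡0 = trans (ev-s 0ℚ) (x≡y⇒x-y≡0 (sym (begin
      evalℚ p 0ℚ * ℚ.1/ evalℚ q 0ℚ * evalℚ q 0ℚ    ≡⟨ ℚₚ.*-assoc (evalℚ p 0ℚ) (ℚ.1/ evalℚ q 0ℚ) (evalℚ q 0ℚ) ⟩
      evalℚ p 0ℚ * (ℚ.1/ evalℚ q 0ℚ * evalℚ q 0ℚ)  ≡⟨ cong (evalℚ p 0ℚ *_) (ℚₚ.*-inverseˡ (evalℚ q 0ℚ)) ⟩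
      evalℚ p 0ℚ * 1ℚ                              ≡⟨ ℚₚ.*-identityʳ (evalℚ p 0ℚ) ⟩
      evalℚ p 0ℚ                                   ∎)))
    s≈0 : s ≈ₚ 0ₚ
    s≈0 = wronskian-vanishing s q s₀≡0 q₀≢0 λ x → begin
        evalℚ (∂ₚ s) x * evalℚ q x
          ≡⟨ cong (_* evalℚ q x) (ev-∂s x) ⟩
        (evalℚ (∂ₚ p) x - k * evalℚ (∂ₚ q) x) * evalℚ q x
          ≡⟨ solve 4 (λ u v v′ k → (u :- k :* v′) :* v := u :* v :- k :* v :* v′) refl
              (evalℚ (∂ₚ p) x) (evalℚ q x) (evalℚ (∂ₚ q) x) k ⟩
        evalℚ (∂ₚ p) x * evalℚ q x - k * evalℚ q x * evalℚ (∂ₚ q) x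
          ≡⟨ cong (_- k * evalℚ q x * evalℚ (∂ₚ q) x) (ev-h x) ⟩
        evalℚ p x * evalℚ (∂ₚ q) x - k * evalℚ q x * evalℚ (∂ₚ q) x
          ≡⟨ solve 4 (λ u v v′ k → u :* v′ :- k :* v :* v′ := (u :- k :* v) :* v′) refl
              (evalℚ p x) (evalℚ q x) (evalℚ (∂ₚ q) x) k ⟩
        (evalℚ p x - k * evalℚ q x) * evalℚ (∂ₚ q) x
          ≡⟨ cong (_* evalℚ (∂ₚ q) x) (ev-s x) ⟨
        evalℚ s x * evalℚ (∂ₚ q) x ∎

open Polynomials

-- Rational functions as a differential field

infix 4 _≃_
record _≃_ (x y : RatFun) : Set where
  constructor crosswise
  field cross : num x *ₚ den y ≋ num y *ₚ den x
open _≃_ public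

module _ where
  open CommutativeRing Poly-commutativeRing
  open IntegerSolver Poly-commutativeRing
  open SetoidReasoning setoid

  cancelₚ : ∀ {p q s} → ¬ p ≋ 0ₚ → p * q ≋ p * s → q ≋ s
  cancelₚ {p} {q} {s} p≉0 h = begin
    q            ≈⟨ solve 2 (λ q s → q := (q :- s) :+ s) refl q s ⟩
    (q - s) + s  ≈⟨ +-congʳ (noZeroDivisorsₚ {p} {q - s} (begin
      p * (q - s)    ≈⟨ solve 3 (λ p q s → p :* (q :- s) := p :* q :- p :* s) refl p q s ⟩
      p * q - p * s  ≈⟨ +-congʳ h ⟩
      p * s - p * s  ≈⟨ -‿inverseʳ (p * s) ⟩
      0#             ∎) p≉0) ⟩
    0# + s       ≈⟨ +-identityˡ s ⟩
    s            ∎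

  private
    const0 : const 0ℚ ≋ 0ₚ
    const0 = coeffwise λ { zero → ≡.refl ; (suc i) → ≡.refl }

    den≋̸0 : ∀ x → ¬ den x ≋ 0ₚ
    den≋̸0 x h = den≉0 x (coeffs h)

    ≃-trans : ∀ {x y z} → x ≃ y → y ≃ z → x ≃ z
    ≃-trans {x} {y} {z} (crosswise h) (crosswise k) = crosswise (cancelₚ (den≋̸0 y) (begin
      den y * (num x * den z)  ≈⟨ solve 3 (λ a b c → b :* (a :* c) := (a :* b) :* c) refl (num x) (den y) (den z) ⟩
      (num x * den y) * den z  ≈⟨ *-congʳ h ⟩
      (num y * den x) * den z  ≈⟨ solve 3 (λ a b c → (a :* b) :* c := (a :* c) :* b) refl (num y) (den x) (den z) ⟩
      (num y * den z) * den x  ≈⟨ *-congʳ k ⟩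
      (num z * den y) * den x  ≈⟨ solve 3 (λ a b c → (a :* b) :* c := b :* (a :* c)) refl (num z) (den y) (den x) ⟩
      den y * (num z * den x)  ∎))

    +ᶠ-cong : ∀ {x x′ y y′} → x ≃ x′ → y ≃ y′ → x +ᶠ y ≃ x′ +ᶠ y′
    +ᶠ-cong {x} {x′} {y} {y′} (crosswise h) (crosswise k) = crosswise (begin
      (num x * den y + num y * den x) * (den x′ * den y′)
        ≈⟨ solve 6 (λ a b c d b′ d′ → (a :* d :+ c :* b) :* (b′ :* d′) := (a :* b′) :* (d :* d′) :+ (c :* d′) :* (b :* b′))
            refl (num x) (den x) (num y) (den y) (den x′) (den y′) ⟩
      (num x * den x′) * (den y * den y′) + (num y * den y′) * (den x * den x′)
        ≈⟨ +-cong (*-congʳ h) (*-congʳ k) ⟩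
      (num x′ * den x) * (den y * den y′) + (num y′ * den y) * (den x * den x′)
        ≈⟨ solve 6 (λ a b c d b′ d′ → (a :* b′) :* (d′ :* d) :+ (c :* d′) :* (b′ :* b) := (a :* d :+ c :* b) :* (b′ :* d′))
            refl (num x′) (den x′) (num y′) (den y′) (den x) (den y) ⟩
      (num x′ * den y′ + num y′ * den x′) * (den x * den y) ∎)

    *ᶠ-cong : ∀ {x x′ y y′} → x ≃ x′ → y ≃ y′ → x *ᶠ y ≃ x′ *ᶠ y′
    *ᶠ-cong {x} {x′} {y} {y′} (crosswise h) (crosswise k) = crosswise (begin
      (num x * num y) * (den x′ * den y′)
        ≈⟨ solve 4 (λ a c b′ d′ → (a :* c) :* (b′ :* d′) := (a :* b′) :* (c :* d′)) refl (num x) (num y) (den x′) (den y′) ⟩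
      (num x * den x′) * (num y * den y′)
        ≈⟨ *-cong h k ⟩
      (num x′ * den x) * (num y′ * den y)
        ≈⟨ solve 4 (λ a c b′ d′ → (a :* b′) :* (c :* d′) := (a :* c) :* (b′ :* d′)) refl (num x′) (num y′) (den x) (den y) ⟩
      (num x′ * num y′) * (den x * den y) ∎)

    -ᶠ-cong : ∀ {x y} → x ≃ y → -ᶠ x ≃ -ᶠ y
    -ᶠ-cong {x} {y} (crosswise h) = crosswise (begin
      (- num x) * den y  ≈⟨ solve 2 (λ a b → (:- a) :* b := :- (a :* b)) refl (num x) (den y) ⟩
      - (num x * den y)  ≈⟨ -‿cong h ⟩
      - (num y * den x)  ≈⟨ solve 2 (λ a b → :- (a :* b) := (:- a) :* b) refl (num y) (den x) ⟩
      (- num y) * den x  ∎)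

    +ᶠ-comm : ∀ x y → x +ᶠ y ≃ y +ᶠ x
    +ᶠ-comm x y = crosswise (solve 4 (λ a b c d → (a :* d :+ c :* b) :* (d :* b) := (c :* b :+ a :* d) :* (b :* d)) refl
      (num x) (den x) (num y) (den y))

    +ᶠ-identityˡ : ∀ x → constᶠ 0ℚ +ᶠ x ≃ x
    +ᶠ-identityˡ x = crosswise (begin
      (const 0ℚ * den x + num x * 1#) * den x  ≈⟨ *-congʳ {den x} (+-congʳ {num x * 1#} (*-congʳ {den x} const0)) ⟩
      (0# * den x + num x * 1#) * den x
        ≈⟨ solve 2 (λ a b → (con (ℤ.+ 0) :* b :+ a :* con (ℤ.+ 1)) :* b := a :* (con (ℤ.+ 1) :* b)) refl (num x) (den x) ⟩
      num x * (1# * den x) ∎)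

    -ᶠ-inverseʳ : ∀ x → x +ᶠ (-ᶠ x) ≃ constᶠ 0ℚ
    -ᶠ-inverseʳ x = crosswise (begin
      (num x * den x + (- num x) * den x) * 1#
        ≈⟨ solve 2 (λ a b → (a :* b :+ (:- a) :* b) :* con (ℤ.+ 1) := con (ℤ.+ 0) :* (b :* b)) refl (num x) (den x) ⟩
      0# * (den x * den x)  ≈⟨ *-congʳ const0 ⟨
      const 0ℚ * (den x * den x) ∎)

    *ᶠ-comm : ∀ x y → x *ᶠ y ≃ y *ᶠ x
    *ᶠ-comm x y = crosswise (solve 4 (λ a b c d → (a :* c) :* (d :* b) := (c :* a) :* (b :* d)) refl
      (num x) (den x) (num y) (den y))

    *ᶠ-identityˡ : ∀ x → constᶠ 1ℚ *ᶠ x ≃ x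
    *ᶠ-identityˡ x = crosswise (solve 2 (λ a b → (con (ℤ.+ 1) :* a) :* b := a :* (con (ℤ.+ 1) :* b)) refl (num x) (den x))

    *ᶠ-distribˡ-+ᶠ : ∀ x y z → x *ᶠ (y +ᶠ z) ≃ x *ᶠ y +ᶠ x *ᶠ z
    *ᶠ-distribˡ-+ᶠ x y z = crosswise (solve 6 (λ a b c d e f → (a :* (c :* f :+ e :* d)) :* ((b :* d) :* (b :* f))
        := ((a :* c) :* (b :* f) :+ (a :* e) :* (b :* d)) :* (b :* (d :* f))) refl
      (num x) (den x) (num y) (den y) (num z) (den z))

  RatFun-commutativeRing : CommutativeRing 0ℓ 0ℓ
  RatFun-commutativeRing = record
    { Carrier = RatFun ; _≈_ = _≃_ ; _+_ = _+ᶠ_ ; _*_ = _*ᶠ_ ; -_ = -ᶠ_ ; 0# = constᶠ 0ℚ ; 1# = constᶠ 1ℚ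
    ; isCommutativeRing = record
      { isRing = record
        { +-isAbelianGroup = record
          { isGroup = record
            { isMonoid = record
              { isSemigroup = record
                { isMagma = record
                  { isEquivalence = record
                    { refl = crosswise refl ; sym = λ h → crosswise (sym (cross h)) ; trans = ≃-trans }
                  ; ∙-cong = +ᶠ-cong }
                ; assoc = λ x y z → crosswise (solve 6 (λ a b c d e f →
                    ((a :* d :+ c :* b) :* f :+ e :* (b :* d)) :* (b :* (d :* f)) :=
                    (a :* (d :* f) :+ (c :* f :+ e :* d) :* b) :* ((b :* d) :* f)) refl
                    (num x) (den x) (num y) (den y) (num z) (den z)) }
              ; identity = +ᶠ-identityˡ , λ x → ≃-trans (+ᶠ-comm x (constᶠ 0ℚ)) (+ᶠ-identityˡ x) }
            ; inverse = (λ x → ≃-trans (+ᶠ-comm (-ᶠ x) x) (-ᶠ-inverseʳ x)) , -ᶠ-inverseʳ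
            ; ⁻¹-cong = -ᶠ-cong }
          ; comm = +ᶠ-comm }
        ; *-cong = *ᶠ-cong
        ; *-assoc = λ x y z → crosswise (solve 6 (λ a b c d e f →
            ((a :* c) :* e) :* (b :* (d :* f)) := (a :* (c :* e)) :* ((b :* d) :* f)) refl
            (num x) (den x) (num y) (den y) (num z) (den z))
        ; *-identity = *ᶠ-identityˡ , λ x → ≃-trans (*ᶠ-comm x (constᶠ 1ℚ)) (*ᶠ-identityˡ x)
        ; distrib = *ᶠ-distribˡ-+ᶠ , λ x y z → ≃-trans (*ᶠ-comm (y +ᶠ z) x)
            (≃-trans (*ᶠ-distribˡ-+ᶠ x y z) (+ᶠ-cong (*ᶠ-comm x y) (*ᶠ-comm x z))) }
      ; *-comm = *ᶠ-comm } }

  num≋0⇒≃0 : ∀ {x} → num x ≋ 0ₚ → x ≃ constᶠ 0ℚ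
  num≋0⇒≃0 {x} h = crosswise (begin
    num x * 1#        ≈⟨ *-congʳ h ⟩
    0# * 1#           ≈⟨ solve 1 (λ b → con (ℤ.+ 0) :* con (ℤ.+ 1) := con (ℤ.+ 0) :* b) refl (den x) ⟩
    0# * den x        ≈⟨ *-congʳ const0 ⟨
    const 0ℚ * den x  ∎)

  ≃0⇒num≋0 : ∀ {x} → x ≃ constᶠ 0ℚ → num x ≋ 0ₚ
  ≃0⇒num≋0 {x} (crosswise h) = begin
    num x             ≈⟨ *-identityʳ (num x) ⟨
    num x * 1#        ≈⟨ h ⟩
    const 0ℚ * den x  ≈⟨ *-congʳ const0 ⟩
    0# * den x        ≈⟨ zeroˡ (den x) ⟩
    0#                ∎

  noZeroDivisorsᶠ : ∀ {x y} → x *ᶠ y ≃ constᶠ 0ℚ → ¬ x ≃ constᶠ 0ℚ → y ≃ constᶠ 0ℚ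
  noZeroDivisorsᶠ {x} h x≄0 = num≋0⇒≃0 (noZeroDivisorsₚ {num x} (≃0⇒num≋0 h) (λ e → x≄0 (num≋0⇒≃0 e)))

  inv-inverseˡ : ∀ x x≉0 → inv x x≉0 *ᶠ x ≃ constᶠ 1ℚ
  inv-inverseˡ x x≉0 = crosswise (solve 2 (λ a b → (b :* a) :* con (ℤ.+ 1) := con (ℤ.+ 1) :* (a :* b)) refl (num x) (den x))

  ∂ : RatFun → RatFun
  ∂ x = (∂ₚ (num x) * den x - num x * ∂ₚ (den x)) / (den x * den x)
    [ *ₚ-nonZero (den x) (den x) (den≉0 x) (den≉0 x) ]

  -- Fractions are not reduced, so the quotient rule must be shown independent of the
  -- representative: a′ d is eliminated with the derivative of a d = c b, and what remains needs
  -- only a d = c b itself.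
  ∂-cong : ∀ {x y} → x ≃ y → ∂ x ≃ ∂ y
  ∂-cong {x} {y} (crosswise h) = crosswise (begin
    (a′ * b - a * b′) * (d * d)
      ≈⟨ solve 5 (λ a b a′ b′ d → (a′ :* b :- a :* b′) :* (d :* d) := b :* d :* (a′ :* d) :- (a :* d) :*
        (b′ :* d)) refl a b a′ b′ d ⟩
    b * d * (a′ * d) - (a * d) * (b′ * d)
      ≈⟨ +-congʳ {x = - ((a * d) * (b′ * d))} (*-congˡ {b * d} a′d) ⟩
    b * d * ((c′ * b + c * b′) - a * d′) - (a * d) * (b′ * d)
      ≈⟨ solve 7 (λ a b c d b′ c′ d′ → b :* d :* ((c′ :* b :+ c :* b′) :- a :* d′) :- (a :* d) :* (b′ :* d)
           := b :* d :* (c′ :* b :+ c :* b′) :- (a :* d) :* (b :* d′ :+ b′ :* d)) refl a b c d b′ c′ d′ ⟩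
    b * d * (c′ * b + c * b′) - (a * d) * (b * d′ + b′ * d)
      ≈⟨ +-congˡ (-‿cong (*-congʳ h)) ⟩
    b * d * (c′ * b + c * b′) - (c * b) * (b * d′ + b′ * d)
      ≈⟨ solve 6 (λ b c d b′ c′ d′ → b :* d :* (c′ :* b :+ c :* b′) :- (c :* b) :* (b :* d′ :+ b′ :* d)
           := (c′ :* d :- c :* d′) :* (b :* b)) refl b c d b′ c′ d′ ⟩
    (c′ * d - c * d′) * (b * b) ∎)
    where
    a = num x
    b = den x
    c = num y
    d = den y
    a′ = ∂ₚ a
    b′ = ∂ₚ b
    c′ = ∂ₚ c
    d′ = ∂ₚ d
    a′d : a′ * d ≈ (c′ * b + c * b′) - a * d′
    a′d = begin
      a′ * d                         ≈⟨ solve 4 (λ a d a′ d′ → a′ :* d := (a′ :* d :+ a :* d′) :- a :* d′) refl a d a′ d′ ⟩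
      (a′ * d + a * d′) - a * d′     ≈⟨ +-congʳ (trans (sym (∂ₚ-* a d)) (trans (∂ₚ-cong h) (∂ₚ-* c b))) ⟩
      (c′ * b + c * b′) - a * d′     ∎

  ∂-+ : ∀ x y → ∂ (x +ᶠ y) ≃ ∂ x +ᶠ ∂ y
  ∂-+ x y = crosswise (begin
    (∂ₚ (a * d + c * b) * (b * d) - (a * d + c * b) * ∂ₚ (b * d)) * ((b * b) * (d * d))
      ≈⟨ *-congʳ (+-cong (*-congʳ (trans (∂ₚ-+ (a * d) (c * b)) (+-cong (∂ₚ-* a d) (∂ₚ-* c b))))
        (-‿cong (*-congˡ {a * d + c * b} (∂ₚ-* b d)))) ⟩
    (((a′ * d + a * d′) + (c′ * b + c * b′)) * (b * d) - (a * d + c * b) * (b′ * d + b * d′)) * ((b * b) * (d * d))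
      ≈⟨ solve 8 (λ a b c d a′ b′ c′ d′ →
          (((a′ :* d :+ a :* d′) :+ (c′ :* b :+ c :* b′)) :* (b :* d) :- (a :* d :+ c :* b) :* (b′ :* d :+ b :* d′)) :*
            ((b :* b) :* (d :* d))
          := ((a′ :* b :- a :* b′) :* (d :* d) :+ (c′ :* d :- c :* d′) :* (b :* b)) :*
            ((b :* d) :* (b :* d))) refl a b c d a′ b′ c′ d′ ⟩
    ((a′ * b - a * b′) * (d * d) + (c′ * d - c * d′) * (b * b)) * ((b * d) * (b * d)) ∎)
    where
    a = num x
    b = den x
    c = num y
    d = den y
    a′ = ∂ₚ a
    b′ = ∂ₚ b
    c′ = ∂ₚ c
    d′ = ∂ₚ d

  ∂-* : ∀ x y → ∂ (x *ᶠ y) ≃ ∂ x *ᶠ y +ᶠ x *ᶠ ∂ y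
  ∂-* x y = crosswise (begin
    (∂ₚ (a * c) * (b * d) - (a * c) * ∂ₚ (b * d)) * (((b * b) * d) * (b * (d * d)))
      ≈⟨ *-congʳ (+-cong (*-congʳ (∂ₚ-* a c)) (-‿cong (*-congˡ {a * c} (∂ₚ-* b d)))) ⟩
    ((a′ * c + a * c′) * (b * d) - (a * c) * (b′ * d + b * d′)) * (((b * b) * d) * (b * (d * d)))
      ≈⟨ solve 8 (λ a b c d a′ b′ c′ d′ →
          ((a′ :* c :+ a :* c′) :* (b :* d) :- (a :* c) :* (b′ :* d :+ b :* d′)) :* (((b :* b) :* d) :* (b :* (d :* d)))
          := (((a′ :* b :- a :* b′) :* c) :* (b :* (d :* d)) :+ (a :* (c′ :* d :- c :* d′)) :* ((b :* b) :* d)) :*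
            ((b :* d) :* (b :* d))) refl a b c d a′ b′ c′ d′ ⟩
    (((a′ * b - a * b′) * c) * (b * (d * d)) + (a * (c′ * d - c * d′)) * ((b * b) * d)) * ((b * d) * (b * d)) ∎)
    where
    a = num x
    b = den x
    c = num y
    d = den y
    a′ = ∂ₚ a
    b′ = ∂ₚ b
    c′ = ∂ₚ c
    d′ = ∂ₚ d

infix 8 ⟪_⟫
⟪_⟫ : Poly → RatFun
⟪ p ⟫ = p / 1ₚ [ 1ₚ≉0ₚ ]

module _ where
  open CommutativeRing Poly-commutativeRing
  open IntegerSolver Poly-commutativeRing
  open SetoidReasoning setoid

  ⟪⟫-cong : ∀ {p q} → p ≋ q → ⟪ p ⟫ ≃ ⟪ q ⟫
  ⟪⟫-cong h = crosswise (*-congʳ h)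

  ⟪⟫-+ : ∀ p q → ⟪ p +ₚ q ⟫ ≃ ⟪ p ⟫ +ᶠ ⟪ q ⟫
  ⟪⟫-+ p q = crosswise (solve 2 (λ p q → (p :+ q) :* (con (ℤ.+ 1) :* con (ℤ.+ 1)) :=
    (p :* con (ℤ.+ 1) :+ q :* con (ℤ.+ 1)) :* con (ℤ.+ 1)) refl p q)

  ⟪⟫-* : ∀ p q → ⟪ p *ₚ q ⟫ ≃ ⟪ p ⟫ *ᶠ ⟪ q ⟫
  ⟪⟫-* p q = crosswise (solve 2 (λ p q → (p :* q) :* (con (ℤ.+ 1) :* con (ℤ.+ 1)) := (p :* q) :* con (ℤ.+ 1)) refl p q)

  fraction-* : ∀ p q q≉0 → (p / q [ q≉0 ]) *ᶠ ⟪ q ⟫ ≃ ⟪ p ⟫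
  fraction-* p q q≉0 = crosswise (solve 2 (λ p q → (p :* q) :* con (ℤ.+ 1) := p :* (q :* con (ℤ.+ 1))) refl p q)

  -- The Wronskian of X and W² is, up to a power of b, that of X/b² and (W/b)².
  wronskian-homogeneous : ∀ X W b b≉0 b²≉0 →
    (W / b [ b≉0 ]) *ᶠ ∂ (X / (b *ₚ b) [ b²≉0 ]) ≃
      (X / (b *ₚ b) [ b²≉0 ]) *ᶠ ∂ (W / b [ b≉0 ]) +ᶠ (X / (b *ₚ b) [ b²≉0 ]) *ᶠ ∂ (W / b [ b≉0 ]) →
    ∂ₚ X * (W * W) ≋ X * ∂ₚ (W * W)
  wronskian-homogeneous X W b b≉0 b²≉0 (crosswise h) = begin
    X′ * (W * W)               ≈⟨ solve 2 (λ X′ W → X′ :* (W :* W) := W :* (W :* X′)) refl X′ W ⟩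
    W * (W * X′)               ≈⟨ *-congˡ {W} (cancelₚ b¹⁰≉0 scaled) ⟩
    W * (X * W′ + X * W′)      ≈⟨ solve 3 (λ X W W′ → W :* (X :* W′ :+ X :* W′) := X :* (W′ :* W :+ W :* W′)) refl X W W′ ⟩
    X * (W′ * W + W * W′)      ≈⟨ *-congˡ {X} (∂ₚ-* W W) ⟨
    X * ∂ₚ (W * W)             ∎
    where
    X′ = ∂ₚ X
    W′ = ∂ₚ W
    b′ = ∂ₚ b
    b⁴ = (b * b) * (b * b)
    b⁹ = (b * b⁴) * b⁴
    b¹⁰≉0 : ¬ b * b⁹ ≋ 0ₚ
    b¹⁰≉0 e = *ₚ-nonZero b b⁹ b≉0
      (*ₚ-nonZero (b * b⁴) b⁴ (*ₚ-nonZero b b⁴ b≉0 b⁴≉0) b⁴≉0) (coeffs e)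
      where
      b⁴≉0 : ¬ b⁴ ≈ₚ 0ₚ
      b⁴≉0 = *ₚ-nonZero (b * b) (b * b) b²≉0 b²≉0
    lhs rhs : Poly → Poly
    lhs u = W * (X′ * (b * b) - X * u) * (((b * b) * (b * b)) * ((b * b) * (b * b)))
    rhs u = ((X * (W′ * b - W * b′)) * ((b * b) * (b * b)) + (X * (W′ * b - W * b′)) * ((b * b) * (b * b))) *
      (b * ((b * b) * (b * b)))
    expanded : lhs (b′ * b + b * b′) ≈ rhs 0#
    expanded = begin
      W * (X′ * (b * b) - X * (b′ * b + b * b′)) * (b⁴ * b⁴)
        ≈⟨ *-congʳ {b⁴ * b⁴} (*-congˡ {W} (+-congˡ {X′ * (b * b)} (-‿cong (*-congˡ {X} (∂ₚ-* b b))))) ⟨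
      W * (X′ * (b * b) - X * ∂ₚ (b * b)) * (b⁴ * b⁴)  ≈⟨ h ⟩
      rhs 0# ∎
    -- Clearing denominators leaves the same term 2 b⁹ X W b′ on both sides; adding it back leaves
    -- b¹⁰ times the claim.
    scaled : b * b⁹ * (W * X′) ≈ b * b⁹ * (X * W′ + X * W′)
    scaled = begin
      b * b⁹ * (W * X′)
        ≈⟨ solve 5 (λ b b′ X W X′ →
             let b⁴ = (b :* b) :* (b :* b) ; b⁹ = (b :* b⁴) :* b⁴ in
             b :* b⁹ :* (W :* X′) := W :* (X′ :* (b :* b) :- X :* (b′ :* b :+ b :* b′)) :* (b⁴ :* b⁴) :+ b⁹ :*
               (X :* W :* b′ :+ X :* W :* b′))
             refl b b′ X W X′ ⟩
      lhs (b′ * b + b * b′) + b⁹ * (X * W * b′ + X * W * b′)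
        ≈⟨ +-congʳ expanded ⟩
      rhs 0# + b⁹ * (X * W * b′ + X * W * b′)
        ≈⟨ solve 5 (λ b b′ X W W′ →
             let b⁴ = (b :* b) :* (b :* b) ; b⁹ = (b :* b⁴) :* b⁴ ; u = (X :* (W′ :* b :- W :* b′)) :* b⁴ in
             (u :+ u) :* (b :* b⁴) :+ b⁹ :* (X :* W :* b′ :+ X :* W :* b′) := b :* b⁹ :* (X :* W′ :+ X :* W′))
             refl b b′ X W W′ ⟩
      b * b⁹ * (X * W′ + X * W′) ∎

private
  fromℕ : ℕ → ℚ
  fromℕ zero    = 0ℚ
  fromℕ (suc n) = 1ℚ ℚ.+ fromℕ n

  0≤fromℕ : ∀ n → 0ℚ ℚ.≤ fromℕ n
  0≤fromℕ zero    = ℚₚ.≤-refl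
  0≤fromℕ (suc n) = ℚₚ.+-mono-≤ (ℚₚ.<⇒≤ (ℚₚ.positive⁻¹ 1ℚ)) (0≤fromℕ n)

module _ where
  open CommutativeRing RatFun-commutativeRing
  open IntegerSolver RatFun-commutativeRing using (_·_)
  open SemiringMult semiring using (×-assoc-*; ×-congʳ)

  ·1≃ : ∀ n → n · 1# ≃ ⟪ const (fromℕ n) ⟫
  ·1≃ zero    = refl {0#}
  ·1≃ (suc n) = trans (+-congˡ {1#} (·1≃ n)) (sym (⟪⟫-+ (const 1ℚ) (const (fromℕ n))))

  torsionFreeᶠ : ∀ n {x} → suc n · x ≃ 0# → x ≃ 0#
  torsionFreeᶠ n {x} h = noZeroDivisorsᶠ {suc n · 1#} {x}
    (trans (×-assoc-* (suc n) 1# x) (trans (×-congʳ (suc n) (*-identityˡ x)) h))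
    λ e → ℚₚ.<-irrefl (≡.sym (coeffs (≃0⇒num≋0 (trans (sym (·1≃ (suc n))) e)) 0))
      (ℚₚ.+-mono-<-≤ (ℚₚ.positive⁻¹ 1ℚ) (0≤fromℕ n))

  inverseᶠ : ∀ {x} → ¬ x ≃ 0# → ∃ λ i → i * x ≃ 1#
  inverseᶠ {x} x≄0 = inv x x≉0 , inv-inverseˡ x x≉0
    where
    x≉0 : ¬ IsZeroᶠ x
    x≉0 e = x≄0 (num≋0⇒≃0 (coeffwise e))

  RatFun-differentialField : DifferentialField 0ℓ 0ℓ
  RatFun-differentialField = record
    { commutativeRing = RatFun-commutativeRing
    ; noZeroDivisors  = λ {x} {y} → noZeroDivisorsᶠ {x} {y}
    ; torsionFree     = λ n {x} → torsionFreeᶠ n {x}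
    ; inverse         = λ {x} → inverseᶠ {x}
    ; ∂ = ∂ ; ∂-cong = ∂-cong ; ∂-+ = ∂-+ ; ∂-* = ∂-* }

  slope-* : ∀ u x x≉0 → u * inv x x≉0 * x ≃ u
  slope-* u x x≉0 = trans (*-assoc u (inv x x≉0) x) (trans (*-congˡ {u} (inv-inverseˡ x x≉0)) (*-identityʳ u))

  module Multiples (g θ : RatFun) (g≄0 : ¬ g ≃ 0#) (∂g : ∂ g ≃ 4 · (θ * g)) where
    open Flow RatFun-differentialField
    open Along g θ ∂g public

    -- All branches of the addition are covered: the branch O requires opposite points, which
    -- `opposite` excludes when the speeds do not cancel.
    addAff-moves : ∀ {x₁ y₁ x₂ y₂ m₁ m₂} → Moves m₁ x₁ y₁ → Moves m₂ x₂ y₂ → ¬ m₁ + m₂ ≃ 0# →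
      (dx : Dec (IsZeroᶠ (x₂ -ᶠ x₁))) (dy : Dec (IsZeroᶠ (y₁ +ᶠ y₂))) →
      ∃₂ λ x y → addAff g x₁ y₁ x₂ y₂ dx dy ≡ aff x y × Moves (m₁ + m₂) x y
    addAff-moves {x₁} {y₁} {x₂} {y₂} {m₁} {m₂} M₁ M₂ m≄0 (no x₂≉x₁) _ =
      l * l - x₁ - x₂ , l * (x₁ - (l * l - x₁ - x₂)) - y₁ , ≡.refl ,
      chord {l} {x₁} {y₁} {x₂} {y₂} {m₁} {m₂} M₁ M₂ (λ e → x₂≉x₁ (coeffs (≃0⇒num≋0 e))) (slope-* (y₂ - y₁) (x₂ - x₁) x₂≉x₁)
      where l = (y₂ - y₁) * inv (x₂ - x₁) x₂≉x₁
    addAff-moves {x₁} {y₁} {x₂} {y₂} {m₁} {m₂} M₁ M₂ m≄0 (yes x₂≈x₁) (yes y₁≈-y₂) =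
      ⊥-elim (opposite {x₁} {y₁} {x₂} {y₂} {m₁} {m₂} g≄0 M₁ M₂
        (num≋0⇒≃0 (coeffwise x₂≈x₁)) (num≋0⇒≃0 (coeffwise y₁≈-y₂)) m≄0)
    addAff-moves {x₁} {y₁} {x₂} {y₂} {m₁} {m₂} M₁ M₂ m≄0 (yes x₂≈x₁) (no y₁≉-y₂) =
      l * l - x₁ - x₂ , l * (x₁ - (l * l - x₁ - x₂)) - y₁ , ≡.refl ,
      tangent {l} {x₁} {y₁} {x₂} {y₂} {m₁} {m₂} M₁ M₂ (num≋0⇒≃0 (coeffwise x₂≈x₁)) (λ e → y₁≉-y₂ (coeffs (≃0⇒num≋0 e)))
        (slope-* (x₁ * x₁ + x₁ * x₁ + x₁ * x₁ + g) (y₁ + y₂) y₁≉-y₂)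
      where l = (x₁ * x₁ + x₁ * x₁ + x₁ * x₁ + g) * inv (y₁ + y₂) y₁≉-y₂

    -- In characteristic 0 the speeds m, 2 m, 3 m, ... are all nonzero, so no multiple ever reaches
    -- O.
    multiple-moves : ∀ {m x y} → Moves m x y → ¬ m ≃ 0# → ∀ n →
      ∃₂ λ x′ y′ → multiple (ℰ g) (suc n) (aff x y) ≡ aff x′ y′ × Moves (suc n · m) x′ y′
    multiple-moves {m} {x} {y} M m≄0 zero = x , y , ≡.refl ,
      Moves-resp-speed {m} {m + 0#} {x} {y} (sym (+-identityʳ m)) M
    multiple-moves {m} {x} {y} M m≄0 (suc n) = step (multiple-moves M m≄0 n)
      where
      step : (∃₂ λ x′ y′ → multiple (ℰ g) (suc n) (aff x y) ≡ aff x′ y′ × Moves (suc n · m) x′ y′) →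
        ∃₂ λ x″ y″ → multiple (ℰ g) (suc (suc n)) (aff x y) ≡ aff x″ y″ × Moves (suc (suc n) · m) x″ y″
      step (x′ , y′ , eq , M′) = sum .proj₁ , sum .proj₂ .proj₁ ,
        ≡.trans (≡.cong (add (ℰ g) (aff x y)) eq) (sum .proj₂ .proj₂ .proj₁) , sum .proj₂ .proj₂ .proj₂
        where
        sum : ∃₂ λ x″ y″ → add (ℰ g) (aff x y) (aff x′ y′) ≡ aff x″ y″ × Moves (m + suc n · m) x″ y″
        sum = addAff-moves {x} {y} {x′} {y′} {m} {suc n · m} M M′ (λ e → m≄0 (torsionFreeᶠ (suc n) {m} e))
          (zero? (num (x′ -ᶠ x))) (zero? (num (y +ᶠ y′)))

module K = CommutativeRing RatFun-commutativeRing

module _ {c ℓ} (F : DifferentialField c ℓ) where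
  open DifferentialField F
  open IntegerSolver commutativeRing
  open LinearCombination commutativeRing

  -- With φ = a/β, x = X/β² and w = W/β both sides have denominator β⁴; hence the four
  -- cancellations. The final `φ * 0#` matches the end of `eval` on a list of five coefficients.
  dehomogenise : ∀ {c₀ c₁ c₂ c₃ c₄ φ x w β a X W} → ¬ β ≈ 0# →
    φ * β ≈ a → x * (β * β) ≈ X → w * β ≈ W →
    X * (W * W) ≈ X * X + (β * (β * (β * (β * c₀ + a * c₁) + a * a * c₂) + a * a * a * c₃) + a * a * a * a * c₄) →
    x * (w * w) ≈ x * x + (c₀ + φ * (c₁ + φ * (c₂ + φ * (c₃ + φ * (c₄ + φ * 0#)))))
  dehomogenise {c₀} {c₁} {c₂} {c₃} {c₄} {φ} {x} {w} {β} {a} {X} {W} β≉0 hφ hx hw h =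
    ≈-from-difference (cancelβ (cancelβ (cancelβ (cancelβ (trans
      (solve 9 (λ c₀ c₁ c₂ c₃ c₄ φ x w β → let a = φ :* β ; X = x :* (β :* β) ; W = w :* β in
        β :* (β :* (β :* (β :* (x :* (w :* w) :-
          (x :* x :+ (c₀ :+ φ :* (c₁ :+ φ :* (c₂ :+ φ :* (c₃ :+ φ :* (c₄ :+ φ :* con (ℤ.+ 0)))))))))))
        := X :* (W :* W) :- (X :* X :+ (β :* (β :* (β :* (β :* c₀ :+ a :* c₁) :+ a :* a :* c₂) :+ a :* a :* a :* c₃) :+ a
          :* a :* a :* a :* c₄)))
        refl c₀ c₁ c₂ c₃ c₄ φ x w β)
      (difference≈0 (trans (*-cong hx (*-cong hw hw)) (trans h (sym (+-cong (*-cong hx hx)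
        (+-cong (*-congˡ (+-cong (*-congˡ (+-cong (*-congˡ (+-congˡ (*-congʳ hφ))) (*-congʳ (*-cong hφ hφ))))
          (*-congʳ (*-cong (*-cong hφ hφ) hφ)))) (*-congʳ (*-cong (*-cong (*-cong hφ hφ) hφ) hφ)))))))))))))
    where
    cancelβ : ∀ {z} → β * z ≈ 0# → z ≈ 0#
    cancelβ h = noZeroDivisors h β≉0

private
  -- A reified expression can be read in ℚ, in polynomials and in rational functions. `transfer`
  -- uses this to turn an identity between values at every rational number into one between rational
  -- functions.
  data Expr (n : ℕ) : Set where
    var     : Fin n → Expr n
    _⊕_ _⊗_ : Expr n → Expr n → Expr n

  ⟦_⟧ : ∀ {n} → Expr n → {A : Set} → (A → A → A) → (A → A → A) → (Fin n → A) → A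
  ⟦ var i ⟧ _+_ _*_ ρ = ρ i
  ⟦ e ⊕ e′ ⟧ _+_ _*_ ρ = ⟦ e ⟧ _+_ _*_ ρ + ⟦ e′ ⟧ _+_ _*_ ρ
  ⟦ e ⊗ e′ ⟧ _+_ _*_ ρ = ⟦ e ⟧ _+_ _*_ ρ * ⟦ e′ ⟧ _+_ _*_ ρ

  ev-⟦⟧ : ∀ {n} (e : Expr n) ρ {σ : Fin n → ℚ} {r} → (∀ i → evalℚ (ρ i) r ≡ σ i) →
    evalℚ (⟦ e ⟧ _+ₚ_ _*ₚ_ ρ) r ≡ ⟦ e ⟧ ℚ._+_ ℚ._*_ σ
  ev-⟦⟧ (var i)  ρ h = h i
  ev-⟦⟧ (e ⊕ e′) ρ h = ev-+≡ (⟦ e ⟧ _+ₚ_ _*ₚ_ ρ) (⟦ e′ ⟧ _+ₚ_ _*ₚ_ ρ) (ev-⟦⟧ e ρ h) (ev-⟦⟧ e′ ρ h)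
  ev-⟦⟧ (e ⊗ e′) ρ h = ev-*≡ (⟦ e ⟧ _+ₚ_ _*ₚ_ ρ) (⟦ e′ ⟧ _+ₚ_ _*ₚ_ ρ) (ev-⟦⟧ e ρ h) (ev-⟦⟧ e′ ρ h)

  ⟪⟫-⟦⟧ : ∀ {n} (e : Expr n) (ρ : Fin n → Poly) →
    ⟪ ⟦ e ⟧ _+ₚ_ _*ₚ_ ρ ⟫ ≃ ⟦ e ⟧ _+ᶠ_ _*ᶠ_ (λ i → ⟪ ρ i ⟫)
  ⟪⟫-⟦⟧ (var i)  ρ = K.refl {⟪ ρ i ⟫}
  ⟪⟫-⟦⟧ (e ⊕ e′) ρ = K.trans (⟪⟫-+ (⟦ e ⟧ _+ₚ_ _*ₚ_ ρ) (⟦ e′ ⟧ _+ₚ_ _*ₚ_ ρ)) (K.+-cong (⟪⟫-⟦⟧ e ρ) (⟪⟫-⟦⟧ e′ ρ))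
  ⟪⟫-⟦⟧ (e ⊗ e′) ρ = K.trans (⟪⟫-* (⟦ e ⟧ _+ₚ_ _*ₚ_ ρ) (⟦ e′ ⟧ _+ₚ_ _*ₚ_ ρ)) (K.*-cong (⟪⟫-⟦⟧ e ρ) (⟪⟫-⟦⟧ e′ ρ))

  transfer : ∀ {n} (e e′ : Expr n) (ρ : Fin n → Poly) (σ : ℚ → Fin n → ℚ) → (∀ r i → evalℚ (ρ i) r ≡ σ r i) →
    (∀ r → ⟦ e ⟧ ℚ._+_ ℚ._*_ (σ r) ≡ ⟦ e′ ⟧ ℚ._+_ ℚ._*_ (σ r)) →
    ⟦ e ⟧ _+ᶠ_ _*ᶠ_ (λ i → ⟪ ρ i ⟫) ≃ ⟦ e′ ⟧ _+ᶠ_ _*ᶠ_ (λ i → ⟪ ρ i ⟫)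
  transfer e e′ ρ σ h eq = K.trans (K.sym (⟪⟫-⟦⟧ e ρ)) (K.trans
    (⟪⟫-cong (pointwise λ r → ≡.trans (ev-⟦⟧ e ρ (h r)) (≡.trans (eq r) (≡.sym (ev-⟦⟧ e′ ρ (h r))))))
    (⟪⟫-⟦⟧ e′ ρ))

ev-const : ∀ c r → evalℚ (const c) r ≡ c
ev-const c r = ≡.trans (≡.cong (c ℚ.+_) (ℚₚ.*-zeroʳ r)) (ℚₚ.+-identityʳ c)

evalᶠ-zero : ∀ p φ → p ≈ₚ 0ₚ → p ∘ᶠ φ ≃ constᶠ 0ℚ
evalᶠ-zero []      φ h = K.refl {constᶠ 0ℚ}
evalᶠ-zero (a ∷ p) φ h = K.trans
  (K.+-cong (K.reflexive (≡.cong constᶠ (h 0))) (K.trans (K.*-congˡ {φ} (evalᶠ-zero p φ λ i → h (suc i))) (K.zeroʳ φ)))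
  (K.+-identityˡ (constᶠ 0ℚ))

evalᶠ-cong : ∀ p q φ → p ≈ₚ q → p ∘ᶠ φ ≃ q ∘ᶠ φ
evalᶠ-cong []      q       φ h = K.sym (evalᶠ-zero q φ λ i → ≡.sym (h i))
evalᶠ-cong (a ∷ p) []      φ h = evalᶠ-zero (a ∷ p) φ h
evalᶠ-cong (a ∷ p) (b ∷ q) φ h = K.+-cong (K.reflexive (≡.cong constᶠ (h 0)))
  (K.*-congˡ {φ} (evalᶠ-cong p q φ λ i → h (suc i)))

-- Binary quartic forms and the identities behind the base changes

module BinaryQuartic {c ℓ} (R : CommutativeRing c ℓ) where
  open CommutativeRing R
  open IntegerSolver R

  -- The binary form Σ cᵢ aⁱ b⁴⁻ⁱ.
  form : (c₀ c₁ c₂ c₃ c₄ a b : Carrier) → Carrier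
  form c₀ c₁ c₂ c₃ c₄ a b = b * (b * (b * (b * c₀ + a * c₁) + a * a * c₂) + a * a * a * c₃) + a * a * a * a * c₄

  :form : ∀ {n} (c₀ c₁ c₂ c₃ c₄ a b : Polynomial n) → Polynomial n
  :form c₀ c₁ c₂ c₃ c₄ a b =
    b :* (b :* (b :* (b :* c₀ :+ a :* c₁) :+ a :* a :* c₂) :+ a :* a :* a :* c₃) :+ a :* a :* a :* a :* c₄

-- The number 1 appears as 1 · 1#, the value of the solver constant 1; over ℚ this computes to 1ℚ.
module Identities {c ℓ} (R : CommutativeRing c ℓ) where
  open CommutativeRing R
  open IntegerSolver R
  open LinearCombination R
  open BinaryQuartic R

  ev-κ : ∀ c₂ c₃ r →
    - (2 · c₃) + r * ((c₃ * c₃ + c₂) + r * 0#) ≈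
    r * (c₃ * c₃ + c₂) - 2 · c₃
  ev-κ = solve 3 (λ c₂ c₃ r →
    :- (2 :× c₃) :+ r :* ((c₃ :* c₃ :+ c₂) :+ r :* (con (ℤ.+ 0))) :=
    r :* (c₃ :* c₃ :+ c₂) :- 2 :× c₃) refl

  ev-N : ∀ c₀ c₂ c₃ r →
    2 · c₃ + r * ((4 · (c₃ * c₃) - (c₃ * c₃ + c₂)) + r * (- (4 · (c₃ * (c₃ * c₃ + c₂))) + r *
      (((c₃ * c₃ + c₂) * (c₃ * c₃ + c₂) + c₀) + r * 0#))) ≈
    r * ((r * (c₃ * c₃ + c₂) - 2 · c₃) * (r * (c₃ * c₃ + c₂) - 2 · c₃)) + c₀ * (r * r * r) -
      (r * (c₃ * c₃ + c₂) - 2 · c₃)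
  ev-N = solve 4 (λ c₀ c₂ c₃ r →
    2 :× c₃ :+ r :* ((4 :× (c₃ :* c₃) :- (c₃ :* c₃ :+ c₂)) :+ r :*
      (:- (4 :× (c₃ :* (c₃ :* c₃ :+ c₂))) :+ r :* (((c₃ :* c₃ :+ c₂) :* (c₃ :* c₃ :+ c₂) :+ c₀) :+ r :*
      (con (ℤ.+ 0))))) :=
    r :* ((r :* (c₃ :* c₃ :+ c₂) :- 2 :× c₃) :* (r :* (c₃ :* c₃ :+ c₂) :- 2 :× c₃)) :+ c₀ :* (r :* r :* r) :-
      (r :* (c₃ :* c₃ :+ c₂) :- 2 :× c₃)) refl

  ev-D : ∀ c₁ c₂ c₃ r →
    - (3 · c₃) + r * ((2 · (c₃ * c₃ + c₂) + 4 · (c₃ * c₃)) + r *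
      ((- (2 · (c₃ * (c₃ * c₃ + c₂))) - c₁) + r * 0#)) ≈
    c₃ + 2 · (r * (c₃ * c₃ + c₂) - 2 · c₃) - 2 · (c₃ * r * (r * (c₃ * c₃ + c₂) - 2 · c₃)) - c₁ * (r * r)
  ev-D = solve 4 (λ c₁ c₂ c₃ r →
    :- (3 :× c₃) :+ r :* ((2 :× (c₃ :* c₃ :+ c₂) :+ 4 :× (c₃ :* c₃)) :+ r :*
      ((:- (2 :× (c₃ :* (c₃ :* c₃ :+ c₂))) :- c₁) :+ r :* (con (ℤ.+ 0)))) :=
    c₃ :+ 2 :× (r :* (c₃ :* c₃ :+ c₂) :- 2 :× c₃) :- 2 :× (c₃ :* r :* (r :* (c₃ :* c₃ :+ c₂) :- 2 :× c₃)) :- c₁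
      :* (r :* r)) refl

  -- Put t = n/(r d), w = t + 1/r and x = c₃ t + κ/r in x w² = x² + f(t). The t³ terms agree by the
  -- choice of x, κ makes the t² terms agree, and the rest is the linear equation d t = n/r.
  cubic-identity : ∀ c₀ c₁ c₂ c₃ r κ n d →
    κ ≈ r * (c₃ * c₃ + c₂) - 2 · c₃ →
    d ≈ c₃ + 2 · κ - 2 · (c₃ * r * κ) - c₁ * (r * r) →
    n ≈ r * (κ * κ) + c₀ * (r * r * r) - κ →
    (r * d * (c₃ * n + κ * d)) * ((n + d) * (n + d)) ≈
    (r * d * (c₃ * n + κ * d)) * (r * d * (c₃ * n + κ * d)) + (form c₀ c₁ c₂ c₃ 0# n (r * d))
  cubic-identity c₀ c₁ c₂ c₃ r κ n d e1 e2 e3 = ≈-from-difference (trans (solve 8 (λ c₀ c₁ c₂ c₃ r κ n d →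
    (r :* d :* (c₃ :* n :+ κ :* d)) :* ((n :+ d) :* (n :+ d)) :-
      ((r :* d :* (c₃ :* n :+ κ :* d)) :* (r :* d :* (c₃ :* n :+ κ :* d)) :+
      (:form c₀ c₁ c₂ c₃ (con (ℤ.+ 0)) n (r :* d))) :=
    (r :* d :* (n :* n :* d)) :* (κ :- (r :* (c₃ :* c₃ :+ c₂) :- 2 :× c₃))
    :+ ((:- (r :* d :* (n :* d :* d))) :* (d :- (c₃ :+ 2 :× κ :- 2 :× (c₃ :* r :* κ) :- c₁ :* (r :* r)))
    :+ ((r :* d :* (d :* d :* d)) :* (n :- (r :* (κ :* κ) :+ c₀ :* (r :* r :* r) :- κ)))))
    refl c₀ c₁ c₂ c₃ r κ n d)
    (+≈0 (*≈0 _ (difference≈0 e1)) (+≈0 (*≈0 _ (difference≈0 e2)) (*≈0 _ (difference≈0 e3)))))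

  -- With w = t + 1/r and x = c₂ the t² terms agree, and the rest is d t = n/r.
  quadratic-identity : ∀ c₀ c₁ c₂ r n d →
    d ≈ 2 · c₂ - c₁ * r →
    n ≈ (c₂ * c₂ + c₀) * (r * r) - c₂ →
    (c₂ * (r * d * (r * d))) * ((n + d) * (n + d)) ≈
    (c₂ * (r * d * (r * d))) * (c₂ * (r * d * (r * d))) + (form c₀ c₁ c₂ 0# 0# n (r * d))
  quadratic-identity c₀ c₁ c₂ r n d e1 e2 = ≈-from-difference (trans (solve 6 (λ c₀ c₁ c₂ r n d →
    (c₂ :* (r :* d :* (r :* d))) :* ((n :+ d) :* (n :+ d)) :- ((c₂ :* (r :* d :* (r :* d))) :*
      (c₂ :* (r :* d :* (r :* d))) :+ (:form c₀ c₁ c₂ (con (ℤ.+ 0)) (con (ℤ.+ 0)) n (r :* d))) :=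
    (:- (r :* d :* (r :* d) :* d :* n)) :* (d :- (2 :× c₂ :- c₁ :* r))
    :+ ((r :* d :* (r :* d) :* (d :* d)) :* (n :- ((c₂ :* c₂ :+ c₀) :* (r :* r) :- c₂))))
    refl c₀ c₁ c₂ r n d)
    (+≈0 (*≈0 _ (difference≈0 e1)) (*≈0 _ (difference≈0 e2))))

  -- This is (1 + r)² = 1 + c₀ + c₁ t solved for t and cleared of the denominator c₁.
  linear-identity : ∀ c₀ c₁ r →
    c₁ * c₁ * ((c₁ * ((1 · 1#) + r)) * (c₁ * ((1 · 1#) + r))) ≈
    c₁ * c₁ * (c₁ * c₁) + (form c₀ c₁ 0# 0# 0# ((2 · r + r * r) - c₀) c₁)
  linear-identity = solve 3 (λ c₀ c₁ r →
    c₁ :* c₁ :* ((c₁ :* ((con (ℤ.+ 1)) :+ r)) :* (c₁ :* ((con (ℤ.+ 1)) :+ r))) :=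
    c₁ :* c₁ :* (c₁ :* c₁) :+ (:form c₀ c₁ (con (ℤ.+ 0)) (con (ℤ.+ 0)) (con (ℤ.+ 0))
      ((2 :× r :+ r :* r) :- c₀) c₁)) refl

  form-shift : ∀ c₀ c₁ c₂ c₃ c₄ t a b →
    form c₀ c₁ c₂ c₃ c₄ ((1 · 1#) * a + t * b) (0# * a + (1 · 1#) * b) ≈
    form (c₀ + t * (c₁ + t * (c₂ + t * (c₃ + t * c₄)))) (c₁ + t * (2 · c₂ + t * (3 · c₃ + t * (4 · c₄))))
      (c₂ + t * (3 · c₃ + t * (6 · c₄))) (c₃ + t * (4 · c₄)) c₄ a b
  form-shift = solve 8 (λ c₀ c₁ c₂ c₃ c₄ t a b →
    :form c₀ c₁ c₂ c₃ c₄ ((con (ℤ.+ 1)) :* a :+ t :* b) ((con (ℤ.+ 0)) :* a :+ (con (ℤ.+ 1)) :* b) :=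
    :form (c₀ :+ t :* (c₁ :+ t :* (c₂ :+ t :* (c₃ :+ t :* c₄))))
      (c₁ :+ t :* (2 :× c₂ :+ t :* (3 :× c₃ :+ t :* (4 :× c₄)))) (c₂ :+ t :* (3 :× c₃ :+ t :* (6 :× c₄)))
      (c₃ :+ t :* (4 :× c₄)) c₄ a b) refl

  form-swap : ∀ c₀ c₁ c₂ c₃ c₄ a b →
    form c₀ c₁ c₂ c₃ c₄ (0# * a + (1 · 1#) * b) ((1 · 1#) * a + 0# * b) ≈
    form c₄ c₃ c₂ c₁ c₀ a b
  form-swap = solve 7 (λ c₀ c₁ c₂ c₃ c₄ a b →
    :form c₀ c₁ c₂ c₃ c₄ ((con (ℤ.+ 0)) :* a :+ (con (ℤ.+ 1)) :* b) ((con (ℤ.+ 1)) :* a :+ (con (ℤ.+ 0)) :* b) :=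
    :form c₄ c₃ c₂ c₁ c₀ a b) refl

  -- The substitution t ↦ t/(1 + e t) fixes 0. For c₀ ≠ 0 a suitable e kills the new linear
  -- coefficient 4 e c₀ + c₁.
  form-shear : ∀ c₀ c₁ c₂ c₃ c₄ e a b →
    form c₀ c₁ c₂ c₃ c₄ ((1 · 1#) * a + 0# * b) (e * a + (1 · 1#) * b) ≈
    form c₀ (4 · (e * c₀) + c₁) (6 · (e * e * c₀) + 3 · (e * c₁) + c₂)
      (4 · (e * e * e * c₀) + 3 · (e * e * c₁) + 2 · (e * c₂) + c₃)
      (e * e * e * e * c₀ + e * e * e * c₁ + e * e * c₂ + e * c₃ + c₄) a b
  form-shear = solve 8 (λ c₀ c₁ c₂ c₃ c₄ e a b →
    :form c₀ c₁ c₂ c₃ c₄ ((con (ℤ.+ 1)) :* a :+ (con (ℤ.+ 0)) :* b) (e :* a :+ (con (ℤ.+ 1)) :* b) :=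
    :form c₀ (4 :× (e :* c₀) :+ c₁) (6 :× (e :* e :* c₀) :+ 3 :× (e :* c₁) :+ c₂)
      (4 :× (e :* e :* e :* c₀) :+ 3 :× (e :* e :* c₁) :+ 2 :× (e :* c₂) :+ c₃)
      (e :* e :* e :* e :* c₀ :+ e :* e :* e :* c₁ :+ e :* e :* c₂ :+ e :* c₃ :+ c₄) a b) refl

  -- Put w = w₀ + t/r and compare V² = w⁴ - 4 h(t) up to t²: this gives V = V₀ + (2 w₀ p/r) t +
  -- (S/r²) t², where p = w₀²/V₀, γ = 2 h₂/V₀, β = 3 p - 2 p³ and S = β - γ r². The t³ and t⁴ terms
  -- leave D t = - r C. Multiplying by D⁴ clears denominators.
  quartic-identity : ∀ w₀ V₀ p β γ h₀ h₂ h₃ h₄ r S C D →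
    V₀ * V₀ + 4 · h₀ ≈ w₀ * w₀ * (w₀ * w₀) →
    p * V₀ ≈ w₀ * w₀ →
    V₀ * γ ≈ 2 · h₂ →
    β ≈ (3 · p - 2 · (p * p * p)) →
    S ≈ β - γ * (r * r) →
    C ≈ 4 · w₀ - 4 · (w₀ * p * S) - 4 · (h₃ * (r * r * r)) →
    D ≈ (1 · 1#) - S * S - 4 · (h₄ * (r * r * r * r)) →
    ((V₀ * D - 2 · (w₀ * p) * C) * D + S * (C * C)) * ((V₀ * D - 2 · (w₀ * p) * C) * D + S * (C * C)) + 4 ·
      (form h₀ 0# h₂ h₃ h₄ (- (r * C)) D) ≈
    (w₀ * D - C) * (w₀ * D - C) * ((w₀ * D - C) * (w₀ * D - C))
  quartic-identity w₀ V₀ p β γ h₀ h₂ h₃ h₄ r S C D e1 e2 e3 e4 e5 e6 e7 = ≈-from-difference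
    (trans (solve 13 (λ w₀ V₀ p β γ h₀ h₂ h₃ h₄ r S C D →
    ((V₀ :* D :- 2 :× (w₀ :* p) :* C) :* D :+ S :* (C :* C)) :*
      ((V₀ :* D :- 2 :× (w₀ :* p) :* C) :* D :+ S :* (C :* C)) :+ 4 :×
      (:form h₀ (con (ℤ.+ 0)) h₂ h₃ h₄ (:- (r :* C)) D) :- ((w₀ :* D :- C) :* (w₀ :* D :- C) :*
      ((w₀ :* D :- C) :* (w₀ :* D :- C))) :=
    (D :* D :* D :* D) :* (V₀ :* V₀ :+ 4 :× h₀ :- (w₀ :* w₀ :* (w₀ :* w₀)))
    :+ (((6 :× (con (ℤ.+ 1)) :- 4 :× (p :* p)) :* (C :* C :* D :* D) :- 4 :× w₀ :* (C :* D :* D :* D)) :*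
      (p :* V₀ :- (w₀ :* w₀))
    :+ ((:- (2 :× (r :* r :* (C :* C :* D :* D)))) :* (V₀ :* γ :- (2 :× h₂))
    :+ ((2 :× V₀ :* (C :* C :* D :* D)) :* (β :- ((3 :× p :- 2 :× (p :* p :* p))))
    :+ ((2 :× V₀ :* (C :* C :* D :* D)) :* (S :- (β :- γ :* (r :* r)))
    :+ ((:- (C :* C :* C :* D)) :* (C :- (4 :× w₀ :- 4 :× (w₀ :* p :* S) :- 4 :× (h₃ :* (r :* r :* r))))
    :+ ((C :* C :* C :* C) :* (D :- ((con (ℤ.+ 1)) :- S :* S :- 4 :× (h₄ :* (r :* r :* r :* r)))))))))))
    refl w₀ V₀ p β γ h₀ h₂ h₃ h₄ r S C D)
    (+≈0 (*≈0 _ (difference≈0 e1)) (+≈0 (*≈0 _ (difference≈0 e2))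
      (+≈0 (*≈0 _ (difference≈0 e3)) (+≈0 (*≈0 _ (difference≈0 e4))
      (+≈0 (*≈0 _ (difference≈0 e5)) (+≈0 (*≈0 _ (difference≈0 e6)) (*≈0 _ (difference≈0 e7)))))))))

  -- For s = ½ this is the passage from V² = W⁴ - 4 F back to x W² = x² + F by 2 x = W² + V.
  half-identity : ∀ s W V F →
    2 · s ≈ (1 · 1#) →
    V * V + 4 · F ≈ W * W * (W * W) →
    (s * (W * W + V)) * (W * W) ≈
    (s * (W * W + V)) * (s * (W * W + V)) + F
  half-identity s W V F e1 e2 = ≈-from-difference (trans (solve 4 (λ s W V F →
    (s :* (W :* W :+ V)) :* (W :* W) :- ((s :* (W :* W :+ V)) :* (s :* (W :* W :+ V)) :+ F) :=
    ((2 :× s :+ (con (ℤ.+ 1))) :* F :- s :* ((W :* W :+ V) :* (W :* W))) :* (2 :× s :- ((con (ℤ.+ 1))))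
    :+ ((:- (s :* s)) :* (V :* V :+ 4 :× F :- (W :* W :* (W :* W)))))
    refl s W V F)
    (+≈0 (*≈0 _ (difference≈0 e1)) (*≈0 _ (difference≈0 e2))))

  half-proportional : ∀ s W V k →
    2 · s ≈ (1 · 1#) →
    s * (W * W + V) ≈ k * (W * W) →
    V ≈
    (2 · k - (1 · 1#)) * (W * W)
  half-proportional s W V k e1 e2 = ≈-from-difference (trans (solve 4 (λ s W V k →
    V :- ((2 :× k :- (con (ℤ.+ 1))) :* (W :* W)) :=
    (:- (W :* W :+ V)) :* (2 :× s :- ((con (ℤ.+ 1))))
    :+ ((2 :× (con (ℤ.+ 1))) :* (s :* (W :* W :+ V) :- (k :* (W :* W)))))
    refl s W V k)
    (+≈0 (*≈0 _ (difference≈0 e1)) (*≈0 _ (difference≈0 e2))))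

  -- With A = V₀ - k w₀² and B = 2 w₀ (k - p), the difference V - k W² is A D² + B C D + (S - k) C².
  -- Inserting D = q C + r² R separates a multiple of r² from a constant multiple of C².
  proportional-identity : ∀ w₀ V₀ p β γ k q r S C D R →
    ((V₀ * D - 2 · (w₀ * p) * C) * D + S * (C * C)) ≈ k * ((w₀ * D - C) * (w₀ * D - C)) →
    S ≈ β - γ * (r * r) →
    D ≈ q * C + r * r * R →
    r * r * ((V₀ - k * (w₀ * w₀)) * (r * r * (R * R)) + (2 · ((V₀ - k * (w₀ * w₀)) * q) + (2 · (w₀ * (k - p))))
      * (C * R) - γ * (C * C)) + C * C * ((V₀ - k * (w₀ * w₀)) * (q * q) + (2 · (w₀ * (k - p))) * q + (β - k)) ≈
    0#
  proportional-identity w₀ V₀ p β γ k q r S C D R e1 e2 e3 = ≈-from-difference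
    (trans (solve 12 (λ w₀ V₀ p β γ k q r S C D R →
    r :* r :* ((V₀ :- k :* (w₀ :* w₀)) :* (r :* r :* (R :* R)) :+
      (2 :× ((V₀ :- k :* (w₀ :* w₀)) :* q) :+ (2 :× (w₀ :* (k :- p)))) :* (C :* R) :- γ :* (C :* C)) :+ C :* C
      :* ((V₀ :- k :* (w₀ :* w₀)) :* (q :* q) :+ (2 :× (w₀ :* (k :- p))) :* q :+ (β :- k)) :- ((con (ℤ.+ 0))) :=
    ((con (ℤ.+ 1))) :* (((V₀ :* D :- 2 :× (w₀ :* p) :* C) :* D :+ S :* (C :* C)) :-
      (k :* ((w₀ :* D :- C) :* (w₀ :* D :- C))))
    :+ ((:- (C :* C)) :* (S :- (β :- γ :* (r :* r)))
    :+ ((:- ((V₀ :- k :* (w₀ :* w₀)) :* (D :+ (q :* C :+ r :* r :* R)) :+ (2 :× (w₀ :* (k :- p))) :* C)) :*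
      (D :- (q :* C :+ r :* r :* R)))))
    refl w₀ V₀ p β γ k q r S C D R)
    (+≈0 (*≈0 _ (difference≈0 e1)) (+≈0 (*≈0 _ (difference≈0 e2)) (*≈0 _ (difference≈0 e3)))))

  -- The first hypothesis gives k = 1/p. Multiplying the second by p and by the constant term of C,
  -- and eliminating q, leaves only p and w₀, up to sign in the factored form stated.
  excluded-constant : ∀ w₀ V₀ p k q →
    V₀ - k * (w₀ * w₀) ≈ 0# →
    (V₀ - k * (w₀ * w₀)) * (q * q) + (2 · (w₀ * (k - p))) * q + ((3 · p - 2 · (p * p * p)) - k) ≈ 0# →
    q * (4 · (w₀ * ((1 · 1#) - p * (3 · p - 2 · (p * p * p))))) ≈
      ((1 · 1#) - (3 · p - 2 · (p * p * p)) * (3 · p - 2 · (p * p * p))) →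
    k * p ≈ (1 · 1#) →
    2 · (w₀ * (((1 · 1#) - p * p) * ((1 · 1#) - p * p) * ((1 · 1#) + 4 · (p * p * p * p)))) ≈
    0#
  excluded-constant w₀ V₀ p k q e1 e2 e3 e4 = ≈-from-difference (trans (solve 5 (λ w₀ V₀ p k q →
    2 :× (w₀ :* (((con (ℤ.+ 1)) :- p :* p) :* ((con (ℤ.+ 1)) :- p :* p) :*
      ((con (ℤ.+ 1)) :+ 4 :× (p :* p :* p :* p)))) :- ((con (ℤ.+ 0))) :=
    (p :* (4 :× (w₀ :* ((con (ℤ.+ 1)) :- p :* (3 :× p :- 2 :× (p :* p :* p))))) :* (q :* q)) :*
      (V₀ :- k :* (w₀ :* w₀) :- ((con (ℤ.+ 0))))
    :+ ((:- (p :* (4 :× (w₀ :* ((con (ℤ.+ 1)) :- p :* (3 :× p :- 2 :× (p :* p :* p))))))) :*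
      ((V₀ :- k :* (w₀ :* w₀)) :* (q :* q) :+ (2 :× (w₀ :* (k :- p))) :* q :+
      ((3 :× p :- 2 :× (p :* p :* p)) :- k) :- ((con (ℤ.+ 0))))
    :+ ((p :* (2 :× (w₀ :* (k :- p)))) :* (q :* (4 :× (w₀ :* ((con (ℤ.+ 1)) :- p :*
      (3 :× p :- 2 :× (p :* p :* p))))) :- (((con (ℤ.+ 1)) :- (3 :× p :- 2 :× (p :* p :* p)) :*
      (3 :× p :- 2 :× (p :* p :* p)))))
    :+ ((2 :× (w₀ :* ((con (ℤ.+ 1)) :- (3 :× p :- 2 :× (p :* p :* p)) :* (3 :× p :- 2 :× (p :* p :* p)))) :-
      (4 :× (w₀ :* ((con (ℤ.+ 1)) :- p :* (3 :× p :- 2 :× (p :* p :* p)))))) :* (k :* p :- ((con (ℤ.+ 1))))))))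
    refl w₀ V₀ p k q)
    (+≈0 (*≈0 _ (difference≈0 e1)) (+≈0 (*≈0 _ (difference≈0 e2))
      (+≈0 (*≈0 _ (difference≈0 e3)) (*≈0 _ (difference≈0 e4))))))

  -- This and the next two lemmas factor the constant terms of C, D and W. Besides w₀ and 1 - p²,
  -- the factors left can vanish at a rational p only if 2 or 3 is a rational square: (2p)² = 2,
  -- (2p² - 2)² = 3 and (2p²)² = 3 respectively.
  c₃-factors : ∀ w₀ p →
    4 · (w₀ * ((1 · 1#) - p * (3 · p - 2 · (p * p * p)))) ≈
    4 · (w₀ * (((1 · 1#) - p * p) * ((1 · 1#) - 2 · (p * p))))
  c₃-factors = solve 2 (λ w₀ p →
    4 :× (w₀ :* ((con (ℤ.+ 1)) :- p :* (3 :× p :- 2 :× (p :* p :* p)))) :=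
    4 :× (w₀ :* (((con (ℤ.+ 1)) :- p :* p) :* ((con (ℤ.+ 1)) :- 2 :× (p :* p))))) refl

  d₄-factors : ∀ p →
    (1 · 1#) - (3 · p - 2 · (p * p * p)) * (3 · p - 2 · (p * p * p)) ≈
    ((1 · 1#) - p * p) * ((2 · (p * p) - (2 · 1#)) * (2 · (p * p) - (2 · 1#)) - (3 · 1#))
  d₄-factors = solve 1 (λ p →
    (con (ℤ.+ 1)) :- (3 :× p :- 2 :× (p :* p :* p)) :* (3 :× p :- 2 :× (p :* p :* p)) :=
    ((con (ℤ.+ 1)) :- p :* p) :* ((2 :× (p :* p) :- (con (ℤ.+ 2))) :* (2 :× (p :* p) :- (con (ℤ.+ 2))) :-
      (con (ℤ.+ 3)))) refl

  W0-factors : ∀ w₀ p →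
    w₀ * ((1 · 1#) - (3 · p - 2 · (p * p * p)) * (3 · p - 2 · (p * p * p))) - 4 ·
      (w₀ * ((1 · 1#) - p * (3 · p - 2 · (p * p * p)))) ≈
    w₀ * (((1 · 1#) - p * p) * (2 · (p * p) * (2 · (p * p)) - (3 · 1#)))
  W0-factors = solve 2 (λ w₀ p →
    w₀ :* ((con (ℤ.+ 1)) :- (3 :× p :- 2 :× (p :* p :* p)) :* (3 :× p :- 2 :× (p :* p :* p))) :- 4 :×
      (w₀ :* ((con (ℤ.+ 1)) :- p :* (3 :× p :- 2 :× (p :* p :* p)))) :=
    w₀ :* (((con (ℤ.+ 1)) :- p :* p) :* (2 :× (p :* p) :* (2 :× (p :* p)) :- (con (ℤ.+ 3))))) refl

  ev-remainder : ∀ A e γ c₃ c₁ f r₀ r₁ r₂ r →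
    (e * (c₃ * r₂) - γ * (c₃ * c₃)) + r * ((e * (c₃ * r₁)) + r *
      ((A * (r₂ * r₂) + e * (c₃ * r₀ + c₁ * r₂) - 2 · (γ * (c₃ * c₁))) + r *
      ((2 · (A * (r₁ * r₂)) + e * (c₁ * r₁ - f * r₂) + 2 · (γ * (c₃ * f))) + r *
      ((A * (r₁ * r₁ + 2 · (r₂ * r₀)) + e * (c₁ * r₀ - f * r₁) - γ * (c₁ * c₁)) + r *
      ((2 · (A * (r₁ * r₀)) - e * (f * r₀) + 2 · (γ * (c₁ * f))) + r *
      ((A * (r₀ * r₀) - γ * (f * f)) + r * (0#))))))) ≈
    A * (r * r * ((r₂ + r * (r₁ + r * (r₀ + r * 0#))) * (r₂ + r * (r₁ + r * (r₀ + r * 0#))))) + e *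
      ((c₃ + r * (0# + r * (c₁ + r * (- f + r * 0#)))) * (r₂ + r * (r₁ + r * (r₀ + r * 0#)))) - γ *
      ((c₃ + r * (0# + r * (c₁ + r * (- f + r * 0#)))) * (c₃ + r * (0# + r * (c₁ + r * (- f + r * 0#)))))
  ev-remainder = solve 10 (λ A e γ c₃ c₁ f r₀ r₁ r₂ r →
    (e :* (c₃ :* r₂) :- γ :* (c₃ :* c₃)) :+ r :* ((e :* (c₃ :* r₁)) :+ r :*
      ((A :* (r₂ :* r₂) :+ e :* (c₃ :* r₀ :+ c₁ :* r₂) :- 2 :× (γ :* (c₃ :* c₁))) :+ r :*
      ((2 :× (A :* (r₁ :* r₂)) :+ e :* (c₁ :* r₁ :- f :* r₂) :+ 2 :× (γ :* (c₃ :* f))) :+ r :*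
      ((A :* (r₁ :* r₁ :+ 2 :× (r₂ :* r₀)) :+ e :* (c₁ :* r₀ :- f :* r₁) :- γ :* (c₁ :* c₁)) :+ r :*
      ((2 :× (A :* (r₁ :* r₀)) :- e :* (f :* r₀) :+ 2 :× (γ :* (c₁ :* f))) :+ r :*
      ((A :* (r₀ :* r₀) :- γ :* (f :* f)) :+ r :* ((con (ℤ.+ 0))))))))) :=
    A :* (r :* r :* ((r₂ :+ r :* (r₁ :+ r :* (r₀ :+ r :* (con (ℤ.+ 0))))) :*
      (r₂ :+ r :* (r₁ :+ r :* (r₀ :+ r :* (con (ℤ.+ 0))))))) :+ e :*
      ((c₃ :+ r :* ((con (ℤ.+ 0)) :+ r :* (c₁ :+ r :* (:- f :+ r :* (con (ℤ.+ 0)))))) :*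
      (r₂ :+ r :* (r₁ :+ r :* (r₀ :+ r :* (con (ℤ.+ 0)))))) :- γ :*
      ((c₃ :+ r :* ((con (ℤ.+ 0)) :+ r :* (c₁ :+ r :* (:- f :+ r :* (con (ℤ.+ 0)))))) :*
      (c₃ :+ r :* ((con (ℤ.+ 0)) :+ r :* (c₁ :+ r :* (:- f :+ r :* (con (ℤ.+ 0)))))))) refl

  ev-C : ∀ w₀ p β γ h₃ r →
    4 · (w₀ * ((1 · 1#) - p * β)) + r * (0# + r * (4 · (w₀ * p * γ) + r * (- (4 · h₃) + r * 0#))) ≈
    4 · w₀ - 4 · (w₀ * p * (β - γ * (r * r))) - 4 · (h₃ * (r * r * r))
  ev-C = solve 6 (λ w₀ p β γ h₃ r →
    4 :× (w₀ :* ((con (ℤ.+ 1)) :- p :* β)) :+ r :* ((con (ℤ.+ 0)) :+ r :*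
      (4 :× (w₀ :* p :* γ) :+ r :* (:- (4 :× h₃) :+ r :* (con (ℤ.+ 0))))) :=
    4 :× w₀ :- 4 :× (w₀ :* p :* (β :- γ :* (r :* r))) :- 4 :× (h₃ :* (r :* r :* r))) refl

  ev-D4 : ∀ β γ h₄ r →
    ((1 · 1#) - β * β) + r * (0# + r * (2 · (β * γ) + r * (0# + r * (- (4 · h₄ + γ * γ) + r * 0#)))) ≈
    (1 · 1#) - (β - γ * (r * r)) * (β - γ * (r * r)) - 4 · (h₄ * (r * r * r * r))
  ev-D4 = solve 4 (λ β γ h₄ r →
    ((con (ℤ.+ 1)) :- β :* β) :+ r :* ((con (ℤ.+ 0)) :+ r :* (2 :× (β :* γ) :+ r :*
      ((con (ℤ.+ 0)) :+ r :* (:- (4 :× h₄ :+ γ :* γ) :+ r :* (con (ℤ.+ 0)))))) :=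
    (con (ℤ.+ 1)) :- (β :- γ :* (r :* r)) :* (β :- γ :* (r :* r)) :- 4 :× (h₄ :* (r :* r :* r :* r))) refl

  -- Neither C nor D has a linear term, so once q matches their constant terms the remainder is
  -- divisible by r².
  ev-division : ∀ w₀ p β γ h₃ h₄ d₄ c₃ q r →
    q * c₃ ≈ d₄ →
    d₄ + r * (0# + r * (2 · (β * γ) + r * (0# + r * (- (4 · h₄ + γ * γ) + r * 0#)))) ≈
    q * (c₃ + r * (0# + r * (4 · (w₀ * p * γ) + r * (- (4 · h₃) + r * 0#)))) + r * r *
      ((2 · (β * γ) - q * (4 · (w₀ * p * γ))) + r * (q * (4 · h₃) + r * (- (4 · h₄ + γ * γ) + r * 0#)))
  ev-division w₀ p β γ h₃ h₄ d₄ c₃ q r e1 = ≈-from-difference (trans (solve 10 (λ w₀ p β γ h₃ h₄ d₄ c₃ q r →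
    d₄ :+ r :* ((con (ℤ.+ 0)) :+ r :* (2 :× (β :* γ) :+ r :* ((con (ℤ.+ 0)) :+ r :*
      (:- (4 :× h₄ :+ γ :* γ) :+ r :* (con (ℤ.+ 0)))))) :- (q :*
      (c₃ :+ r :* ((con (ℤ.+ 0)) :+ r :* (4 :× (w₀ :* p :* γ) :+ r :* (:- (4 :× h₃) :+ r :* (con (ℤ.+ 0)))))) :+ r
      :* r :* ((2 :× (β :* γ) :- q :* (4 :× (w₀ :* p :* γ))) :+ r :*
      (q :* (4 :× h₃) :+ r :* (:- (4 :× h₄ :+ γ :* γ) :+ r :* (con (ℤ.+ 0)))))) :=
    (:- (con (ℤ.+ 1))) :* (q :* c₃ :- (d₄)))
    refl w₀ p β γ h₃ h₄ d₄ c₃ q r)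
    (*≈0 _ (difference≈0 e1)))

  -- If p² = 1 then V₀² = w₀⁴, so the point equation leaves nothing for h₀.
  unit-square : ∀ w₀ V₀ p h₀ →
    V₀ * V₀ + 4 · h₀ ≈ w₀ * w₀ * (w₀ * w₀) →
    p * V₀ ≈ w₀ * w₀ →
    (1 · 1#) - p * p ≈ 0# →
    4 · h₀ ≈
    0#
  unit-square w₀ V₀ p h₀ e1 e2 e3 = ≈-from-difference (trans (solve 4 (λ w₀ V₀ p h₀ →
    4 :× h₀ :- ((con (ℤ.+ 0))) :=
    ((con (ℤ.+ 1))) :* (V₀ :* V₀ :+ 4 :× h₀ :- (w₀ :* w₀ :* (w₀ :* w₀)))
    :+ ((:- (p :* V₀ :+ w₀ :* w₀)) :* (p :* V₀ :- (w₀ :* w₀))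
    :+ ((:- (V₀ :* V₀)) :* ((con (ℤ.+ 1)) :- p :* p :- ((con (ℤ.+ 0)))))))
    refl w₀ V₀ p h₀)
    (+≈0 (*≈0 _ (difference≈0 e1)) (+≈0 (*≈0 _ (difference≈0 e2)) (*≈0 _ (difference≈0 e3)))))

  inverse-of-p : ∀ w₀ V₀ p k →
    V₀ - k * (w₀ * w₀) ≈ 0# →
    p * V₀ ≈ w₀ * w₀ →
    V₀ * (k * p - (1 · 1#)) ≈
    0#
  inverse-of-p w₀ V₀ p k e1 e2 = ≈-from-difference (trans (solve 4 (λ w₀ V₀ p k →
    V₀ :* (k :* p :- (con (ℤ.+ 1))) :- ((con (ℤ.+ 0))) :=
    (:- (con (ℤ.+ 1))) :* (V₀ :- k :* (w₀ :* w₀) :- ((con (ℤ.+ 0))))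
    :+ ((k) :* (p :* V₀ :- (w₀ :* w₀))))
    refl w₀ V₀ p k)
    (+≈0 (*≈0 _ (difference≈0 e1)) (*≈0 _ (difference≈0 e2))))

  ev-form : ∀ c₀ c₁ c₂ c₃ c₄ r →
    c₀ + r * (c₁ + r * (c₂ + r * (c₃ + r * (c₄ + r * 0#)))) ≈
    form c₀ c₁ c₂ c₃ c₄ r (1 · 1#)
  ev-form = solve 6 (λ c₀ c₁ c₂ c₃ c₄ r →
    c₀ :+ r :* (c₁ :+ r :* (c₂ :+ r :* (c₃ :+ r :* (c₄ :+ r :* (con (ℤ.+ 0)))))) :=
    :form c₀ c₁ c₂ c₃ c₄ r (con (ℤ.+ 1))) refl

  form-a4 : ∀ c a b →
    form 0# 0# 0# 0# c a b ≈
    c * (a * a * (a * a))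
  form-a4 = solve 3 (λ c a b →
    :form (con (ℤ.+ 0)) (con (ℤ.+ 0)) (con (ℤ.+ 0)) (con (ℤ.+ 0)) c a b :=
    c :* (a :* a :* (a :* a))) refl

  form-b4 : ∀ c a b →
    form c 0# 0# 0# 0# a b ≈
    c * (b * b * (b * b))
  form-b4 = solve 3 (λ c a b →
    :form c (con (ℤ.+ 0)) (con (ℤ.+ 0)) (con (ℤ.+ 0)) (con (ℤ.+ 0)) a b :=
    c :* (b :* b :* (b :* b))) refl

  -- Completing the square in x: the equation x² - w² x + c = 0 has discriminant w⁴ - 4 c.
  point-identity : ∀ x w c →
    x * (w * w) ≈ x * x + c →
    (2 · x - w * w) * (2 · x - w * w) + 4 · c ≈
    w * w * (w * w)
  point-identity x w c e1 = ≈-from-difference (trans (solve 3 (λ x w c →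
    (2 :× x :- w :* w) :* (2 :× x :- w :* w) :+ 4 :× c :- (w :* w :* (w :* w)) :=
    (:- (4 :× (con (ℤ.+ 1)))) :* (x :* (w :* w) :- (x :* x :+ c)))
    refl x w c)
    (*≈0 _ (difference≈0 e1)))

-- From certificates to non-torsion sections

open BinaryQuartic ℚₚ.+-*-commutativeRing using (form)

-- With t = a/b, x = X/b² and w = W/b the identity says x w² = x² + f(t), so
-- that (x , x w) is a section.
record Certificate (c₀ c₁ c₂ c₃ c₄ : ℚ) : Set where
  field
    a b X W         : Poly
    independent     : ∀ c d → (∀ r → c ℚ.* evalℚ a r ℚ.+ d ℚ.* evalℚ b r ≡ 0ℚ) → c ≡ 0ℚ × d ≡ 0ℚ
    identity        : ∀ r → evalℚ X r ℚ.* (evalℚ W r ℚ.* evalℚ W r) ≡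
                            evalℚ X r ℚ.* evalℚ X r ℚ.+ form c₀ c₁ c₂ c₃ c₄ (evalℚ a r) (evalℚ b r)
    W₀≢0            : evalℚ W 0ℚ ≢ 0ℚ
    notProportional : ∀ k → ¬ (∀ r → evalℚ X r ≡ k ℚ.* (evalℚ W r ℚ.* evalℚ W r))

nonTorsionSection : ∀ {g x w} → x *ᶠ (w *ᶠ w) ≃ x *ᶠ x +ᶠ g → ¬ w *ᶠ ∂ x ≃ x *ᶠ ∂ w +ᶠ x *ᶠ ∂ w →
  HasNonTorsionSection (ℰ g)
nonTorsionSection {g} {x} {w} factored wronskian =
  (aff x S.y , coeffs (cross (K.trans S.curve (K.sym (K.+-identityʳ (x *ᶠ x *ᶠ x +ᶠ g *ᶠ x)))))) , nonTorsion
  where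
  module S = FlowOfSection.At RatFun-differentialField {x} {w} {g} factored wronskian
  module M = Multiples g S.θ S.g≉0 S.∂g
  nonTorsion : ∀ n → n ≢ 0 → multiple (ℰ g) n (aff x S.y) ≢ O
  nonTorsion zero    0≢0 _ = 0≢0 ≡.refl
  nonTorsion (suc n) _   e = aff≢O (≡.trans (≡.sym (proj₁ (proj₂ (proj₂ (M.multiple-moves S.section-moves S.m≉0 n))))) e)
    where
    aff≢O : ∀ {x y} → aff x y ≢ O
    aff≢O ()

coeffs-≤4 : ∀ f → deg≤ 4 f → f ≈ₚ coeff f 0 ∷ coeff f 1 ∷ coeff f 2 ∷ coeff f 3 ∷ coeff f 4 ∷ []
coeffs-≤4 f f≤4 0 = ≡.refl
coeffs-≤4 f f≤4 1 = ≡.refl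
coeffs-≤4 f f≤4 2 = ≡.refl
coeffs-≤4 f f≤4 3 = ≡.refl
coeffs-≤4 f f≤4 4 = ≡.refl
coeffs-≤4 f f≤4 (suc (suc (suc (suc (suc i))))) = f≤4 _ (s≤s (s≤s (s≤s (s≤s (s≤s z≤n)))))

-- Linear independence of a and b gives both b ≠ 0 and a/b non-constant. If the Wronskian vanished,
-- X would be a constant multiple of W², by the criterion based at 0 where W does not vanish;
-- `notProportional` excludes this.
certificate⇒section : ∀ f → deg≤ 4 f → Certificate (coeff f 0) (coeff f 1) (coeff f 2) (coeff f 3) (coeff f 4) →
  ∃ λ φ → NonConstant φ × HasNonTorsionSection (ℰ (f ∘ᶠ φ))
certificate⇒section f f≤4 C = φ , nonConstant , nonTorsionSection {f ∘ᶠ φ} {x} {w} factored wronskian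
  where
  open Certificate C
  b≉0 : ¬ b ≈ₚ 0ₚ
  b≉0 h = ℚₚ.1≢0 (proj₂ (independent 0ℚ 1ℚ λ r →
    ≡.cong₂ ℚ._+_ (ℚₚ.*-zeroˡ (evalℚ a r)) (≡.cong (1ℚ ℚ.*_) (ev-zero b r h))))
  b²≉0 : ¬ b *ₚ b ≈ₚ 0ₚ
  b²≉0 = *ₚ-nonZero b b b≉0 b≉0
  φ x w : RatFun
  φ = a / b [ b≉0 ]
  x = X / (b *ₚ b) [ b²≉0 ]
  w = W / b [ b≉0 ]
  nonConstant : NonConstant φ
  nonConstant (c , h) = ℚₚ.1≢0 (proj₁ (independent 1ℚ (ℚ.- c) λ r → begin
    1ℚ * evalℚ a r + - c * evalℚ b r
      ≡⟨ ≡.cong₂ _+_ (ℚₚ.*-comm 1ℚ (evalℚ a r)) (≡.sym (ℚₚ.neg-distribˡ-* c (evalℚ b r))) ⟩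
    evalℚ a r * 1ℚ - c * evalℚ b r
      ≡⟨ x≡y⇒x-y≡0 (≡.trans (≡.sym (ev-*≡ a 1ₚ ≡.refl (ev-1ₚ r))) (≡.trans (≈ₚ⇒ev≡ (a *ₚ 1ₚ) (const c *ₚ b) h r)
        (ev-*≡ (const c) b (ev-const c r) ≡.refl))) ⟩
    0ℚ ∎))
    where
    open ≡.≡-Reasoning
    open import Data.Rational.Base using (_+_; _*_; -_; _-_)
  wronskian : ¬ w *ᶠ ∂ x ≃ x *ᶠ ∂ w +ᶠ x *ᶠ ∂ w
  wronskian h = notProportional (proj₁ proportional) λ r →
    ≡.trans (proj₂ proportional r) (≡.cong (proj₁ proportional ℚ.*_) (ev-* W W r))
    where
    proportional : ∃ λ k → ∀ r → evalℚ X r ≡ k ℚ.* evalℚ (W *ₚ W) r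
    proportional = wronskian≈0⇒proportional X (W *ₚ W)
      (λ e → W₀≢0 (square≡0 (≡.trans (≡.sym (ev-* W W 0ℚ)) e))) (wronskian-homogeneous X W b b≉0 b²≉0 h)
  ρ : Fin 9 → Poly
  ρ = lookup (const (coeff f 0) ∷ const (coeff f 1) ∷ const (coeff f 2) ∷ const (coeff f 3) ∷ const
    (coeff f 4) ∷ a ∷ b ∷ X ∷ W ∷ [])
  σ : ℚ → Fin 9 → ℚ
  σ r = lookup
    (coeff f 0 ∷ coeff f 1 ∷ coeff f 2 ∷ coeff f 3 ∷ coeff f 4 ∷ evalℚ a r ∷ evalℚ b r ∷ evalℚ X r ∷ evalℚ W r ∷ [])
  ev-ρ : ∀ r i → evalℚ (ρ i) r ≡ σ r i
  ev-ρ r 0F = ev-const (coeff f 0) r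
  ev-ρ r 1F = ev-const (coeff f 1) r
  ev-ρ r 2F = ev-const (coeff f 2) r
  ev-ρ r 3F = ev-const (coeff f 3) r
  ev-ρ r 4F = ev-const (coeff f 4) r
  ev-ρ r 5F = ≡.refl
  ev-ρ r 6F = ≡.refl
  ev-ρ r 7F = ≡.refl
  ev-ρ r 8F = ≡.refl
  homogeneous : ⟪ X ⟫ K.* (⟪ W ⟫ K.* ⟪ W ⟫) ≃ ⟪ X ⟫ K.* ⟪ X ⟫ K.+
    (⟪ b ⟫ K.* (⟪ b ⟫ K.* (⟪ b ⟫ K.* (⟪ b ⟫ K.* constᶠ (coeff f 0) K.+ ⟪ a ⟫ K.* constᶠ (coeff f 1))
      K.+ ⟪ a ⟫ K.* ⟪ a ⟫ K.* constᶠ (coeff f 2)) K.+ ⟪ a ⟫ K.* ⟪ a ⟫ K.* ⟪ a ⟫ K.* constᶠ (coeff f 3))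
      K.+ ⟪ a ⟫ K.* ⟪ a ⟫ K.* ⟪ a ⟫ K.* ⟪ a ⟫ K.* constᶠ (coeff f 4))
  homogeneous = transfer (xᵉ ⊗ (wᵉ ⊗ wᵉ))
    ((xᵉ ⊗ xᵉ) ⊕ ((bᵉ ⊗ ((bᵉ ⊗ ((bᵉ ⊗ ((bᵉ ⊗ var 0F) ⊕ (aᵉ ⊗ var 1F))) ⊕ ((aᵉ ⊗ aᵉ) ⊗ var 2F)))
      ⊕ (((aᵉ ⊗ aᵉ) ⊗ aᵉ) ⊗ var 3F))) ⊕ ((((aᵉ ⊗ aᵉ) ⊗ aᵉ) ⊗ aᵉ) ⊗ var 4F))) ρ σ ev-ρ identity
    where
    aᵉ bᵉ xᵉ wᵉ : Expr 9
    aᵉ = var 5F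
    bᵉ = var 6F
    xᵉ = var 7F
    wᵉ = var 8F
  factored : x *ᶠ (w *ᶠ w) ≃ x *ᶠ x +ᶠ f ∘ᶠ φ
  factored = K.trans
    (dehomogenise RatFun-differentialField
      {constᶠ (coeff f 0)} {constᶠ (coeff f 1)} {constᶠ (coeff f 2)} {constᶠ (coeff f 3)} {constᶠ (coeff f 4)}
      {φ} {x} {w} {⟪ b ⟫} {⟪ a ⟫} {⟪ X ⟫} {⟪ W ⟫}
      (λ e → b≉0 (coeffs (≃0⇒num≋0 e))) (fraction-* a b b≉0)
      (K.trans (K.*-congˡ {x} (K.sym (⟪⟫-* b b))) (fraction-* X (b *ₚ b) b²≉0)) (fraction-* W b b≉0) homogeneous)
    (K.+-congˡ {x *ᶠ x} (evalᶠ-cong (coeff f 0 ∷ coeff f 1 ∷ coeff f 2 ∷ coeff f 3 ∷ coeff f 4 ∷ []) f φ λ i → ≡.sym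
      (coeffs-≤4 f f≤4 i)))

-- Explicit certificates in degrees at most 3 and 4

module Certificates where
  open import Data.Rational.Base using (_+_; _*_; -_; _-_; _<_; _≤_; ∣_∣)
  open ≡
  open ≡-Reasoning
  open ℚ-Solver
  open Identities ℚₚ.+-*-commutativeRing
  open SemiringMult (CommutativeRing.semiring ℚₚ.+-*-commutativeRing) using (×-assoc-*; ×-congʳ; ×-comm-*)

  0<suc·1 : ∀ n → 0ℚ < suc n · 1ℚ
  0<suc·1 zero    = ℚₚ.positive⁻¹ 1ℚ
  0<suc·1 (suc n) = ℚₚ.+-mono-< (ℚₚ.positive⁻¹ 1ℚ) (0<suc·1 n)

  ·≡0 : ∀ n {c} → suc n · c ≡ 0ℚ → c ≡ 0ℚ
  ·≡0 n {c} e = noZeroDivisorsℚ {suc n · 1ℚ} {c}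
    (trans (×-assoc-* (suc n) 1ℚ c) (trans (×-congʳ (suc n) (ℚₚ.*-identityˡ c)) e))
    (λ e′ → ℚₚ.<-irrefl (sym e′) (0<suc·1 n))

  ·≢0 : ∀ n {c} → c ≢ 0ℚ → suc n · c ≢ 0ℚ
  ·≢0 n c≢0 e = c≢0 (·≡0 n e)

  neg≡0 : ∀ {c} → - c ≡ 0ℚ → c ≡ 0ℚ
  neg≡0 e = ℚₚ.neg-injective e

  *≡0ʳ : ∀ a {b} → b ≡ 0ℚ → a * b ≡ 0ℚ
  *≡0ʳ a b≡0 = trans (cong (a *_) b≡0) (ℚₚ.*-zeroʳ a)

  *≡0ˡ : ∀ {a} b → a ≡ 0ℚ → a * b ≡ 0ℚ
  *≡0ˡ b a≡0 = trans (cong (_* b) a≡0) (ℚₚ.*-zeroˡ b)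

  ev-at-0 : ∀ p → evalℚ p 0ℚ ≡ coeff p 0
  ev-at-0 []      = refl
  ev-at-0 (a ∷ p) = trans (cong (λ e → a + e) (ℚₚ.*-zeroˡ (evalℚ p 0ℚ))) (ℚₚ.+-identityʳ a)

  ev-0∷ : ∀ p r → evalℚ (0ℚ ∷ p) r ≡ r * evalℚ p r
  ev-0∷ p r = ℚₚ.+-identityˡ (r * evalℚ p r)

  vanishing-at-0 : ∀ p → (∀ r → r ≢ 0ℚ → evalℚ p r ≡ 0ℚ) → evalℚ p 0ℚ ≡ 0ℚ
  vanishing-at-0 p h = ev-zero p 0ℚ (ev≡⇒≈ₚ p 0ₚ h)

  -- At 0 the polynomial p has order 0 and r q has order 1, so no nontrivial combination of them can
  -- vanish.
  independent-shift : ∀ p q → evalℚ p 0ℚ ≢ 0ℚ → evalℚ q 0ℚ ≢ 0ℚ → ∀ c d →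
    (∀ r → c * evalℚ p r + d * (r * evalℚ q r) ≡ 0ℚ) → c ≡ 0ℚ × d ≡ 0ℚ
  independent-shift p q p₀≢0 q₀≢0 c d h = c≡0 , d≡0
    where
    c≡0 : c ≡ 0ℚ
    c≡0 = noZeroDivisorsℚ {evalℚ p 0ℚ} {c} (begin
      evalℚ p 0ℚ * c                              ≡⟨ ℚₚ.*-comm (evalℚ p 0ℚ) c ⟩
      c * evalℚ p 0ℚ                              ≡⟨ ℚₚ.+-identityʳ (c * evalℚ p 0ℚ) ⟨
      c * evalℚ p 0ℚ + 0ℚ                         ≡⟨ cong (λ u → c * evalℚ p 0ℚ + u) (*≡0ʳ d (ℚₚ.*-zeroˡ (evalℚ q 0ℚ))) ⟨
      c * evalℚ p 0ℚ + d * (0ℚ * evalℚ q 0ℚ)      ≡⟨ h 0ℚ ⟩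
      0ℚ                                          ∎) p₀≢0
    d*rq : ∀ r → d * (r * evalℚ q r) ≡ 0ℚ
    d*rq r = begin
      d * (r * evalℚ q r)                   ≡⟨ ℚₚ.+-identityˡ (d * (r * evalℚ q r)) ⟨
      0ℚ + d * (r * evalℚ q r)              ≡⟨ cong (λ u → u + d * (r * evalℚ q r)) (*≡0ˡ (evalℚ p r) c≡0) ⟨
      c * evalℚ p r + d * (r * evalℚ q r)   ≡⟨ h r ⟩
      0ℚ                                    ∎
    d≡0 : d ≡ 0ℚ
    d≡0 with d ℚₚ.≟ 0ℚ
    ... | yes e   = e
    ... | no  d≢0 = ⊥-elim (q₀≢0 (vanishing-at-0 q λ r r≢0 →
      noZeroDivisorsℚ {r} {evalℚ q r} (noZeroDivisorsℚ {d} (d*rq r) d≢0) r≢0))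

  -- Evaluation at 0 forces k = 0, and then X would be identically zero.
  vanishing-notProportional : ∀ X W → evalℚ X 0ℚ ≡ 0ℚ → evalℚ W 0ℚ ≢ 0ℚ → ¬ (∀ r → evalℚ X r ≡ 0ℚ) →
    ∀ k → ¬ (∀ r → evalℚ X r ≡ k * (evalℚ W r * evalℚ W r))
  vanishing-notProportional X W X₀≡0 W₀≢0 X≢0 k h = X≢0 λ r → trans (h r) (*≡0ˡ (evalℚ W r * evalℚ W r) k≡0)
    where
    k≡0 : k ≡ 0ℚ
    k≡0 = noZeroDivisorsℚ {evalℚ W 0ℚ * evalℚ W 0ℚ} {k}
      (trans (ℚₚ.*-comm (evalℚ W 0ℚ * evalℚ W 0ℚ) k) (trans (sym (h 0ℚ)) X₀≡0)) (*-≢0 W₀≢0 W₀≢0)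

  -- Here w = t + 1/z and x = c₃ t + κ/z.
  module _ (c₀ c₁ c₂ c₃ : ℚ) (c₃≢0 : c₃ ≢ 0ℚ) where
    private
      v : ℚ
      v = c₃ * c₃ + c₂
      κ N D Y X : Poly
      κ = - (2 · c₃) ∷ v ∷ []
      N = 2 · c₃ ∷ 4 · (c₃ * c₃) - v ∷ - (4 · (c₃ * v)) ∷ v * v + c₀ ∷ []
      D = - (3 · c₃) ∷ 2 · v + 4 · (c₃ * c₃) ∷ - (2 · (c₃ * v)) - c₁ ∷ []
      Y = scale c₃ N +ₚ κ *ₚ D
      X = (0ℚ ∷ D) *ₚ Y
      ev-X : ∀ r → evalℚ X r ≡ r * evalℚ D r * (c₃ * evalℚ N r + evalℚ κ r * evalℚ D r)
      ev-X r = ev-*≡ (0ℚ ∷ D) Y {r} (ev-0∷ D r)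
        (ev-+≡ (scale c₃ N) (κ *ₚ D) {r} (ev-scale c₃ N r) (ev-* κ D r))
      D₀≢0 : evalℚ D 0ℚ ≢ 0ℚ
      D₀≢0 e = ·≢0 2 c₃≢0 (neg≡0 (trans (sym (ev-at-0 D)) e))
      W₀ : evalℚ (N +ₚ D) 0ℚ ≡ - c₃
      W₀ = trans (ev-+≡ N D {0ℚ} (ev-at-0 N) (ev-at-0 D))
        (solve 1 (λ c → 2 :× c :+ :- (3 :× c) := :- c) refl c₃)
      Y₀ : evalℚ Y 0ℚ ≡ 8 · (c₃ * c₃)
      Y₀ = trans (ev-+≡ (scale c₃ N) (κ *ₚ D) {0ℚ}
          (trans (ev-scale c₃ N 0ℚ) (cong (c₃ *_) (ev-at-0 N)))
          (ev-*≡ κ D {0ℚ} (ev-at-0 κ) (ev-at-0 D)))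
        (solve 1 (λ c → c :* (2 :× c) :+ (:- (2 :× c)) :* (:- (3 :× c)) := 8 :× (c :* c)) refl c₃)
      -- X is r D times Y, with D(0) = -3 c₃ and Y(0) = 8 c₃² both nonzero.
      X≢0 : ¬ (∀ r → evalℚ X r ≡ 0ℚ)
      X≢0 h = ·≢0 7 (*-≢0 c₃≢0 c₃≢0) (trans (sym Y₀) (ev-zero Y 0ℚ Y≈0))
        where
        Y≈0 : Y ≈ₚ 0ₚ
        Y≈0 = coeffs (noZeroDivisorsₚ {0ℚ ∷ D} {Y} (coeffwise (ev≡⇒≈ₚ X 0ₚ λ r _ → h r))
          (λ e → D₀≢0 (trans (ev-at-0 D) (coeffs e 1))))

    certificate₃ : Certificate c₀ c₁ c₂ c₃ 0ℚ
    certificate₃ = record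
      { a = N ; b = 0ℚ ∷ D ; X = X ; W = N +ₚ D
      ; independent = λ c d h → independent-shift N D
          (λ e → ·≢0 1 c₃≢0 (trans (sym (ev-at-0 N)) e)) D₀≢0 c d
          (λ r → trans (cong (λ u → c * evalℚ N r + d * u) (sym (ev-0∷ D r))) (h r))
      ; identity = λ r → subst₂ (λ x w → x * (w * w) ≡ x * x + form c₀ c₁ c₂ c₃ 0ℚ (evalℚ N r) (evalℚ (0ℚ ∷ D) r))
          (sym (ev-X r)) (sym (ev-+ N D r))
          (subst (λ b → ev-X′ r * ((evalℚ N r + evalℚ D r) * (evalℚ N r + evalℚ D r)) ≡ ev-X′ r * ev-X′ r
            + form c₀ c₁ c₂ c₃ 0ℚ (evalℚ N r) b)
            (sym (ev-0∷ D r))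
            (cubic-identity c₀ c₁ c₂ c₃ r (evalℚ κ r) (evalℚ N r) (evalℚ D r)
              (ev-κ c₂ c₃ r)
              (trans (ev-D c₁ c₂ c₃ r) (cong (λ κ → c₃ + 2 · κ - 2 · (c₃ * r * κ) - c₁ * (r * r)) (sym (ev-κ c₂ c₃ r))))
              (trans (ev-N c₀ c₂ c₃ r) (cong (λ κ → r * (κ * κ) + c₀ * (r * r * r) - κ) (sym (ev-κ c₂ c₃ r))))))
      ; W₀≢0 = W₀≢0
      ; notProportional = vanishing-notProportional X (N +ₚ D)
          (trans (ev-X 0ℚ) (*≡0ˡ (c₃ * evalℚ N 0ℚ + evalℚ κ 0ℚ * evalℚ D 0ℚ) (ℚₚ.*-zeroˡ (evalℚ D 0ℚ)))) W₀≢0 X≢0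
      }
      where
      ev-X′ : ℚ → ℚ
      ev-X′ r = r * evalℚ D r * (c₃ * evalℚ N r + evalℚ κ r * evalℚ D r)
      W₀≢0 : evalℚ (N +ₚ D) 0ℚ ≢ 0ℚ
      W₀≢0 e = c₃≢0 (neg≡0 (trans (sym W₀) e))

  -- Here w = t + 1/z and x = c₂.
  module _ (c₀ c₁ c₂ : ℚ) (c₂≢0 : c₂ ≢ 0ℚ) where
    private
      N D X : Poly
      N = - c₂ ∷ 0ℚ ∷ c₂ * c₂ + c₀ ∷ []
      D = 2 · c₂ ∷ - c₁ ∷ []
      X = scale c₂ ((0ℚ ∷ D) *ₚ (0ℚ ∷ D))
      ev-X : ∀ r → evalℚ X r ≡ c₂ * (r * evalℚ D r * (r * evalℚ D r))
      ev-X r = trans (ev-scale c₂ ((0ℚ ∷ D) *ₚ (0ℚ ∷ D)) r)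
        (cong (c₂ *_) (ev-*≡ (0ℚ ∷ D) (0ℚ ∷ D) {r} (ev-0∷ D r) (ev-0∷ D r)))
      D₀≢0 : evalℚ D 0ℚ ≢ 0ℚ
      D₀≢0 e = ·≢0 1 c₂≢0 (trans (sym (ev-at-0 D)) e)
      W₀≢0 : evalℚ (N +ₚ D) 0ℚ ≢ 0ℚ
      W₀≢0 e = c₂≢0 (trans (trans (solve 1 (λ c → c := :- c :+ 2 :× c) refl c₂)
        (sym (ev-+≡ N D {0ℚ} (ev-at-0 N) (ev-at-0 D)))) e)
      X≢0 : ¬ (∀ r → evalℚ X r ≡ 0ℚ)
      X≢0 h = D₀≢0 (vanishing-at-0 D λ r r≢0 → noZeroDivisorsℚ {r} (square≡0 {r * evalℚ D r}
        (noZeroDivisorsℚ {c₂} (trans (sym (ev-X r)) (h r)) c₂≢0)) r≢0)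
      ev-D₂ : ∀ r → evalℚ D r ≡ 2 · c₂ - c₁ * r
      ev-D₂ r = solve 3 (λ c₁ c₂ r → 2 :× c₂ :+ r :* (:- c₁ :+ r :* con (ℤ.+ 0)) := 2 :× c₂ :- c₁ :* r) refl c₁ c₂ r
      ev-N₂ : ∀ r → evalℚ N r ≡ (c₂ * c₂ + c₀) * (r * r) - c₂
      ev-N₂ r = solve 3 (λ c₀ c₂ r → :- c₂ :+ r :* (con (ℤ.+ 0) :+ r :* ((c₂ :* c₂ :+ c₀) :+ r :* con (ℤ.+ 0)))
        := (c₂ :* c₂ :+ c₀) :* (r :* r) :- c₂) refl c₀ c₂ r

    certificate₂ : Certificate c₀ c₁ c₂ 0ℚ 0ℚ
    certificate₂ = record
      { a = N ; b = 0ℚ ∷ D ; X = X ; W = N +ₚ D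
      ; independent = λ c d h → independent-shift N D
          (λ e → c₂≢0 (neg≡0 (trans (sym (ev-at-0 N)) e))) D₀≢0 c d
          (λ r → trans (cong (λ u → c * evalℚ N r + d * u) (sym (ev-0∷ D r))) (h r))
      ; identity = λ r → subst₂ (λ x w → x * (w * w) ≡ x * x + form c₀ c₁ c₂ 0ℚ 0ℚ (evalℚ N r) (evalℚ (0ℚ ∷ D) r))
          (sym (ev-X r)) (sym (ev-+ N D r))
          (subst (λ b → X′ r * ((evalℚ N r + evalℚ D r) * (evalℚ N r + evalℚ D r)) ≡ X′ r * X′ r + form c₀ c₁ c₂ 0ℚ 0ℚ
            (evalℚ N r) b)
            (sym (ev-0∷ D r))
            (quadratic-identity c₀ c₁ c₂ r (evalℚ N r) (evalℚ D r) (ev-D₂ r) (ev-N₂ r)))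
      ; W₀≢0 = W₀≢0
      ; notProportional = vanishing-notProportional X (N +ₚ D)
          (trans (ev-X 0ℚ) (*≡0ʳ c₂ (*≡0ˡ (0ℚ * evalℚ D 0ℚ) (ℚₚ.*-zeroˡ (evalℚ D 0ℚ))))) W₀≢0 X≢0
      }
      where
      X′ : ℚ → ℚ
      X′ r = c₂ * (r * evalℚ D r * (r * evalℚ D r))

  -- Here w = 1 + z and x = 1.
  module _ (c₀ c₁ : ℚ) (c₁≢0 : c₁ ≢ 0ℚ) where
    private
      A W : Poly
      A = - c₀ ∷ 2 · 1ℚ ∷ 1ℚ ∷ []
      W = c₁ ∷ c₁ ∷ []
      ev-A : ∀ r → evalℚ A r ≡ (2 · r + r * r) - c₀
      ev-A r = solve 2 (λ c₀ r → :- c₀ :+ r :* (2 :× con (ℤ.+ 1) :+ r :* (con (ℤ.+ 1) :+ r :* con (ℤ.+ 0))) :=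
        (2 :× r :+ r :* r) :- c₀) refl c₀ r
      ev-W : ∀ r → evalℚ W r ≡ c₁ * (1ℚ + r)
      ev-W r = solve 2 (λ c₁ r → c₁ :+ r :* (c₁ :+ r :* con (ℤ.+ 0)) := c₁ :* (con (ℤ.+ 1) :+ r)) refl c₁ r

    certificate₁ : Certificate c₀ c₁ 0ℚ 0ℚ 0ℚ
    certificate₁ = record
      { a = A ; b = const c₁ ; X = const (c₁ * c₁) ; W = W
      ; independent = independent₁
      ; identity = λ r → subst₂ (λ x w → x * (w * w) ≡ x * x + form c₀ c₁ 0ℚ 0ℚ 0ℚ (evalℚ A r) (evalℚ (const c₁) r))
          (sym (ev-const (c₁ * c₁) r)) (sym (ev-W r))
          (subst₂ (λ a b → c₁ * c₁ * ((c₁ * (1ℚ + r)) * (c₁ * (1ℚ + r))) ≡ c₁ * c₁ * (c₁ * c₁) + form c₀ c₁ 0ℚ 0ℚ 0ℚ a b)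
            (sym (ev-A r)) (sym (ev-const c₁ r)) (linear-identity c₀ c₁ r))
      ; W₀≢0 = λ e → c₁≢0 (trans (sym (ev-at-0 W)) e)
      -- W = c₁ (1 + r) vanishes at r = -1, where the constant X does not.
      ; notProportional = λ k h → *-≢0 c₁≢0 c₁≢0 (begin
          c₁ * c₁                      ≡⟨ ev-const (c₁ * c₁) (- 1ℚ) ⟨
          evalℚ (const (c₁ * c₁)) (- 1ℚ)  ≡⟨ h (- 1ℚ) ⟩
          k * (evalℚ W (- 1ℚ) * evalℚ W (- 1ℚ))
            ≡⟨ *≡0ʳ k (*≡0ˡ (evalℚ W (- 1ℚ)) (trans (ev-W (- 1ℚ)) (ℚₚ.*-zeroʳ c₁))) ⟩
          0ℚ                           ∎)
      }
      where
      independent₁ : ∀ c d → (∀ r → c * evalℚ A r + d * evalℚ (const c₁) r ≡ 0ℚ) → c ≡ 0ℚ × d ≡ 0ℚ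
      independent₁ c d h = c≡0 , noZeroDivisorsℚ {c₁} {d} (trans (ℚₚ.*-comm c₁ d) (trans
        (trans (sym (ℚₚ.+-identityˡ (d * c₁))) (cong (_+ d * c₁) (sym (*≡0ˡ (evalℚ A 0ℚ) c≡0)))) (h′ 0ℚ))) c₁≢0
        where
        h′ : ∀ r → c * evalℚ A r + d * c₁ ≡ 0ℚ
        h′ r = trans (cong (λ u → c * evalℚ A r + d * u) (sym (ev-const c₁ r))) (h r)
        c≡0 : c ≡ 0ℚ
        -- The number 3 is A(1) - A(0); the constant polynomial drops out of the difference.
        c≡0 = ·≡0 2 (begin
          3 · c
            ≡⟨ solve 4 (λ c c₀ d c₁ → 3 :× c := (c :* ((2 :× con (ℤ.+ 1) :+ con (ℤ.+ 1) :* con (ℤ.+ 1)) :- c₀) :+ d :* c₁)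
                 :- (c :* ((2 :× con (ℤ.+ 0) :+ con (ℤ.+ 0) :* con (ℤ.+ 0)) :- c₀) :+ d :* c₁)) refl c c₀ d c₁ ⟩
          (c * ((2 · 1ℚ + 1ℚ * 1ℚ) - c₀) + d * c₁) - (c * ((2 · 0ℚ + 0ℚ * 0ℚ) - c₀) + d * c₁)
            ≡⟨ cong₂ (λ u v → (c * u + d * c₁) - (c * v + d * c₁)) (ev-A 1ℚ) (ev-A 0ℚ) ⟨
          (c * evalℚ A 1ℚ + d * c₁) - (c * evalℚ A 0ℚ + d * c₁)
            ≡⟨ cong₂ _-_ (h′ 1ℚ) (h′ 0ℚ) ⟩
          0ℚ ∎)

  certificate≤3 : ∀ c₀ c₁ c₂ c₃ → ¬ (c₁ ≡ 0ℚ × c₂ ≡ 0ℚ × c₃ ≡ 0ℚ) → Certificate c₀ c₁ c₂ c₃ 0ℚ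
  certificate≤3 c₀ c₁ c₂ c₃ ≢0 with c₃ ℚₚ.≟ 0ℚ
  ... | no  c₃≢0 = certificate₃ c₀ c₁ c₂ c₃ c₃≢0
  ... | yes refl with c₂ ℚₚ.≟ 0ℚ
  ...   | no  c₂≢0 = certificate₂ c₀ c₁ c₂ c₂≢0
  ...   | yes refl = certificate₁ c₀ c₁ λ c₁≡0 → ≢0 (c₁≡0 , refl , refl)

  -- From m² = p k² it follows that k divides m², hence m by coprimality, hence k = 1.
  coprime-square : ∀ {m k p} → Coprime m k → m ℕ.* m ≡ p ℕ.* (k ℕ.* k) → m ℕ.* m ≡ p
  coprime-square {m} {k} {p} c e = trans e (trans (cong (λ k → p ℕ.* (k ℕ.* k)) k≡1) (ℕₚ.*-identityʳ p))
    where
    k∣m : k ∣ m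
    k∣m = coprime-divisor (Coprimality.sym c) (divides (p ℕ.* k) (trans e (sym (ℕₚ.*-assoc p k k))))
    k≡1 : k ≡ 1
    k≡1 = c (k∣m , ∣-refl)

  -- One argument for both 2 and 3, which lie strictly between the squares 1 and 4.
  square≢ : ∀ p → 2 ℕ.≤ p → p ℕ.≤ 3 → ∀ m → m ℕ.* m ≢ p
  square≢ p 2≤p p≤3 zero          e = ℕₚ.<⇒≢ (ℕₚ.<-≤-trans (s≤s z≤n) 2≤p) e
  square≢ p 2≤p p≤3 (suc zero)    e = ℕₚ.<⇒≢ 2≤p e
  square≢ p 2≤p p≤3 (suc (suc m)) e = ℕₚ.<⇒≢ (ℕₚ.≤-<-trans p≤3 (ℕₚ.*-mono-≤ {2} {2 ℕ.+ m} {2} {2 ℕ.+ m} (s≤s (s≤s z≤n))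
    (s≤s (s≤s z≤n)))) (sym e)

  rational-square : ∀ (q : ℚ) p → toℚᵘ (q * q) ℚᵘ.≃ (ℚᵘ.mkℚᵘ (ℤ.+ p) 0) → ℤ.∣ ℚ.numerator q ∣ ℕ.* ℤ.∣ ℚ.numerator q ∣ ≡ p
  rational-square q@(mkℚ n d c) p h with ℚᵘₚ.≃-trans (ℚᵘₚ.≃-sym (ℚₚ.toℚᵘ-homo-* q q)) h
  ... | *≡* e = coprime-square (Coprimality.recompute c) (begin
    ℤ.∣ n ∣ ℕ.* ℤ.∣ n ∣                    ≡⟨ ℤₚ.abs-* n n ⟨
    ℤ.∣ n ℤ.* n ∣                          ≡⟨ cong ℤ.∣_∣ (ℤₚ.*-identityʳ (n ℤ.* n)) ⟨
    ℤ.∣ n ℤ.* n ℤ.* ℤ.+ 1 ∣                  ≡⟨ cong ℤ.∣_∣ e ⟩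
    ℤ.∣ ℤ.+ p ℤ.* ℤ.+ (suc d ℕ.* suc d) ∣      ≡⟨ ℤₚ.abs-* (ℤ.+ p) (ℤ.+ (suc d ℕ.* suc d)) ⟩
    p ℕ.* (suc d ℕ.* suc d)                ∎)
    where open ≡-Reasoning

  √2-irrational : ∀ q → q * q ≢ 1ℚ ℚ.+ 1ℚ
  √2-irrational q e = square≢ 2 (s≤s (s≤s z≤n)) (s≤s (s≤s z≤n)) ℤ.∣ ℚ.numerator q ∣
    (rational-square q 2 (ℚᵘₚ.≃-reflexive (cong toℚᵘ e)))

  √3-irrational : ∀ q → q * q ≢ 1ℚ ℚ.+ (1ℚ ℚ.+ 1ℚ)
  √3-irrational q e = square≢ 3 (s≤s (s≤s z≤n)) (s≤s (s≤s (s≤s z≤n))) ℤ.∣ ℚ.numerator q ∣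
    (rational-square q 3 (ℚᵘₚ.≃-reflexive (cong toℚᵘ e)))

  -- An invertible linear substitution in (a , b) is a projective change of the coordinate t; x and
  -- w, hence X and W, stay the same. Stating non-constancy as linear independence makes it
  -- invariant, by Cramer's rule.
  linearChange : ∀ {c₀ c₁ c₂ c₃ c₄ d₀ d₁ d₂ d₃ d₄} p q s t → p * t - q * s ≢ 0ℚ →
    (∀ u v → form c₀ c₁ c₂ c₃ c₄ (p * u + q * v) (s * u + t * v) ≡ form d₀ d₁ d₂ d₃ d₄ u v) →
    Certificate d₀ d₁ d₂ d₃ d₄ → Certificate c₀ c₁ c₂ c₃ c₄
  linearChange {c₀} {c₁} {c₂} {c₃} {c₄} {d₀} {d₁} {d₂} {d₃} {d₄} p q s t det≢0 change C = record
    { a = a′ ; b = b′ ; X = X ; W = W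
    ; independent = λ c d h →
        let c′≡0 , d′≡0 = independent (c * p + d * s) (c * q + d * t) λ r →
              trans (regroup c d p q s t (evalℚ a r) (evalℚ b r))
                (trans (cong₂ (λ u v → c * u + d * v) (sym (ev-a r)) (sym (ev-b r))) (h r))
        in noZeroDivisorsℚ {p * t - q * s} {c} (trans (cramer₁ c d p q s t) (cong₂ _-_ (*≡0ʳ t c′≡0) (*≡0ʳ s d′≡0))) det≢0
         , noZeroDivisorsℚ {p * t - q * s} {d} (trans (cramer₂ c d p q s t) (cong₂ _-_ (*≡0ʳ p d′≡0) (*≡0ʳ q c′≡0))) det≢0
    ; identity = λ r → trans (identity r) (cong (λ u → evalℚ X r * evalℚ X r + u) (trans
        (sym (change (evalℚ a r) (evalℚ b r)))
        (cong₂ (form c₀ c₁ c₂ c₃ c₄) (sym (ev-a r)) (sym (ev-b r)))))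
    ; W₀≢0 = W₀≢0
    ; notProportional = notProportional
    }
    where
    open Certificate C
    a′ b′ : Poly
    a′ = scale p a +ₚ scale q b
    b′ = scale s a +ₚ scale t b
    ev-a : ∀ r → evalℚ a′ r ≡ p * evalℚ a r + q * evalℚ b r
    ev-a r = ev-+≡ (scale p a) (scale q b) {r} (ev-scale p a r) (ev-scale q b r)
    ev-b : ∀ r → evalℚ b′ r ≡ s * evalℚ a r + t * evalℚ b r
    ev-b r = ev-+≡ (scale s a) (scale t b) {r} (ev-scale s a r) (ev-scale t b r)
    regroup : ∀ c d p q s t a b → (c * p + d * s) * a + (c * q + d * t) * b ≡ c * (p * a + q * b) + d * (s * a + t * b)
    regroup = solve 8 (λ c d p q s t a b → (c :* p :+ d :* s) :* a :+ (c :* q :+ d :* t) :* b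
      := c :* (p :* a :+ q :* b) :+ d :* (s :* a :+ t :* b)) refl
    cramer₁ : ∀ c d p q s t → (p * t - q * s) * c ≡ t * (c * p + d * s) - s * (c * q + d * t)
    cramer₁ = solve 6 (λ c d p q s t → (p :* t :- q :* s) :* c := t :* (c :* p :+ d :* s) :- s :* (c :* q :+ d :* t)) refl
    cramer₂ : ∀ c d p q s t → (p * t - q * s) * d ≡ p * (c * q + d * t) - q * (c * p + d * s)
    cramer₂ = solve 6 (λ c d p q s t → (p :* t :- q :* s) :* d := p :* (c :* q :+ d :* t) :- q :* (c :* p :+ d :* s)) refl

  module _ (c₀ c₁ c₂ c₃ c₄ : ℚ) where

    shift : ∀ t → Certificate (c₀ + t * (c₁ + t * (c₂ + t * (c₃ + t * c₄))))
      (c₁ + t * (2 · c₂ + t * (3 · c₃ + t * (4 · c₄))))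
      (c₂ + t * (3 · c₃ + t * (6 · c₄))) (c₃ + t * (4 · c₄)) c₄ → Certificate c₀ c₁ c₂ c₃ c₄
    shift t = linearChange 1ℚ t 0ℚ 1ℚ
      (λ e → ℚₚ.1≢0 (trans (solve 1 (λ t → con (ℤ.+ 1) := con (ℤ.+ 1) :* con (ℤ.+ 1) :- t :* con (ℤ.+ 0)) refl t) e))
      (form-shift c₀ c₁ c₂ c₃ c₄ t)

    swap : Certificate c₄ c₃ c₂ c₁ c₀ → Certificate c₀ c₁ c₂ c₃ c₄
    swap = linearChange 0ℚ 1ℚ 1ℚ 0ℚ (λ ()) (form-swap c₀ c₁ c₂ c₃ c₄)

    shear : ∀ e → Certificate c₀ (4 · (e * c₀) + c₁) (6 · (e * e * c₀) + 3 · (e * c₁) + c₂)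
      (4 · (e * e * e * c₀) + 3 · (e * e * c₁) + 2 · (e * c₂) + c₃)
      (e * e * e * e * c₀ + e * e * e * c₁ + e * e * c₂ + e * c₃ + c₄) → Certificate c₀ c₁ c₂ c₃ c₄
    shear e = linearChange 1ℚ 0ℚ e 1ℚ
      (λ h → ℚₚ.1≢0 (trans (solve 1 (λ e → con (ℤ.+ 1) := con (ℤ.+ 1) :* con (ℤ.+ 1) :- con (ℤ.+ 0) :* e) refl e) h))
      (form-shear c₀ c₁ c₂ c₃ c₄ e)

  0≤square : ∀ x → 0ℚ ≤ x * x
  0≤square x with ℚₚ.≤-total 0ℚ x
  ... | inj₁ 0≤x = ℚₚ.nonNegative⁻¹ (x * x) {{ℚₚ.nonNeg*nonNeg⇒nonNeg x {{ℚ.nonNegative 0≤x}} x {{ℚ.nonNegative 0≤x}}}}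
  ... | inj₂ x≤0 = ℚₚ.nonNegative⁻¹ (x * x) {{ℚₚ.nonPos*nonPos⇒nonPos x {{ℚ.nonPositive x≤0}} x {{ℚ.nonPositive x≤0}}}}

  divide : ∀ a b → b ≢ 0ℚ → ∃ λ q → q * b ≡ a
  divide a b b≢0 = a * ℚ.1/ b , trans (ℚₚ.*-assoc a (ℚ.1/ b) b)
    (trans (cong (a *_) (ℚₚ.*-inverseˡ b)) (ℚₚ.*-identityʳ a))
    where instance _ = ℚ.≢-nonZero b≢0

  -- Here w = w₀ + t/z, 2 x = w² + V and t = − z C / D, with V = V₀ + … of degree 2 in t.
  module Quartic (w₀ V₀ h₀ h₂ h₃ h₄ p γ : ℚ) (pV₀ : p * V₀ ≡ w₀ * w₀) (V₀γ : V₀ * γ ≡ 2 · h₂) (w₀≢0 : w₀ ≢ 0ℚ)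
    (V₀≢0 : V₀ ≢ 0ℚ) (h₀≢0 : h₀ ≢ 0ℚ)
    (point : V₀ * V₀ + 4 · h₀ ≡ w₀ * w₀ * (w₀ * w₀)) (h≢0 : ¬ (h₂ ≡ 0ℚ × h₃ ≡ 0ℚ × h₄ ≡ 0ℚ)) where
    private
      β : ℚ
      β = 3 · p - 2 · (p * p * p)

      p≢0 : p ≢ 0ℚ
      p≢0 p≡0 = *-≢0 w₀≢0 w₀≢0 (trans (sym pV₀) (*≡0ˡ V₀ p≡0))

      1-p²≢0 : 1ℚ - p * p ≢ 0ℚ
      1-p²≢0 e = ·≢0 3 h₀≢0 (unit-square w₀ V₀ p h₀ point pV₀ e)

      c₁ c₃ d₄ : ℚ
      c₁ = 4 · (w₀ * p * γ)
      c₃ = 4 · (w₀ * (1ℚ - p * β))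
      d₄ = 1ℚ - β * β

      c₃≢0 : c₃ ≢ 0ℚ
      c₃≢0 e = ·≢0 3 (*-≢0 w₀≢0 (*-≢0 1-p²≢0 1-2p²≢0)) (trans (sym (c₃-factors w₀ p)) e)
        where
        1-2p²≢0 : 1ℚ - 2 · (p * p) ≢ 0ℚ
        1-2p²≢0 e = √2-irrational (2 · p) (trans
          (solve 1 (λ p → 2 :× p :* (2 :× p) := 2 :× (2 :× (p :* p))) refl p)
          (cong (2 ·_) (sym (x-y≡0⇒x≡y {1ℚ} {2 · (p * p)} e))))

      d₄≢0 : d₄ ≢ 0ℚ
      d₄≢0 e = *-≢0 1-p²≢0 (λ e → √3-irrational s (x-y≡0⇒x≡y {s * s} {3 · 1ℚ} e)) (trans (sym (d₄-factors p)) e)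
        where s = 2 · (p * p) - 2 · 1ℚ

      S C D W V X : Poly
      S = β ∷ 0ℚ ∷ - γ ∷ []
      C = c₃ ∷ 0ℚ ∷ c₁ ∷ - (4 · h₃) ∷ []
      D = d₄ ∷ 0ℚ ∷ 2 · (β * γ) ∷ 0ℚ ∷ - (4 · h₄ + γ * γ) ∷ []
      W = scale w₀ D +ₚ (-ₚ C)
      V = (scale V₀ D +ₚ (-ₚ scale (2 · (w₀ * p)) C)) *ₚ D +ₚ S *ₚ (C *ₚ C)
      X = scale ½ (W *ₚ W +ₚ V)

      W′ V′ : ℚ → ℚ
      W′ r = w₀ * evalℚ D r - evalℚ C r
      V′ r = (V₀ * evalℚ D r - 2 · (w₀ * p) * evalℚ C r) * evalℚ D r + evalℚ S r * (evalℚ C r * evalℚ C r)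

      ev-W : ∀ r → evalℚ W r ≡ W′ r
      ev-W r = ev-+≡ (scale w₀ D) (-ₚ C) {r} (ev-scale w₀ D r) (ev-neg C r)

      ev-V : ∀ r → evalℚ V r ≡ V′ r
      ev-V r = ev-+≡ ((scale V₀ D +ₚ (-ₚ scale (2 · (w₀ * p)) C)) *ₚ D) (S *ₚ (C *ₚ C)) {r}
        (ev-*≡ (scale V₀ D +ₚ (-ₚ scale (2 · (w₀ * p)) C)) D {r}
          (ev-+≡ (scale V₀ D) (-ₚ scale (2 · (w₀ * p)) C) {r} (ev-scale V₀ D r)
            (ev-neg≡ (scale (2 · (w₀ * p)) C) {r} (ev-scale (2 · (w₀ * p)) C r))) refl)
        (ev-*≡ S (C *ₚ C) {r} refl (ev-* C C r))

      ev-X : ∀ r → evalℚ X r ≡ ½ * (W′ r * W′ r + V′ r)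
      ev-X r = trans (ev-scale ½ (W *ₚ W +ₚ V) r) (cong (½ *_)
        (ev-+≡ (W *ₚ W) V {r} (ev-*≡ W W {r} (ev-W r) (ev-W r)) (ev-V r)))

      ev-S : ∀ r → evalℚ S r ≡ β - γ * (r * r)
      ev-S r = solve 3 (λ β γ r → β :+ r :* (con (ℤ.+ 0) :+ r :* (:- γ :+ r :* con (ℤ.+ 0))) := β :- γ :*
        (r :* r)) refl β γ r

      quartic : ∀ r → V′ r * V′ r + 4 · form h₀ 0ℚ h₂ h₃ h₄ (- (r * evalℚ C r)) (evalℚ D r) ≡ W′ r * W′ r * (W′ r * W′ r)
      quartic r = quartic-identity w₀ V₀ p β γ h₀ h₂ h₃ h₄ r (evalℚ S r) (evalℚ C r) (evalℚ D r)
        point pV₀ V₀γ refl (ev-S r)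
        (trans (ev-C w₀ p β γ h₃ r) (cong (λ s → 4 · w₀ - 4 · (w₀ * p * s) - 4 · (h₃ * (r * r * r))) (sym (ev-S r))))
        (trans (ev-D4 β γ h₄ r) (cong (λ s → 1ℚ - s * s - 4 · (h₄ * (r * r * r * r))) (sym (ev-S r))))

      W₀≢0 : evalℚ W 0ℚ ≢ 0ℚ
      W₀≢0 e = *-≢0 w₀≢0 (*-≢0 1-p²≢0 λ e → √3-irrational s (x-y≡0⇒x≡y {s * s} {3 · 1ℚ} e)) (trans (sym (W0-factors w₀ p))
        (trans (sym (trans (ev-W 0ℚ) (cong₂ (λ d c → w₀ * d - c) (ev-at-0 D) (ev-at-0 C)))) e))
        where s = 2 · (p * p)

      C₀≢0 : evalℚ C 0ℚ ≢ 0ℚ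
      C₀≢0 e = c₃≢0 (trans (sym (ev-at-0 C)) e)

      -- If V = k W² then, as D = q C + z² R with q constant, the relation
      -- becomes z² Q + C² L = 0 with L constant, so that L = 0 and Q = 0.
      module Proportional (k q : ℚ) (V≡kW² : ∀ r → V′ r ≡ k * (W′ r * W′ r)) (qc₃ : q * c₃ ≡ d₄) where
        r₀ r₁ r₂ : ℚ
        r₂ = 2 · (β * γ) - q * c₁
        r₁ = q * (4 · h₃)
        r₀ = - (4 · h₄ + γ * γ)
        R : Poly
        R = r₂ ∷ r₁ ∷ r₀ ∷ []

        q≢0 : q ≢ 0ℚ
        q≢0 q≡0 = d₄≢0 (trans (sym qc₃) (*≡0ˡ c₃ q≡0))

        A B e L : ℚ
        A = V₀ - k * (w₀ * w₀)
        B = 2 · (w₀ * (k - p))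
        e = 2 · (A * q) + B
        L = A * (q * q) + B * q + (β - k)

        Q′ : ℚ → ℚ
        Q′ r = A * (r * r * (evalℚ R r * evalℚ R r)) + e * (evalℚ C r * evalℚ R r) - γ * (evalℚ C r * evalℚ C r)

        relation : ∀ r → r * r * Q′ r + evalℚ C r * evalℚ C r * L ≡ 0ℚ
        relation r = proportional-identity w₀ V₀ p β γ k q r (evalℚ S r) (evalℚ C r) (evalℚ D r) (evalℚ R r)
          (V≡kW² r) (ev-S r) (ev-division w₀ p β γ h₃ h₄ d₄ c₃ q r qc₃)

        L≡0 : L ≡ 0ℚ
        L≡0 = noZeroDivisorsℚ {evalℚ C 0ℚ * evalℚ C 0ℚ} {L} (begin
          evalℚ C 0ℚ * evalℚ C 0ℚ * L                   ≡⟨ ℚₚ.+-identityˡ (evalℚ C 0ℚ * evalℚ C 0ℚ * L) ⟨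
          0ℚ + evalℚ C 0ℚ * evalℚ C 0ℚ * L              ≡⟨ cong (λ u → u + evalℚ C 0ℚ * evalℚ C 0ℚ * L)
            (ℚₚ.*-zeroˡ (Q′ 0ℚ)) ⟨
          0ℚ * Q′ 0ℚ + evalℚ C 0ℚ * evalℚ C 0ℚ * L      ≡⟨ relation 0ℚ ⟩
          0ℚ                                            ∎) (*-≢0 C₀≢0 C₀≢0)

        -- The function `Q′` as a list of coefficients: its vanishing at every r ≠ 0 becomes seven
        -- equations.
        Q : Poly
        Q = e * (c₃ * r₂) - γ * (c₃ * c₃)
          ∷ e * (c₃ * r₁)
          ∷ A * (r₂ * r₂) + e * (c₃ * r₀ + c₁ * r₂) - 2 · (γ * (c₃ * c₁))
          ∷ 2 · (A * (r₁ * r₂)) + e * (c₁ * r₁ - 4 · h₃ * r₂) + 2 · (γ * (c₃ * (4 · h₃)))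
          ∷ A * (r₁ * r₁ + 2 · (r₂ * r₀)) + e * (c₁ * r₀ - 4 · h₃ * r₁) - γ * (c₁ * c₁)
          ∷ 2 · (A * (r₁ * r₀)) - e * (4 · h₃ * r₀) + 2 · (γ * (c₁ * (4 · h₃)))
          ∷ A * (r₀ * r₀) - γ * (4 · h₃ * (4 · h₃)) ∷ []

        Q≈0 : Q ≈ₚ 0ₚ
        Q≈0 = ev≡⇒≈ₚ Q 0ₚ λ r r≢0 → trans (ev-remainder A e γ c₃ c₁ (4 · h₃) r₀ r₁ r₂ r)
          (noZeroDivisorsℚ {r * r} {Q′ r} (trans (trans (sym (ℚₚ.+-identityʳ (r * r * Q′ r)))
            (cong (λ u → r * r * Q′ r + u) (sym (*≡0ʳ (evalℚ C r * evalℚ C r) L≡0)))) (relation r)) (*-≢0 r≢0 r≢0))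

        -- A = 0 would give k p = 1, and with L = 0 also w₀ (1 - p²)² (1 + 4 p⁴) = 0, whose factors
        -- are all nonzero.
        A≢0 : A ≢ 0ℚ
        A≢0 A≡0 = ·≢0 1 (*-≢0 w₀≢0 (*-≢0 (*-≢0 1-p²≢0 1-p²≢0) 1+4p⁴≢0))
          (excluded-constant w₀ V₀ p k q A≡0 L≡0 qc₃ kp≡1)
          where
          kp≡1 : k * p ≡ 1ℚ
          kp≡1 = x-y≡0⇒x≡y {k * p} {1ℚ} (noZeroDivisorsℚ {V₀} {k * p - 1ℚ} (inverse-of-p w₀ V₀ p k A≡0 pV₀) V₀≢0)
          1+4p⁴≢0 : 1ℚ + 4 · (p * p * p * p) ≢ 0ℚ
          1+4p⁴≢0 e = ℚₚ.<-irrefl (sym (trans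
            (cong (1ℚ +_) (solve 1 (λ p → 2 :× (p :* p) :* (2 :× (p :* p)) := 4 :× (p :* p :* p :* p)) refl p)) e))
            (ℚₚ.+-mono-<-≤ (ℚₚ.positive⁻¹ 1ℚ) (0≤square (2 · (p * p))))

        r₀≡0⇒h₄≡0 : γ ≡ 0ℚ → r₀ ≡ 0ℚ → h₄ ≡ 0ℚ
        r₀≡0⇒h₄≡0 γ≡0 r₀≡0 = ·≡0 3 (trans
          (trans (sym (ℚₚ.+-identityʳ (4 · h₄))) (cong (λ u → 4 · h₄ + u) (sym (*≡0ˡ γ γ≡0)))) (neg≡0 r₀≡0))

        γ≡0⇒h₂≡0 : γ ≡ 0ℚ → h₂ ≡ 0ℚ
        γ≡0⇒h₂≡0 γ≡0 = ·≡0 1 (trans (sym V₀γ) (*≡0ʳ V₀ γ≡0))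

        r₁≡0⇒h₃≡0 : r₁ ≡ 0ℚ → h₃ ≡ 0ℚ
        r₁≡0⇒h₃≡0 r₁≡0 = ·≡0 3 (noZeroDivisorsℚ {q} {4 · h₃} r₁≡0 q≢0)

        -≡0 : ∀ x y → x - y ≡ 0ℚ → y ≡ 0ℚ → x ≡ 0ℚ
        -≡0 x y x-y≡0 y≡0 = trans (x-y≡0⇒x≡y {x} {y} x-y≡0) y≡0

        -- Four coefficients of Q suffice. If e = 0, those of degree 0, 6 and 4 give γ = 0, r₀ = 0
        -- and r₁ = 0 in turn. If e ≠ 0, those of degree 1 and 6 give r₁ = 0, hence h₃ = 0, and r₀ =
        -- 0; degree 4 then reduces to γ c₁² = 0, and c₁ is a nonzero multiple of γ. Either way h₂ =
        -- h₃ = h₄ = 0.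
        absurd : Dec (e ≡ 0ℚ) → ⊥
        absurd (yes e≡0) = h≢0 (γ≡0⇒h₂≡0 γ≡0 , r₁≡0⇒h₃≡0 r₁≡0 , r₀≡0⇒h₄≡0 γ≡0 r₀≡0)
          where
          γ≡0 : γ ≡ 0ℚ
          γ≡0 = noZeroDivisorsℚ {c₃ * c₃} {γ} (trans (ℚₚ.*-comm (c₃ * c₃) γ)
            (trans (sym (x-y≡0⇒x≡y {e * (c₃ * r₂)} {γ * (c₃ * c₃)} (Q≈0 0))) (*≡0ˡ (c₃ * r₂) e≡0))) (*-≢0 c₃≢0 c₃≢0)
          r₀≡0 : r₀ ≡ 0ℚ
          r₀≡0 = square≡0 {r₀} (noZeroDivisorsℚ {A} {r₀ * r₀} (-≡0 (A * (r₀ * r₀)) (γ * (4 · h₃ * (4 · h₃))) (Q≈0 6)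
            (*≡0ˡ (4 · h₃ * (4 · h₃)) γ≡0)) A≢0)
          r₁≡0 : r₁ ≡ 0ℚ
          r₁≡0 = square≡0 {r₁} (noZeroDivisorsℚ {A} {r₁ * r₁} (begin
            A * (r₁ * r₁)                      ≡⟨ cong (A *_) (ℚₚ.+-identityʳ (r₁ * r₁)) ⟨
            A * (r₁ * r₁ + 0ℚ)                 ≡⟨ cong (λ u → A * (r₁ * r₁ + 2 · u)) (*≡0ʳ r₂ r₀≡0) ⟨
            A * (r₁ * r₁ + 2 · (r₂ * r₀))      ≡⟨ ℚₚ.+-identityʳ (A * (r₁ * r₁ + 2 · (r₂ * r₀))) ⟨
            A * (r₁ * r₁ + 2 · (r₂ * r₀)) + 0ℚ ≡⟨ cong (λ u → A * (r₁ * r₁ + 2 · (r₂ * r₀)) + u)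
              (*≡0ˡ (c₁ * r₀ - 4 · h₃ * r₁) e≡0) ⟨
            A * (r₁ * r₁ + 2 · (r₂ * r₀)) + e * (c₁ * r₀ - 4 · h₃ * r₁)
                                               ≡⟨ -≡0 _ (γ * (c₁ * c₁)) (Q≈0 4) (*≡0ˡ (c₁ * c₁) γ≡0) ⟩
            0ℚ                                 ∎) A≢0)
        absurd (no e≢0) = h≢0 (γ≡0⇒h₂≡0 γ≡0 , h₃≡0 , r₀≡0⇒h₄≡0 γ≡0 r₀≡0)
          where
          r₁≡0 : r₁ ≡ 0ℚ
          r₁≡0 = noZeroDivisorsℚ {c₃} {r₁} (noZeroDivisorsℚ {e} {c₃ * r₁} (Q≈0 1) e≢0) c₃≢0
          h₃≡0 : h₃ ≡ 0ℚ
          h₃≡0 = r₁≡0⇒h₃≡0 r₁≡0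
          4h₃≡0 : 4 · h₃ ≡ 0ℚ
          4h₃≡0 = cong (4 ·_) h₃≡0
          r₀≡0 : r₀ ≡ 0ℚ
          r₀≡0 = square≡0 {r₀} (noZeroDivisorsℚ {A} {r₀ * r₀} (-≡0 (A * (r₀ * r₀)) (γ * (4 · h₃ * (4 · h₃))) (Q≈0 6)
            (*≡0ʳ γ (*≡0ˡ (4 · h₃) 4h₃≡0))) A≢0)
          γc₁²≡0 : γ * (c₁ * c₁) ≡ 0ℚ
          γc₁²≡0 = begin
            γ * (c₁ * c₁)
              ≡⟨ x-y≡0⇒x≡y {A * (r₁ * r₁ + 2 · (r₂ * r₀)) + e * (c₁ * r₀ - 4 · h₃ * r₁)} {γ * (c₁ * c₁)} (Q≈0 4) ⟨
            A * (r₁ * r₁ + 2 · (r₂ * r₀)) + e * (c₁ * r₀ - 4 · h₃ * r₁)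
              ≡⟨ cong₂ (λ u v → A * u + e * v)
                   (cong₂ (λ u v → u + 2 · v) (*≡0ˡ r₁ r₁≡0) (*≡0ʳ r₂ r₀≡0))
                     (cong₂ _-_ (*≡0ʳ c₁ r₀≡0) (*≡0ʳ (4 · h₃) r₁≡0)) ⟩
            A * 0ℚ + e * 0ℚ
              ≡⟨ cong₂ _+_ (ℚₚ.*-zeroʳ A) (ℚₚ.*-zeroʳ e) ⟩
            0ℚ ∎
          γ≡0 : γ ≡ 0ℚ
          γ≡0 = decidable-stable (γ ℚₚ.≟ 0ℚ) λ γ≢0 →
            let c₁≢0 = ·≢0 3 (*-≢0 (*-≢0 w₀≢0 p≢0) γ≢0) in *-≢0 γ≢0 (*-≢0 c₁≢0 c₁≢0) γc₁²≡0

    certificate₄ : Certificate h₀ 0ℚ h₂ h₃ h₄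
    certificate₄ = record
      { a = -ₚ (0ℚ ∷ C) ; b = D ; X = X ; W = W
      -- Here a = - r C is the polynomial divisible by r, so the roles are exchanged and the sign is
      -- moved to c.
      ; independent = λ c d h →
          let d≡0 , -c≡0 = independent-shift D C (λ e → d₄≢0 (trans (sym (ev-at-0 D)) e)) C₀≢0 d (- c) λ r →
                trans (swapped c d (r * evalℚ C r) (evalℚ D r))
                  (trans (cong (λ u → c * u + d * evalℚ D r) (sym (ev-a r))) (h r))
          in neg≡0 -c≡0 , d≡0
      ; identity = λ r → subst₂ (λ x w → x * (w * w) ≡ x * x + form h₀ 0ℚ h₂ h₃ h₄ (evalℚ (-ₚ (0ℚ ∷ C)) r) (evalℚ D r))
          (sym (ev-X r)) (sym (ev-W r))
          (subst (λ a → ½ * (W′ r * W′ r + V′ r) * (W′ r * W′ r) ≡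
              ½ * (W′ r * W′ r + V′ r) * (½ * (W′ r * W′ r + V′ r)) + form h₀ 0ℚ h₂ h₃ h₄ a (evalℚ D r)) (sym (ev-a r))
            (half-identity ½ (W′ r) (V′ r) (form h₀ 0ℚ h₂ h₃ h₄ (- (r * evalℚ C r)) (evalℚ D r)) refl (quartic r)))
      ; W₀≢0 = W₀≢0
      -- As 2 X = W² + V, the relation X = k W² amounts to V = (2 k - 1) W².
      ; notProportional = λ k h → 
          let q , qc₃ = divide d₄ c₃ c₃≢0
              module P = Proportional (2 · k - 1ℚ) q (λ r → half-proportional ½ (W′ r) (V′ r) k refl
                (trans (sym (ev-X r)) (trans (h r) (cong (λ w → k * (w * w)) (ev-W r))))) qc₃
          in P.absurd (P.e ℚₚ.≟ 0ℚ)
      }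
      where
      ev-a : ∀ r → evalℚ (-ₚ (0ℚ ∷ C)) r ≡ - (r * evalℚ C r)
      ev-a r = ev-neg≡ (0ℚ ∷ C) {r} (ev-0∷ C r)
      swapped : ∀ c d u v → d * v + - c * u ≡ c * (- u) + d * v
      swapped = solve 4 (λ c d u v → d :* v :+ (:- c) :* u := c :* (:- u) :+ d :* v) refl

open Certificates

-- A usable point among infinitely many on the fibre

module RationalPoints where
  open import Data.Rational.Base using (_+_; _*_; _-_; _≤_)
  open ≡
  open ℚ-Solver

  sgn : ℚ → Fin 3
  sgn x with ℚₚ.<-cmp x 0ℚ
  ... | tri< _ _ _ = 0F
  ... | tri≈ _ _ _ = 1F
  ... | tri> _ _ _ = 2F

  squares≡ : ∀ {x y} → x * x ≡ y * y → x + y ≢ 0ℚ → x ≡ y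
  squares≡ {x} {y} e x+y≢0 = x-y≡0⇒x≡y {x} {y} (noZeroDivisorsℚ {x + y} {x - y}
    (trans (solve 2 (λ x y → (x :+ y) :* (x :- y) := x :* x :- y :* y) refl x y) (x≡y⇒x-y≡0 e)) x+y≢0)

  sgn-square-injective : ∀ x y → sgn x ≡ sgn y → x * x ≡ y * y → x ≡ y
  sgn-square-injective x y s e with ℚₚ.<-cmp x 0ℚ | ℚₚ.<-cmp y 0ℚ
  ... | tri< x<0 _ _ | tri< y<0 _ _ = squares≡ e λ x+y≡0 → ℚₚ.<-irrefl x+y≡0 (ℚₚ.+-mono-< x<0 y<0)
  ... | tri≈ _ x≡0 _ | tri≈ _ y≡0 _ = trans x≡0 (sym y≡0)
  ... | tri> _ _ 0<x | tri> _ _ 0<y = squares≡ e λ x+y≡0 → ℚₚ.<-irrefl (sym x+y≡0) (ℚₚ.+-mono-< 0<x 0<y)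
  sgn-square-injective x y () e | tri< _ _ _ | tri≈ _ _ _
  sgn-square-injective x y () e | tri< _ _ _ | tri> _ _ _
  sgn-square-injective x y () e | tri≈ _ _ _ | tri< _ _ _
  sgn-square-injective x y () e | tri≈ _ _ _ | tri> _ _ _
  sgn-square-injective x y () e | tri> _ _ _ | tri< _ _ _
  sgn-square-injective x y () e | tri> _ _ _ | tri≈ _ _ _

  OnCurve : ℚ → ℚ × ℚ → Set
  OnCurve c (x , y) = y * y ≡ x * x * x + c * x + 0ℚ

  -- y ≠ 0 makes x and w = y/x nonzero. The second condition makes V₀ = 2 x - w² nonzero, since x V₀
  -- = x² - c. For c ≠ 0 the excluded points are the affine 2-torsion points and the halves of (0 ,
  -- 0).
  Good : ℚ → ℚ × ℚ → Set
  Good c (x , y) = y ≢ 0ℚ × x * x ≢ c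

  module _ (c : ℚ) where
    -- y = 0 means x (x² + c) = 0, and otherwise x² = c; both cases are contained in x (x² + c) (x²
    -- - c) = 0.
    bad-abscissa : ∀ P → OnCurve c P → ¬ Good c P → proj₁ P * ((proj₁ P * proj₁ P) * (proj₁ P * proj₁ P) - c * c) ≡ 0ℚ
    bad-abscissa (x , y) on bad with y ℚₚ.≟ 0ℚ
    ... | yes y≡0 = trans
      (solve 2 (λ x c → x :* ((x :* x) :* (x :* x) :- c :* c) := (x :* x :- c) :*
        (x :* x :* x :+ c :* x :+ con (ℤ.+ 0))) refl x c)
      (*≡0ʳ (x * x - c) (trans (sym on) (*≡0ˡ y y≡0)))
    ... | no y≢0 = trans
      (solve 2 (λ x c → x :* ((x :* x) :* (x :* x) :- c :* c) := x :* (x :* x :+ c) :* (x :* x :- c)) refl x c)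
      (*≡0ʳ (x * (x * x + c)) (x≡y⇒x-y≡0 (decidable-stable (x * x ℚₚ.≟ c) λ x²≢c → bad (y≢0 , x²≢c))))

    -- A nonzero solution has x⁴ = c², which determines x² because squares are nonnegative, and then
    -- the sign determines x.
    sgn-determines-abscissa : ∀ x x′ → sgn x ≡ sgn x′ → x * ((x * x) * (x * x) - c * c) ≡ 0ℚ →
      x′ * ((x′ * x′) * (x′ * x′) - c * c) ≡ 0ℚ → x ≡ x′
    sgn-determines-abscissa x x′ s e e′ = decide (x ℚₚ.≟ 0ℚ) (x′ ℚₚ.≟ 0ℚ)
      where
      sgn0≢ : ∀ {z} → z ≢ 0ℚ → sgn 0ℚ ≢ sgn z
      sgn0≢ {z} z≢0 h with ℚₚ.<-cmp z 0ℚ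
      ... | tri≈ _ z≡0 _ = z≢0 z≡0
      sgn0≢ {z} z≢0 () | tri< _ _ _
      sgn0≢ {z} z≢0 () | tri> _ _ _
      decide : Dec (x ≡ 0ℚ) → Dec (x′ ≡ 0ℚ) → x ≡ x′
      decide (yes x≡0) (yes x′≡0) = trans x≡0 (sym x′≡0)
      decide (yes x≡0) (no x′≢0)  = ⊥-elim (sgn0≢ x′≢0 (trans (cong sgn (sym x≡0)) s))
      decide (no x≢0)  (yes x′≡0) = ⊥-elim (sgn0≢ x≢0 (trans (cong sgn (sym x′≡0)) (sym s)))
      decide (no x≢0)  (no x′≢0)  = sgn-square-injective x x′ s (squares≡ {x * x} {x′ * x′}
        (trans (fourth≡ x x≢0 e) (sym (fourth≡ x′ x′≢0 e′)))
        λ sum≡0 → *-≢0 x≢0 x≢0 (ℚₚ.≤-antisym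
          (ℚₚ.≤-trans (subst (_≤ x * x + x′ * x′) (ℚₚ.+-identityʳ (x * x)) (ℚₚ.+-monoʳ-≤ (x * x) (0≤square x′)))
            (ℚₚ.≤-reflexive sum≡0))
          (0≤square x)))
        where
        fourth≡ : ∀ z → z ≢ 0ℚ → z * ((z * z) * (z * z) - c * c) ≡ 0ℚ → (z * z) * (z * z) ≡ c * c
        fourth≡ z z≢0 h = x-y≡0⇒x≡y {(z * z) * (z * z)} {c * c} (noZeroDivisorsℚ {z} h z≢0)

    sgns-determine : ∀ P P′ → OnCurve c P → OnCurve c P′ → ¬ Good c P → ¬ Good c P′ →
      sgn (proj₁ P) ≡ sgn (proj₁ P′) → sgn (proj₂ P) ≡ sgn (proj₂ P′) → P ≡ P′
    sgns-determine (x , y) (x′ , y′) on on′ bad bad′ sx sy = cong₂ _,_ x≡x′ (sgn-square-injective y y′ sy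
      (trans on (trans (cong (λ x → x * x * x + c * x + 0ℚ) x≡x′) (sym on′))))
      where
      x≡x′ : x ≡ x′
      x≡x′ = sgn-determines-abscissa x x′ sx (bad-abscissa (x , y) on bad) (bad-abscissa (x′ , y′) on′ bad′)

    -- A bad point is determined by the signs of its coordinates, so there are at most 9 of them.
    good-point : InfinitelyManyRationalPoints c → ∃ λ P → OnCurve c P × Good c P
    good-point (P , P-injective , on) = find (any? λ i → good? (P (toℕ i)))
      where
      good? : ∀ Q → Dec (Good c Q)
      good? (x , y) = ¬? (y ℚₚ.≟ 0ℚ) ×-dec ¬? (x * x ℚₚ.≟ c)
      signs : Fin 10 → Fin 9
      signs i = combine (sgn (proj₁ (P (toℕ i)))) (sgn (proj₂ (P (toℕ i))))
      find : Dec (∃ λ (i : Fin 10) → Good c (P (toℕ i))) → ∃ λ Q → OnCurve c Q × Good c Q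
      find (yes (i , good)) = P (toℕ i) , on (toℕ i) , good
      find (no none) = ⊥-elim (collision (pigeonhole (ℕₚ.n<1+n 9) signs))
        where
        collision : (∃₂ λ i j → i Fin.< j × signs i ≡ signs j) → ⊥
        collision (i , j , i<j , e) = <⇒≢ i<j (toℕ-injective (P-injective (sgns-determine (P (toℕ i)) (P (toℕ j))
          (on (toℕ i)) (on (toℕ j)) (λ g → none (i , g)) (λ g → none (j , g))
          (proj₁ codes) (proj₂ codes))))
          where
          codes = combine-injective (sgn (proj₁ (P (toℕ i)))) (sgn (proj₂ (P (toℕ i))))
            (sgn (proj₁ (P (toℕ j)))) (sgn (proj₂ (P (toℕ j)))) e

open RationalPoints

-- The single complex root of a fourth power

module ComplexRoots where
  open import Data.Rational.Base using (_+_; _*_; -_; _-_; _<_; _≤_; ∣_∣)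
  open ≡
  open ℚ-Solver

  mutual
    -- The real and imaginary parts of the value at a + b i, on rational approximations. The shape
    -- copies the operations of `ℂ-rawRing`, including the added imaginary part 0 of a constant, so
    -- that each term of the Cauchy sequences matches directly.
    evRe : Poly → ℚ → ℚ → ℚ
    evRe []      a b = 0ℚ
    evRe (c ∷ p) a b = c + (a * evRe p a b + - (b * evIm p a b))

    evIm : Poly → ℚ → ℚ → ℚ
    evIm []      a b = 0ℚ
    evIm (c ∷ p) a b = 0ℚ + (a * evIm p a b + b * evRe p a b)

  evalℂ : Poly → ℂ → ℂ
  evalℂ = eval ℂ-rawRing constᶜ

  mutual
    seq-re : ∀ p z n → seq (re (evalℂ p z)) n ≡ evRe p (seq (re z) n) (seq (im z) n)
    seq-re []      z n = refl
    seq-re (c ∷ p) z n = cong₂ (λ u v → c + (seq (re z) n * u + - (seq (im z) n * v))) (seq-re p z n) (seq-im p z n)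

    seq-im : ∀ p z n → seq (im (evalℂ p z)) n ≡ evIm p (seq (re z) n) (seq (im z) n)
    seq-im []      z n = refl
    seq-im (c ∷ p) z n = cong₂ (λ u v → 0ℚ + (seq (re z) n * u + seq (im z) n * v)) (seq-im p z n) (seq-re p z n)

  ev≈0 : ∀ p a b → p ≈ₚ 0ₚ → evRe p a b ≡ 0ℚ × evIm p a b ≡ 0ℚ
  ev≈0 []      a b h = refl , refl
  ev≈0 (c ∷ p) a b h with ev≈0 p a b (λ i → h (suc i))
  ... | u≡0 , v≡0 =
    trans (cong₂ _+_ (h 0) (cong₂ (λ u v → a * u + - (b * v)) u≡0 v≡0))
      (solve 2 (λ a b → con (ℤ.+ 0) :+ (a :* con (ℤ.+ 0) :+ :- (b :* con (ℤ.+ 0))) := con (ℤ.+ 0)) refl a b) ,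
    trans (cong₂ (λ u v → 0ℚ + (a * v + b * u)) u≡0 v≡0) (solve 2 (λ a b → con (ℤ.+ 0) :+
      (a :* con (ℤ.+ 0) :+ b :* con (ℤ.+ 0)) := con (ℤ.+ 0)) refl a b)

  evℂ-cong : ∀ p q a b → p ≈ₚ q → evRe p a b ≡ evRe q a b × evIm p a b ≡ evIm q a b
  evℂ-cong [] q a b h with ev≈0 q a b (λ i → sym (h i))
  ... | u≡0 , v≡0 = sym u≡0 , sym v≡0
  evℂ-cong (c ∷ p) [] a b h = ev≈0 (c ∷ p) a b h
  evℂ-cong (c ∷ p) (d ∷ q) a b h with evℂ-cong p q a b (λ i → h (suc i))
  ... | u≡ , v≡ = cong₂ _+_ (h 0) (cong₂ (λ u v → a * u + - (b * v)) u≡ v≡) , cong₂ (λ u v → 0ℚ + (a * v + b * u)) u≡ v≡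

  square-mono : ∀ {x y} → 0ℚ ≤ x → x ≤ y → x * x ≤ y * y
  square-mono {x} {y} 0≤x x≤y = ℚₚ.≤-trans
    (ℚₚ.*-monoˡ-≤-nonNeg x {{ℚ.nonNegative 0≤x}} x≤y)
    (ℚₚ.*-monoʳ-≤-nonNeg y {{ℚ.nonNegative (ℚₚ.≤-trans 0≤x x≤y)}} x≤y)

  ∣∣-square : ∀ x → ∣ x ∣ * ∣ x ∣ ≡ x * x
  ∣∣-square x = trans (sym (ℚₚ.∣p*q∣≡∣p∣*∣q∣ x x)) (ℚₚ.0≤p⇒∣p∣≡p (0≤square x))

  ∣∣<⇒square≤ : ∀ {x ε} → ∣ x ∣ < ε → x * x ≤ ε * ε
  ∣∣<⇒square≤ {x} {ε} h = subst (_≤ ε * ε) (∣∣-square x) (square-mono (ℚₚ.0≤∣p∣ x) (ℚₚ.<⇒≤ h))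

  square<⇒∣∣< : ∀ {x δ} → 0ℚ < δ → x * x < δ * δ → ∣ x ∣ < δ
  square<⇒∣∣< {x} {δ} 0<δ h = ℚₚ.≰⇒> λ δ≤∣x∣ → ℚₚ.<-irrefl refl (ℚₚ.<-≤-trans h
    (subst (δ * δ ≤_) (∣∣-square x) (square-mono (ℚₚ.<⇒≤ 0<δ) δ≤∣x∣)))

  ∣∣-pos : ∀ {x} → x ≢ 0ℚ → 0ℚ < ∣ x ∣
  ∣∣-pos {x} x≢0 = ℚₚ.≰⇒> λ ∣x∣≤0 → x≢0 (ℚₚ.∣p∣≡0⇒p≡0 x (ℚₚ.≤-antisym ∣x∣≤0 (ℚₚ.0≤∣p∣ x)))

  -- |κ (A + B i)⁴|² = κ² (A² + B²)⁴
  modulus-bound : ∀ κ A B {d} → κ ≢ 0ℚ → 0ℚ < d →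
    let ε = ½ * (∣ κ ∣ * (d * d)) in
    ∣ κ * (A * A * (A * A) - 6 · (A * A * (B * B)) + B * B * (B * B)) ∣ < ε →
    ∣ κ * (4 · (A * A * A * B) - 4 · (A * (B * B * B))) ∣ < ε →
    A * A + B * B < d
  -- If d ≤ A² + B², then T = κ² d⁴ is at most the squared modulus, which is at most 2 ε² = T/2; but
  -- T > 0.
  modulus-bound κ A B {d} κ≢0 0<d hu hv = ℚₚ.≰⇒> λ d≤s → ℚₚ.<-irrefl refl (begin-strict
    T                                    ≤⟨ ℚₚ.*-monoˡ-≤-nonNeg (κ * κ) {{ℚ.nonNegative (0≤square κ)}}
                                              (square-mono (0≤square d) (square-mono (ℚₚ.<⇒≤ 0<d) d≤s)) ⟩
    κ * κ * (s * s * (s * s))            ≡⟨ solve 3 (λ κ A B → let s = A :* A :+ B :* B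
                                                                   u = κ :* (A :* A :* (A :* A) :- 6 :× (A :* A :* (B :* B))
                                                                     :+ B :* B :* (B :* B))
                                                                   v = κ :* (4 :× (A :* A :* A :* B) :- 4 :×
                                                                     (A :* (B :* B :* B)))
                                              in κ :* κ :* (s :* s :* (s :* s)) := u :* u :+ v :* v) refl κ A B ⟩
    u * u + v * v                        ≤⟨ ℚₚ.+-mono-≤ (∣∣<⇒square≤ {u} hu) (∣∣<⇒square≤ {v} hv) ⟩
    ε * ε + ε * ε                        ≡⟨ solve 3 (λ h k d → h :* (k :* d) :* (h :* (k :* d)) :+ h :* (k :* d) :*
      (h :* (k :* d))
                                              := h :* ((h :+ h) :* (k :* k :* (d :* d)))) refl ½ ∣ κ ∣ (d * d) ⟩
    ½ * ((½ + ½) * (∣ κ ∣ * ∣ κ ∣ * (d * d * (d * d))))  ≡⟨ cong (λ k → ½ * ((½ + ½) * (k * (d * d * (d * d)))))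
      (∣∣-square κ) ⟩
    ½ * (1ℚ * T)                         ≡⟨ cong (½ *_) (ℚₚ.*-identityˡ T) ⟩
    ½ * T                                ≡⟨ ℚₚ.+-identityʳ (½ * T) ⟨
    ½ * T + 0ℚ                           <⟨ ℚₚ.+-monoʳ-< (½ * T) (half-pos 0<T) ⟩
    ½ * T + ½ * T                        ≡⟨ ½+½ T ⟩
    T                                    ∎)
    where
    open ℚₚ.≤-Reasoning
    s T u v ε : ℚ
    s = A * A + B * B
    T = κ * κ * (d * d * (d * d))
    u = κ * (A * A * (A * A) - 6 · (A * A * (B * B)) + B * B * (B * B))
    v = κ * (4 · (A * A * A * B) - 4 · (A * (B * B * B)))
    ε = ½ * (∣ κ ∣ * (d * d))
    0<d² : 0ℚ < d * d
    0<d² = *-pos 0<d 0<d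
    0<T : 0ℚ < T
    0<T = *-pos (subst (0ℚ <_) (∣∣-square κ) (*-pos (∣∣-pos κ≢0) (∣∣-pos κ≢0))) (*-pos 0<d² 0<d²)

  module _ (f : Poly) (κ p q : ℚ) (κ≢0 : κ ≢ 0ℚ) (q≢0 : q ≢ 0ℚ)
    (fourthPower : ∀ r → evalℚ f r ≡ κ * ((p + q * r) * (p + q * r) * ((p + q * r) * (p + q * r)))) where
    private
      F : Poly
      F = κ * (p * p * p * p) ∷ 4 · (κ * (p * p * p * q)) ∷ 6 · (κ * (p * p * q * q)) ∷ 4 · (κ * (p * q * q * q)) ∷ κ *
        (q * q * q * q) ∷ []

      f≈F : f ≈ₚ F
      f≈F = ev≡⇒≈ₚ f F λ r _ → trans (fourthPower r)
        (solve 4 (λ κ p q r → κ :* ((p :+ q :* r) :* (p :+ q :* r) :* ((p :+ q :* r) :* (p :+ q :* r))) :=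
          κ :* (p :* p :* p :* p) :+ r :* (4 :× (κ :* (p :* p :* p :* q)) :+ r :* (6 :× (κ :* (p :* p :* q :* q))
            :+ r :* (4 :× (κ :* (p :* q :* q :* q)) :+ r :* (κ :* (q :* q :* q :* q) :+ r :* con (ℤ.+ 0)))))) refl κ p q r)

      module _ (a b : ℚ) where
        A B : ℚ
        A = p + q * a
        B = q * b

        evRe-f : evRe f a b ≡ κ * (A * A * (A * A) - 6 · (A * A * (B * B)) + B * B * (B * B))
        evRe-f = trans (proj₁ (evℂ-cong f F a b f≈F)) (solve 5 (λ κ p q a b →
          let A = p :+ q :* a
              B = q :* b
              O = con (ℤ.+ 0)
              c₀ = κ :* (p :* p :* p :* p)
              c₁ = 4 :× (κ :* (p :* p :* p :* q))
              c₂ = 6 :× (κ :* (p :* p :* q :* q))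
              c₃ = 4 :× (κ :* (p :* q :* q :* q))
              c₄ = κ :* (q :* q :* q :* q)
              u₄ = c₄ :+ (a :* O :+ :- (b :* O))
              v₄ = O :+ (a :* O :+ b :* O)
              u₃ = c₃ :+ (a :* u₄ :+ :- (b :* v₄))
              v₃ = O :+ (a :* v₄ :+ b :* u₄)
              u₂ = c₂ :+ (a :* u₃ :+ :- (b :* v₃))
              v₂ = O :+ (a :* v₃ :+ b :* u₃)
              u₁ = c₁ :+ (a :* u₂ :+ :- (b :* v₂))
              v₁ = O :+ (a :* v₂ :+ b :* u₂)
          in c₀ :+ (a :* u₁ :+ :- (b :* v₁)) := κ :* (A :* A :* (A :* A) :- 6 :× (A :* A :* (B :* B)) :+ B :* B :*
            (B :* B)))
          refl κ p q a b)

        evIm-f : evIm f a b ≡ κ * (4 · (A * A * A * B) - 4 · (A * (B * B * B)))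
        evIm-f = trans (proj₂ (evℂ-cong f F a b f≈F)) (solve 5 (λ κ p q a b →
          let A = p :+ q :* a
              B = q :* b
              O = con (ℤ.+ 0)
              c₁ = 4 :× (κ :* (p :* p :* p :* q))
              c₂ = 6 :× (κ :* (p :* p :* q :* q))
              c₃ = 4 :× (κ :* (p :* q :* q :* q))
              c₄ = κ :* (q :* q :* q :* q)
              u₄ = c₄ :+ (a :* O :+ :- (b :* O))
              v₄ = O :+ (a :* O :+ b :* O)
              u₃ = c₃ :+ (a :* u₄ :+ :- (b :* v₄))
              v₃ = O :+ (a :* v₄ :+ b :* u₄)
              u₂ = c₂ :+ (a :* u₃ :+ :- (b :* v₃))
              v₂ = O :+ (a :* v₃ :+ b :* u₃)
              u₁ = c₁ :+ (a :* u₂ :+ :- (b :* v₂))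
              v₁ = O :+ (a :* v₂ :+ b :* u₂)
          in O :+ (a :* v₁ :+ b :* u₁) := κ :* (4 :× (A :* A :* A :* B) :- 4 :× (A :* (B :* B :* B))))
          refl κ p q a b)

      -- A quantitative form of p + q z = 0: the values of f tend to 0 along the approximations of
      -- z, and `modulus-bound` carries this over to the linear form. The choice d = δ² bounds its
      -- real and imaginary parts by δ.
      root-near : ∀ z → IsComplexRoot f z → ∀ δ → 0ℚ < δ → ∃ λ N → ∀ n → N ℕ.≤ n →
        ∣ p + q * seq (re z) n ∣ < δ × ∣ q * seq (im z) n ∣ < δ
      root-near z (re≈0 , im≈0) δ 0<δ = M ℕ.⊔ N , near
        where
        d = δ * δ
        0<d : 0ℚ < d
        0<d = *-pos 0<δ 0<δ
        ε = ½ * (∣ κ ∣ * (d * d))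
        0<ε : 0ℚ < ε
        0<ε = half-pos (*-pos (∣∣-pos κ≢0) (*-pos 0<d 0<d))
        M = proj₁ (re≈0 ε 0<ε)
        N = proj₁ (im≈0 ε 0<ε)
        near : ∀ n → M ℕ.⊔ N ℕ.≤ n → ∣ p + q * seq (re z) n ∣ < δ × ∣ q * seq (im z) n ∣ < δ
        near n l = square<⇒∣∣< 0<δ (ℚₚ.≤-<-trans A²≤s s<d) , square<⇒∣∣< 0<δ (ℚₚ.≤-<-trans B²≤s s<d)
          where
          a b A′ B′ : ℚ
          a = seq (re z) n
          b = seq (im z) n
          A′ = p + q * a
          B′ = q * b
          small : ∀ {x y} w → ∣ x - 0ℚ ∣ < ε → x ≡ y → y ≡ w → ∣ w ∣ < ε
          small {x} w h e e′ = subst (λ u → ∣ u ∣ < ε) (trans (ℚₚ.+-identityʳ x) (trans e e′)) h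
          s<d : A′ * A′ + B′ * B′ < d
          s<d = modulus-bound κ A′ B′ κ≢0 0<d
            (small _ (proj₂ (re≈0 ε 0<ε) n (ℕₚ.m⊔n≤o⇒m≤o M N l)) (seq-re f z n) (evRe-f a b))
            (small _ (proj₂ (im≈0 ε 0<ε) n (ℕₚ.m⊔n≤o⇒n≤o M N l)) (seq-im f z n) (evIm-f a b))
          A²≤s : A′ * A′ ≤ A′ * A′ + B′ * B′
          A²≤s = subst (_≤ A′ * A′ + B′ * B′) (ℚₚ.+-identityʳ (A′ * A′)) (ℚₚ.+-monoʳ-≤ (A′ * A′) (0≤square B′))
          B²≤s : B′ * B′ ≤ A′ * A′ + B′ * B′
          B²≤s = subst (_≤ A′ * A′ + B′ * B′) (ℚₚ.+-identityˡ (B′ * B′)) (ℚₚ.+-monoˡ-≤ (B′ * B′) (0≤square A′))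

      close : ∀ x y u v η → x - y ≡ q * (u - v) → ∣ x ∣ < ½ * (∣ q ∣ * η) → ∣ y ∣ < ½ * (∣ q ∣ * η) → ∣ u - v ∣ < η
      close x y u v η e hx hy = ℚₚ.*-cancelˡ-<-nonNeg ∣ q ∣ {{ℚ.nonNegative (ℚₚ.0≤∣p∣ q)}} (begin-strict
        ∣ q ∣ * ∣ u - v ∣                      ≡⟨ ℚₚ.∣p*q∣≡∣p∣*∣q∣ q (u - v) ⟨
        ∣ q * (u - v) ∣                        ≡⟨ cong ∣_∣ e ⟨
        ∣ x - y ∣                              ≤⟨ ℚₚ.∣p-q∣≤∣p∣+∣q∣ x y ⟩
        ∣ x ∣ + ∣ y ∣                          <⟨ ℚₚ.+-mono-< hx hy ⟩
        ½ * (∣ q ∣ * η) + ½ * (∣ q ∣ * η)      ≡⟨ ½+½ (∣ q ∣ * η) ⟩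
        ∣ q ∣ * η                              ∎)
        where open ℚₚ.≤-Reasoning

    -- At both roots p + q z and p + q w tend to 0, and so does their difference q (z - w). Dividing
    -- by the nonzero rational q gives equality of Cauchy reals without deciding anything about
    -- them.
    fourthPower⇒singleRoot : ¬ HasTwoDifferentComplexRoots f
    fourthPower⇒singleRoot (z , w , z≉w , fz≈0 , fw≈0) = z≉w
      ( (λ η 0<η → within η 0<η λ n hz hw → close (p + q * seq (re z) n) (p + q * seq (re w) n) (seq (re z) n)
        (seq (re w) n) η
          (solve 4 (λ p q u v → (p :+ q :* u) :- (p :+ q :* v) := q :* (u :- v)) refl p q (seq (re z) n) (seq (re w) n))
            (proj₁ hz) (proj₁ hw))
      , (λ η 0<η → within η 0<η λ n hz hw → close (q * seq (im z) n) (q * seq (im w) n) (seq (im z) n) (seq (im w) n) η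
          (solve 3 (λ q u v → q :* u :- q :* v := q :* (u :- v)) refl q (seq (im z) n) (seq (im w) n)) (proj₂ hz)
            (proj₂ hw)))
      where
      Near : ℂ → ℚ → ℕ → Set
      Near z δ n = ∣ p + q * seq (re z) n ∣ < δ × ∣ q * seq (im z) n ∣ < δ
      within : ∀ η → 0ℚ < η → {P : ℕ → Set} →
        (∀ n → Near z (½ * (∣ q ∣ * η)) n → Near w (½ * (∣ q ∣ * η)) n → P n) → ∃ λ N → ∀ n → N ℕ.≤ n → P n
      within η 0<η h = both (root-near z fz≈0 δ 0<δ) (root-near w fw≈0 δ 0<δ)
        where
        δ = ½ * (∣ q ∣ * η)
        0<δ : 0ℚ < δ
        0<δ = half-pos (*-pos (∣∣-pos q≢0) 0<η)
        both : (∃ λ N → ∀ n → N ℕ.≤ n → Near z δ n) → (∃ λ N → ∀ n → N ℕ.≤ n → Near w δ n) → ∃ λ N → ∀ n → N ℕ.≤ n → _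
        both (M , hz) (N , hw) = M ℕ.⊔ N , λ n l → h n (hz n (ℕₚ.m⊔n≤o⇒m≤o M N l)) (hw n (ℕₚ.m⊔n≤o⇒n≤o M N l))

open ComplexRoots

-- The quartic case

module QuarticCase where
  open import Data.Rational.Base using (_+_; _*_; -_; _-_; _<_; _≤_; ∣_∣)
  open ≡
  open ≡-Reasoning
  open ℚ-Solver
  open Identities ℚₚ.+-*-commutativeRing
  open SemiringMult (CommutativeRing.semiring ℚₚ.+-*-commutativeRing) using (×-assoc-*; ×-congʳ; ×-comm-*)

  form-cong : ∀ {c₀ c₁ c₂ c₃ c₄ d₀ d₁ d₂ d₃ d₄} a b → c₀ ≡ d₀ → c₁ ≡ d₁ → c₂ ≡ d₂ → c₃ ≡ d₃ → c₄ ≡ d₄ →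
    form c₀ c₁ c₂ c₃ c₄ a b ≡ form d₀ d₁ d₂ d₃ d₄ a b
  form-cong a b refl refl refl refl refl = refl

  -- The data of the quartic construction are w = y/x, V = 2 x - w², p = w²/V and γ = 2 h₂/V; a good
  -- point is one where these quotients exist and w ≠ 0.
  good-point⇒certificate : ∀ {c h₂ h₃ h₄} P → OnCurve c P → Good c P → c ≢ 0ℚ → ¬ (h₂ ≡ 0ℚ × h₃ ≡ 0ℚ × h₄ ≡ 0ℚ) →
    Certificate c 0ℚ h₂ h₃ h₄
  good-point⇒certificate {c} {h₂} {h₃} {h₄} (x , y) on (y≢0 , x²≢c) c≢0 h≢0 = fromSlope (divide y x x≢0)
    where
    x≢0 : x ≢ 0ℚ
    x≢0 x≡0 = y≢0 (square≡0 (trans on (trans (cong (λ x → x * x * x + c * x + 0ℚ) x≡0)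
      (solve 1 (λ c → con (ℤ.+ 0) :* con (ℤ.+ 0) :* con (ℤ.+ 0) :+ c :* con (ℤ.+ 0) :+ con (ℤ.+ 0) := con
        (ℤ.+ 0)) refl c))))
    fromSlope : (∃ λ w → w * x ≡ y) → Certificate c 0ℚ h₂ h₃ h₄
    fromSlope (w , wx≡y) = fromQuotients (divide (w * w) V V≢0) (divide (2 · h₂) V V≢0)
      where
      factored : x * (w * w) ≡ x * x + c
      factored = x-y≡0⇒x≡y {x * (w * w)} {x * x + c} (noZeroDivisorsℚ {x} (begin
        x * (x * (w * w) - (x * x + c))
          ≡⟨ solve 3 (λ x w c → x :* (x :* (w :* w) :- (x :* x :+ c)) := (w :* x) :* (w :* x) :-
            (x :* x :* x :+ c :* x :+ con (ℤ.+ 0))) refl x w c ⟩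
        (w * x) * (w * x) - (x * x * x + c * x + 0ℚ)
          ≡⟨ x≡y⇒x-y≡0 (trans (cong₂ _*_ wx≡y wx≡y) on) ⟩
        0ℚ ∎) x≢0)
      V = 2 · x - w * w
      V≢0 : V ≢ 0ℚ
      V≢0 V≡0 = x²≢c (x-y≡0⇒x≡y {x * x} {c} (begin
        x * x - c                                       ≡⟨ solve 3 (λ x w c → x :* x :- c := x :* (2 :× x :- w :* w) :+
          (x :* (w :* w) :- (x :* x :+ c))) refl x w c ⟩
        x * V + (x * (w * w) - (x * x + c))             ≡⟨ cong₂ _+_ (*≡0ʳ x V≡0) (x≡y⇒x-y≡0 factored) ⟩
        0ℚ                                              ∎))
      w≢0 : w ≢ 0ℚ
      w≢0 w≡0 = y≢0 (trans (sym wx≡y) (*≡0ˡ x w≡0))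
      fromQuotients : (∃ λ p → p * V ≡ w * w) → (∃ λ γ → γ * V ≡ 2 · h₂) → Certificate c 0ℚ h₂ h₃ h₄
      fromQuotients (p , pV) (γ , γV) = Quartic.certificate₄ w V c h₂ h₃ h₄ p γ pV (trans (ℚₚ.*-comm V γ) γV)
        w≢0 V≢0 c≢0 (point-identity x w c factored) h≢0

  module _ (f : Poly) (f≤4 : deg≤ 4 f) (twoRoots : HasTwoDifferentComplexRoots f) (c₄≢0 : coeff f 4 ≢ 0ℚ) (t : ℚ) where
    private
      c₀ = coeff f 0
      c₁ = coeff f 1
      c₂ = coeff f 2
      c₃ = coeff f 3
      c₄ = coeff f 4

      -- The Taylor coefficients of f at t, the fourth being c₄ itself.
      g₀ g₁ g₂ g₃ : ℚ
      g₀ = c₀ + t * (c₁ + t * (c₂ + t * (c₃ + t * c₄)))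
      g₁ = c₁ + t * (2 · c₂ + t * (3 · c₃ + t * (4 · c₄)))
      g₂ = c₂ + t * (3 · c₃ + t * (6 · c₄))
      g₃ = c₃ + t * (4 · c₄)

      ev-f : ∀ r → evalℚ f r ≡ c₀ + r * (c₁ + r * (c₂ + r * (c₃ + r * (c₄ + r * 0ℚ))))
      ev-f r = ≈ₚ⇒ev≡ f (c₀ ∷ c₁ ∷ c₂ ∷ c₃ ∷ c₄ ∷ []) (coeffs-≤4 f f≤4) r

      ev-f-t : evalℚ f t ≡ g₀
      ev-f-t = trans (ev-f t) (solve 6 (λ c₀ c₁ c₂ c₃ c₄ t → c₀ :+ t :*
        (c₁ :+ t :* (c₂ :+ t :* (c₃ :+ t :* (c₄ :+ t :* con (ℤ.+ 0)))))
        := c₀ :+ t :* (c₁ :+ t :* (c₂ :+ t :* (c₃ :+ t :* c₄)))) refl c₀ c₁ c₂ c₃ c₄ t)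

      ev-f-shifted : ∀ r → evalℚ f r ≡ form g₀ g₁ g₂ g₃ c₄ (r - t) 1ℚ
      ev-f-shifted r = begin
        evalℚ f r                                  ≡⟨ ev-f r ⟩
        c₀ + r * (c₁ + r * (c₂ + r * (c₃ + r * (c₄ + r * 0ℚ))))  ≡⟨ ev-form c₀ c₁ c₂ c₃ c₄ r ⟩
        form c₀ c₁ c₂ c₃ c₄ r 1ℚ                   ≡⟨ cong₂ (form c₀ c₁ c₂ c₃ c₄)
          (solve 2 (λ r t → r := con (ℤ.+ 1) :* (r :- t) :+ t :* con (ℤ.+ 1)) refl r t)
          (solve 2 (λ r t → con (ℤ.+ 1) := con (ℤ.+ 0) :* (r :- t) :+ con (ℤ.+ 1) :* con (ℤ.+ 1)) refl r t) ⟩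
        form c₀ c₁ c₂ c₃ c₄ (1ℚ * (r - t) + t * 1ℚ) (0ℚ * (r - t) + 1ℚ * 1ℚ)  ≡⟨ form-shift c₀ c₁ c₂ c₃ c₄ t (r - t) 1ℚ ⟩
        form g₀ g₁ g₂ g₃ c₄ (r - t) 1ℚ             ∎

      -- t is a root of f: exchanging t and ∞ leads to a polynomial of degree ≤ 3.
      root-certificate : g₀ ≡ 0ℚ → Certificate c₀ c₁ c₂ c₃ c₄
      root-certificate g₀≡0 = shift c₀ c₁ c₂ c₃ c₄ t (swap g₀ g₁ g₂ g₃ c₄
        -- If the remaining coefficients vanished, f would be c₄ (r - t)⁴, against the assumption on
        -- the roots.
        (subst (Certificate c₄ g₃ g₂ g₁) (sym g₀≡0) (certificate≤3 c₄ g₃ g₂ g₁ λ (g₃≡0 , g₂≡0 , g₁≡0) →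
          fourthPower⇒singleRoot f c₄ (- t) 1ℚ c₄≢0 (λ ()) (λ r → begin
            evalℚ f r                               ≡⟨ ev-f-shifted r ⟩
            form g₀ g₁ g₂ g₃ c₄ (r - t) 1ℚ          ≡⟨ form-cong (r - t) 1ℚ g₀≡0 g₁≡0 g₂≡0 g₃≡0 refl ⟩
            form 0ℚ 0ℚ 0ℚ 0ℚ c₄ (r - t) 1ℚ          ≡⟨ form-a4 c₄ (r - t) 1ℚ ⟩
            c₄ * ((r - t) * (r - t) * ((r - t) * (r - t)))
              ≡⟨ cong (λ u → c₄ * (u * u * (u * u))) (solve 2 (λ r t → r :- t := :- t :+ con (ℤ.+ 1) :* r) refl r t) ⟩
            c₄ * ((- t + 1ℚ * r) * (- t + 1ℚ * r) * ((- t + 1ℚ * r) * (- t + 1ℚ * r)))  ∎) twoRoots)))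

      -- Otherwise a projective change of coordinate fixing t kills the linear coefficient.
      nonRoot-certificate : g₀ ≢ 0ℚ → InfinitelyManyRationalPoints g₀ → Certificate c₀ c₁ c₂ c₃ c₄
      -- The value e = - g₁/(4 g₀) is the one for which the sheared linear coefficient 4 e g₀ + g₁
      -- vanishes.
      nonRoot-certificate g₀≢0 points = fromShear (divide (- g₁) (4 · g₀) (·≢0 3 g₀≢0))
        where
        fromShear : (∃ λ e → e * (4 · g₀) ≡ - g₁) → Certificate c₀ c₁ c₂ c₃ c₄
        fromShear (e , eg) = shift c₀ c₁ c₂ c₃ c₄ t (shear g₀ g₁ g₂ g₃ c₄ e
          (subst (λ h₁ → Certificate g₀ h₁ h₂ h₃ h₄) (sym h₁≡0)
            (let P , on , good = good-point g₀ points in good-point⇒certificate P on good g₀≢0 h≢0)))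
          where
          h₁ h₂ h₃ h₄ : ℚ
          h₁ = 4 · (e * g₀) + g₁
          h₂ = 6 · (e * e * g₀) + 3 · (e * g₁) + g₂
          h₃ = 4 · (e * e * e * g₀) + 3 · (e * e * g₁) + 2 · (e * g₂) + g₃
          h₄ = e * e * e * e * g₀ + e * e * e * g₁ + e * e * g₂ + e * g₃ + c₄
          h₁≡0 : h₁ ≡ 0ℚ
          h₁≡0 = trans (cong (_+ g₁) (trans (sym (×-comm-* 4 e g₀)) eg)) (ℚₚ.+-inverseˡ g₁)
          -- For e = 0 the shear is the identity and h₄ would be c₄, which is nonzero.
          e≢0 : h₄ ≡ 0ℚ → e ≢ 0ℚ
          e≢0 h₄≡0 e≡0 = c₄≢0 (trans (trans
            (solve 5 (λ g₀ g₁ g₂ g₃ c₄ → let e = con (ℤ.+ 0) in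
              c₄ := e :* e :* e :* e :* g₀ :+ e :* e :* e :* g₁ :+ e :* e :* g₂ :+ e :* g₃ :+ c₄) refl g₀ g₁ g₂ g₃ c₄)
            (cong (λ e → e * e * e * e * g₀ + e * e * e * g₁ + e * e * g₂ + e * g₃ + c₄) (sym e≡0))) h₄≡0)
          h≢0 : ¬ (h₂ ≡ 0ℚ × h₃ ≡ 0ℚ × h₄ ≡ 0ℚ)
          -- If only g₀ survives, undoing the shear at (r - t , 1) by u = r - t, v = 1 - e (r - t)
          -- shows that f is g₀ v⁴, the fourth power of a linear polynomial because e ≠ 0.
          h≢0 (h₂≡0 , h₃≡0 , h₄≡0) = fourthPower⇒singleRoot f g₀ (1ℚ + e * t) (- e) g₀≢0
            (λ -e≡0 → e≢0 h₄≡0 (neg≡0 -e≡0)) (λ r → let u = r - t ; v = 1ℚ - e * (r - t) in begin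
              evalℚ f r                        ≡⟨ ev-f-shifted r ⟩
              form g₀ g₁ g₂ g₃ c₄ (r - t) 1ℚ   ≡⟨ cong₂ (form g₀ g₁ g₂ g₃ c₄)
                (solve 3 (λ r t e → r :- t := con (ℤ.+ 1) :* (r :- t) :+ con (ℤ.+ 0) :*
                  (con (ℤ.+ 1) :- e :* (r :- t))) refl r t e)
                (solve 3 (λ r t e → con (ℤ.+ 1) := e :* (r :- t) :+ con (ℤ.+ 1) :*
                  (con (ℤ.+ 1) :- e :* (r :- t))) refl r t e) ⟩
              form g₀ g₁ g₂ g₃ c₄ (1ℚ * u + 0ℚ * v) (e * u + 1ℚ * v)  ≡⟨ form-shear g₀ g₁ g₂ g₃ c₄ e u v ⟩
              form g₀ h₁ h₂ h₃ h₄ u v          ≡⟨ form-cong u v refl h₁≡0 h₂≡0 h₃≡0 h₄≡0 ⟩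
              form g₀ 0ℚ 0ℚ 0ℚ 0ℚ u v          ≡⟨ form-b4 g₀ u v ⟩
              g₀ * (v * v * (v * v))           ≡⟨ cong (λ v → g₀ * (v * v * (v * v)))
                (solve 3 (λ r t e → con (ℤ.+ 1) :- e :* (r :- t) := (con (ℤ.+ 1) :+ e :* t) :+ (:- e) :* r) refl r t e) ⟩
              g₀ * ((1ℚ + e * t + - e * r) * (1ℚ + e * t + - e * r) *
                ((1ℚ + e * t + - e * r) * (1ℚ + e * t + - e * r))) ∎) twoRoots

    certificate-quartic : InfinitelyManyRationalPoints (evalℚ f t) → Certificate c₀ c₁ c₂ c₃ c₄
    certificate-quartic points = decide (g₀ ℚₚ.≟ 0ℚ)
      where
      decide : Dec (g₀ ≡ 0ℚ) → Certificate c₀ c₁ c₂ c₃ c₄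
      decide (yes g₀≡0) = root-certificate g₀≡0
      decide (no  g₀≢0) = nonRoot-certificate g₀≢0 (subst InfinitelyManyRationalPoints ev-f-t points)

open QuarticCase

theorem2p1 : (f : Poly) → NonConstantPoly f → deg≤ 4 f → HasTwoDifferentComplexRoots f →
    (deg≤ 3 f → ∃[ φ ] (NonConstant φ × HasNonTorsionSection (ℰ (f ∘ᶠ φ))))
    ×
    (deg≡ 4 f → (∃[ t₀ ] InfinitelyManyRationalPoints (evalℚ f t₀)) →
    ∃[ ψ ] (NonConstant ψ × HasNonTorsionSection (ℰ (f ∘ᶠ ψ))))
theorem2p1 f nonConstant f≤4 twoRoots =
    (λ f≤3 → certificate⇒section f f≤4
      (≡.subst (Certificate (coeff f 0) (coeff f 1) (coeff f 2) (coeff f 3)) (≡.sym (f≤3 4 ℕₚ.≤-refl))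
        (certificate≤3 (coeff f 0) (coeff f 1) (coeff f 2) (coeff f 3) λ (c₁≡0 , c₂≡0 , c₃≡0) →
          nonConstant (coeff f 0 , λ
            { 0 → ≡.refl ; 1 → c₁≡0 ; 2 → c₂≡0 ; 3 → c₃≡0
            ; (suc (suc (suc (suc i)))) → f≤3 _ (s≤s (s≤s (s≤s (s≤s z≤n)))) }))))
  , (λ (c₄≢0 , _) (t₀ , points) → certificate⇒section f f≤4 (certificate-quartic f f≤4 twoRoots c₄≢0 t₀ points))
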